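{- There are absolute constants $C, C'>0$ such that for every non-constant function $f\colon\{0,1\}^n\to\{0,1\}$ there is a non-empty $S\subseteq[n]$ with $|S|\leq C'\,\tilde{I}[f]$ and \[ |\widehat{f}(S)|\geq 2^{ -C\cdot |S|\log(1+\tilde{I}[f])}\sqrt{\mathrm{var}(f)} . \] In particular, $H_{\infty}[\widehat f]\leq O\big(\tilde{I}[f]\log(1+\tilde{I}[f])\big)$, where the implied constant is absolute.
   Context: $\{0,1\}^n$ carries the uniform measure; $\langle f,g\rangle=\mathbb{E}_x[f(x)g(x)]$, $\|f\|_2=\langle f,f\rangle^{1/2}$. For $S\subseteq[n]$, $\chi_S(x)=(-1)^{\sum_{i\in S}x_i}$ and $\widehat f(S)=\langle f,\chi_S\rangle$, so $f=\sum_S\widehat f(S)\chi_S$. The total influence is $I[f]=\sum_{S}|S|\widehat f(S)^2$ (equivalently $\sum_i\|\partial_i f\|_2^2$ with $\partial_i f=\frac12(f_{i\to0}-f_{i\to1})$; using instead $\sum_i\Pr_x[f(x)\ne f(x\oplus e_i)]$ only changes $I[f]$ by a factor $4$). $\mathrm{var}(f)=\mathbb{E}[f^2]-\mathbb{E}[f]^2$ and $\tilde I[f]=I[f]/\mathrm{var}(f)$. The Fourier min-entropy is $H_\infty[\widehat f]=\min_{S\subseteq[n]}\log(1/\widehat f(S)^2)$. $\log$ is the natural logarithm. -}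

module Defs where

open import Data.Bool using (Bool; true; false; if_then_else_; _∧_; _xor_)
open import Data.Nat as ℕ using (ℕ; zero; suc)
open import Data.Integer as ℤ using (ℤ)
open import Data.Vec using (Vec; []; _∷_; zipWith; foldr)
open import Data.List using (List; []; _∷_; map; _++_)
open import Data.Rational using (ℚ; 0ℚ; 1ℚ; _+_; _*_; _-_; -_; _÷_; ≢-nonZero; _/_)
open import Data.Rational.Properties using (_≟_)
open import Relation.Nullary using (yes; no)

-- Points of the cube {0,1}^n, and subsets S ⊆ [n] (as indicator vectors,
-- which is exactly Data.Fin.Subset n = Vec Bool n).
Cube : ℕ → Set
Cube n = Vec Bool n

cube : (n : ℕ) → List (Cube n)
cube zero = [] ∷ []
cube (suc n) = map (false ∷_) (cube n) ++ map (true ∷_) (cube n)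

card : ∀ {n} → Cube n → ℕ
card [] = 0
card (true ∷ s) = suc (card s)
card (false ∷ s) = card s

sumℚ : List ℚ → ℚ
sumℚ [] = 0ℚ
sumℚ (q ∷ qs) = q + sumℚ qs

fromℕ : ℕ → ℚ
fromℕ k = ℤ.+ k / 1

_^ℚ_ : ℚ → ℕ → ℚ
q ^ℚ zero = 1ℚ
q ^ℚ suc k = q * (q ^ℚ k)

-- Division, with the (never used in the statement) convention p/0 = 0.
_÷₀_ : ℚ → ℚ → ℚ
p ÷₀ q with q ≟ 0ℚ
... | yes _ = 0ℚ
... | no q≢0 = _÷_ p q {{≢-nonZero q≢0}}

val : Bool → ℚ
val true = 1ℚ
val false = 0ℚ

𝔼 : (n : ℕ) → (Cube n → ℚ) → ℚ
𝔼 n g = sumℚ (map g (cube n)) ÷₀ fromℕ (2 ℕ.^ n)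

χ : ∀ {n} → Cube n → Cube n → ℚ
χ S x = if foldr _ _xor_ false (zipWith _∧_ S x) then - 1ℚ else 1ℚ

fhat : ∀ {n} → (Cube n → Bool) → Cube n → ℚ
fhat {n} f S = 𝔼 n (λ x → val (f x) * χ S x)

var : ∀ {n} → (Cube n → Bool) → ℚ
var {n} f = 𝔼 n (λ x → val (f x) * val (f x)) - (𝔼 n (λ x → val (f x)) ^ℚ 2)

Inf : ∀ {n} → (Cube n → Bool) → ℚ
Inf {n} f = sumℚ (map (λ S → fromℕ (card S) * (fhat f S ^ℚ 2)) (cube n))

tildeI : ∀ {n} → (Cube n → Bool) → ℚ
tildeI f = Inf f ÷₀ var f

NonConstant : ∀ {n} → (Cube n → Bool) → Set
NonConstant {n} f = Σ (Cube n) λ x → Σ (Cube n) λ y → f x ≢ f y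
  where open import Data.Product using (Σ)
        open import Relation.Binary.PropositionalEquality using (_≢_)

NonEmpty : ∀ {n} → Cube n → Set
NonEmpty S = 1 ℕ.≤ card S

{-# OPTIONS --safe #-}
-- Suppose every coefficient with 1 ≤ |S| ≤ O(Ĩ) satisfies f̂(S)² < (1+Ĩ)^(-D|S|), and let u be
-- the part of f̂ on these S; it carries at least half of the variance.  The pairing Σ f̂·u is
-- nevertheless shown to be a small multiple of var f.
--
-- * Sets of size at most τ = O(log(1+Ĩ)) are peeled off through a coordinate i of small influence
--   in u: the derivative of f in direction i takes the values 0, ±½ only, and Bonami's inequality
--   makes the part of u through i pointwise small (up to a factor 9^τ, polynomial in Ĩ).  Sets all
--   of whose coordinates are influential are too few to matter.
-- * Larger sets are split along a partition of the coordinates into A and B.  By counting, T is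
--   light on one side, say A, up to negligible mass, i.e. Σ u(T′)² over the T′ with T′∩A = T∩A is
--   at most (Kδ)^|T∩A|, where δ^|T| is the bound on u(T)².  Then T∩A is kept as a frequency and
--   the variables of B are fixed: by Bonami the new coefficients are pointwise at most
--   (K′δ)^|S| up to a small tail, and one recurses on the restricted (still Boolean) function.
-- * Each round costs a constant factor in δ.  A partition chosen by averaging makes large pieces
--   rare, so that O(log(1+Ĩ)) rounds suffice and δ is lost only up to a power of 1+Ĩ.
--
-- When the norm of u exceeds a power of 1+Ĩ after a restriction, the pairing is bounded directly
-- using |f| ≤ 1.
module Submission where

open import Defs
open import Data.Bool using (Bool; true; false; if_then_else_; _∧_; _xor_; not)
open import Data.Empty using (⊥; ⊥-elim)
open import Data.Fin using (Fin; zero; suc; toℕ)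
open import Data.Integer as ℤ using (∣_∣)
import Data.Integer.Properties as ℤₚ
open import Data.List using ([]; _∷_; map; _++_)
open import Data.List.Properties using (map-++; map-∘)
open import Data.Nat using (ℕ; zero; suc)
import Data.Nat as ℕ
import Data.Nat.Coprimality as Coprime
import Data.Nat.Properties as ℕₚ
open import Data.Nat.Solver using () renaming (module +-*-Solver to ℕ-Solver)
open import Data.Product using (Σ; _×_; _,_; proj₁; proj₂)
open import Data.Rational using (ℚ; 0ℚ; 1ℚ; ½; mkℚ; _+_; _*_; _-_; -_; 1/_; _/_; _≤_; _<_; *≤*; ↥_; ↧ₙ_; nonNegative; positive; ≢-nonZero)
open import Data.Rational.Properties
  using (≤-refl; ≤-reflexive; ≤-trans; ≤-total; <⇒≤; ≰⇒>; <-irrefl; <-≤-trans; _≤?_; _≟_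
        ; +-mono-≤; +-mono-<; +-monoˡ-≤; +-monoʳ-≤; +-assoc; +-comm; +-identityˡ; +-identityʳ
        ; *-assoc; *-comm; *-identityˡ; *-identityʳ; *-zeroˡ; *-zeroʳ; *-distribˡ-+; *-distribʳ-+
        ; *-monoˡ-≤-nonNeg; *-monoʳ-≤-nonNeg; *-monoʳ-<-pos; *-cancelʳ-≤-pos; *-inverseˡ; *-inverseʳ
        ; neg-antimono-≤; nonNegative⁻¹; positive⁻¹; normalize-coprime; toℚᵘ-injective; toℚᵘ-homo-*; module ≤-Reasoning)
open import Data.Rational.Solver using (module +-*-Solver)
import Data.Rational.Unnormalised as ℚᵘ
import Data.Rational.Unnormalised.Properties as ℚᵘₚ
open import Data.Sum using (_⊎_; inj₁; inj₂)
open import Data.Vec using ([]; _∷_; lookup; replicate)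
open import Function using (_∘_)
open import Relation.Binary.PropositionalEquality using (_≡_; _≢_; refl; sym; trans; cong; cong₂; subst; subst₂; module ≡-Reasoning)
open import Relation.Nullary using (¬_; Dec; yes; no; does; _×-dec_)
open +-*-Solver using (solve; con; _:+_; _:*_; _:-_; :-_; _:=_)
open ℕ-Solver using () renaming (solve to solveℕ; con to conℕ; _:+_ to _:⊕_; _:*_ to _:⊗_; _:=_ to _:≡_)

-- The coefficients `u` are kept apart from the function. A restriction of `φ` is again Boolean, but
-- its own Fourier coefficients need not be small; `u` consists of mere test coefficients and may be
-- cut off wherever it becomes large. Hence the induction concerns the bilinear `pair f u`, and `u`
-- is a part of `hat f` only at the start. The induction hypothesis is linear in energy, mass,
-- triples and influence, since the means of these over all restrictions are known exactly. Both
-- sides of a mask see the whole energy, so its coefficient doubles in each round, whereas mass and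
-- influence are shared between the sides. For `J` rounds the energy coefficient must therefore
-- start near `2^-J`, which makes the large sets at the last level cost about `2^J`. Triples lose a
-- factor 4 per round, so `4^-J` turns this cost into about `2^-J`, which beats the polynomial
-- number of triples in a set once `J` is logarithmic. Logarithms, square roots and optimal weights
-- are replaced by integer exponents of 2: `k`, `l` and `h` measure the errors relative to energy,
-- mass and influence.

2ℚ 3ℚ : ℚ
2ℚ = 1ℚ + 1ℚ
3ℚ = 2ℚ + 1ℚ

-- Inequalities and powers in the rationals

0≤1 : 0ℚ ≤ 1ℚ
0≤1 = nonNegative⁻¹ 1ℚ

0≤½ : 0ℚ ≤ ½
0≤½ = nonNegative⁻¹ ½

0≤2 : 0ℚ ≤ 2ℚ
0≤2 = nonNegative⁻¹ 2ℚ

0≤3 : 0ℚ ≤ 3ℚ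
0≤3 = nonNegative⁻¹ 3ℚ

*-monoˡ : ∀ c {a b} → 0ℚ ≤ c → a ≤ b → c * a ≤ c * b
*-monoˡ c 0≤c = *-monoˡ-≤-nonNeg c {{nonNegative 0≤c}}

*-monoʳ : ∀ c {a b} → 0ℚ ≤ c → a ≤ b → a * c ≤ b * c
*-monoʳ c 0≤c = *-monoʳ-≤-nonNeg c {{nonNegative 0≤c}}

0≤+ : ∀ {a b} → 0ℚ ≤ a → 0ℚ ≤ b → 0ℚ ≤ a + b
0≤+ p q = +-mono-≤ p q

0≤* : ∀ {a b} → 0ℚ ≤ a → 0ℚ ≤ b → 0ℚ ≤ a * b
0≤* {a} {b} p q = ≤-trans (≤-reflexive (sym (*-zeroʳ a))) (*-monoˡ a p q)

*-mono-≤ : ∀ {a b c d} → 0ℚ ≤ a → 0ℚ ≤ c → a ≤ b → c ≤ d → a * c ≤ b * d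
*-mono-≤ {a} {b} {c} {d} 0≤a 0≤c a≤b c≤d = ≤-trans (*-monoˡ a 0≤a c≤d) (*-monoʳ d (≤-trans 0≤c c≤d) a≤b)

0≤sq : ∀ a → 0ℚ ≤ a * a
0≤sq a with ≤-total 0ℚ a
... | inj₁ p = 0≤* p p
... | inj₂ p = subst (0ℚ ≤_) (solve 1 (λ a → (:- a) :* (:- a) := a :* a) refl a) (0≤* (neg-antimono-≤ p) (neg-antimono-≤ p))

≤-gap : ∀ {a b} r → 0ℚ ≤ r → b ≡ a + r → a ≤ b
≤-gap {a} {b} r 0≤r refl = subst (_≤ a + r) (+-identityʳ a) (+-mono-≤ (≤-refl {a}) 0≤r)

gap-≤ : ∀ {a b} → a ≤ b → 0ℚ ≤ b - a
gap-≤ {a} {b} p = subst (_≤ b - a) (solve 1 (λ a → a :- a := con 0ℚ) refl a) (+-mono-≤ p (≤-refl { - a}))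

≤+ʳ : ∀ {a} b → 0ℚ ≤ b → a ≤ a + b
≤+ʳ b 0≤b = ≤-gap b 0≤b refl

≤+ˡ : ∀ {a} b → 0ℚ ≤ b → a ≤ b + a
≤+ˡ {a} b 0≤b = ≤-gap b 0≤b (+-comm b a)

^-nonNeg : ∀ {q} → 0ℚ ≤ q → ∀ k → 0ℚ ≤ q ^ℚ k
^-nonNeg p zero = 0≤1
^-nonNeg p (suc k) = 0≤* p (^-nonNeg p k)

^-+ : ∀ q a b → q ^ℚ (a ℕ.+ b) ≡ (q ^ℚ a) * (q ^ℚ b)
^-+ q zero b = sym (*-identityˡ _)
^-+ q (suc a) b = trans (cong (q *_) (^-+ q a b)) (sym (*-assoc q (q ^ℚ a) (q ^ℚ b)))

^-distrib-* : ∀ p q k → (p * q) ^ℚ k ≡ (p ^ℚ k) * (q ^ℚ k)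
^-distrib-* p q zero = refl
^-distrib-* p q (suc k) rewrite ^-distrib-* p q k =
  solve 4 (λ p q x y → p :* q :* (x :* y) := (p :* x) :* (q :* y)) refl p q (p ^ℚ k) (q ^ℚ k)

1^ : ∀ k → 1ℚ ^ℚ k ≡ 1ℚ
1^ zero = refl
1^ (suc k) = trans (*-identityˡ _) (1^ k)

^-* : ∀ q a b → q ^ℚ (a ℕ.* b) ≡ (q ^ℚ a) ^ℚ b
^-* q zero b = sym (1^ b)
^-* q (suc a) b = trans (^-+ q b (a ℕ.* b)) (trans (cong ((q ^ℚ b) *_) (^-* q a b)) (sym (^-distrib-* q (q ^ℚ a) b)))

^-monoˡ : ∀ {p q} → 0ℚ ≤ p → p ≤ q → ∀ k → p ^ℚ k ≤ q ^ℚ k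
^-monoˡ 0≤p p≤q zero = ≤-refl
^-monoˡ 0≤p p≤q (suc k) = *-mono-≤ 0≤p (^-nonNeg 0≤p k) p≤q (^-monoˡ 0≤p p≤q k)

1≤^ : ∀ {q} → 1ℚ ≤ q → ∀ k → 1ℚ ≤ q ^ℚ k
1≤^ {q} 1≤q k = subst (_≤ q ^ℚ k) (1^ k) (^-monoˡ 0≤1 1≤q k)

^-monoʳ : ∀ {q} → 1ℚ ≤ q → ∀ {a b} → a ℕ.≤ b → q ^ℚ a ≤ q ^ℚ b
^-monoʳ 1≤q {b = b} ℕ.z≤n = 1≤^ 1≤q b
^-monoʳ {q} 1≤q (ℕ.s≤s a≤b) = *-monoˡ q (≤-trans 0≤1 1≤q) (^-monoʳ 1≤q a≤b)

1≤2 : 1ℚ ≤ 2ℚ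
1≤2 = ≤+ʳ 1ℚ 0≤1

0≤2^ : ∀ k → 0ℚ ≤ 2ℚ ^ℚ k
0≤2^ = ^-nonNeg 0≤2

0≤½^ : ∀ k → 0ℚ ≤ ½ ^ℚ k
0≤½^ = ^-nonNeg 0≤½

2^*½^ : ∀ k → (2ℚ ^ℚ k) * (½ ^ℚ k) ≡ 1ℚ
2^*½^ k = trans (sym (^-distrib-* 2ℚ ½ k)) (1^ k)

½^-antimono : ∀ {a b} → a ℕ.≤ b → ½ ^ℚ b ≤ ½ ^ℚ a
½^-antimono {b = b} ℕ.z≤n = lemma b
  where
  lemma : ∀ b → ½ ^ℚ b ≤ 1ℚ
  lemma b = subst (½ ^ℚ b ≤_) (1^ b) (^-monoˡ 0≤½ (≤-gap ½ 0≤½ refl) b)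
½^-antimono (ℕ.s≤s p) = *-monoˡ ½ 0≤½ (½^-antimono p)

-- Weighted arithmetic-geometric mean: the gap is a sum of squares once `2^k * ½^k = 1` is used. The
-- exponent `k` replaces an optimised real weight and later trades little energy of `f` against much
-- mass of `u`.
xy≤ : ∀ k x y → x * y ≤ (½ ^ℚ k) * (x * x) + (2ℚ ^ℚ k) * (y * y)
xy≤ k x y = ≤-gap (¾ * (h * (x * x)) + t * ((½ * h * x - y) * (½ * h * x - y)))
  (0≤+ (0≤* (nonNegative⁻¹ ¾) (0≤* (0≤½^ k) (0≤sq x))) (0≤* (0≤2^ k) (0≤sq (½ * h * x - y))))
  (begin
  h * (x * x) + t * (y * y)
    -- The ring solver does not know `t * h = 1`; explicit factors `1ℚ` mark the places where the
    -- product is substituted next.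
    ≡⟨ solve 4 (λ x y h t → h :* (x :* x) :+ t :* (y :* y)
        := con 1ℚ :* (x :* y) :+ (con ¾ :* (h :* (x :* x)) :+ (con (1ℚ - ¾) :* con 1ℚ :* (h :* (x :* x)) :+ t :* (y :* y) :- con 1ℚ :* (x :* y)))) refl x y h t ⟩
  1ℚ * (x * y) + (¾ * (h * (x * x)) + ((1ℚ - ¾) * 1ℚ * (h * (x * x)) + t * (y * y) - 1ℚ * (x * y)))
    ≡⟨ cong (λ o → 1ℚ * (x * y) + (¾ * (h * (x * x)) + ((1ℚ - ¾) * o * (h * (x * x)) + t * (y * y) - o * (x * y)))) (sym (2^*½^ k)) ⟩
  1ℚ * (x * y) + (¾ * (h * (x * x)) + ((1ℚ - ¾) * (t * h) * (h * (x * x)) + t * (y * y) - t * h * (x * y)))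
    ≡⟨ solve 4 (λ x y h t → con 1ℚ :* (x :* y) :+ (con ¾ :* (h :* (x :* x)) :+ (con (1ℚ - ¾) :* (t :* h) :* (h :* (x :* x)) :+ t :* (y :* y) :- t :* h :* (x :* y)))
        := x :* y :+ (con ¾ :* (h :* (x :* x)) :+ t :* ((con ½ :* h :* x :- y) :* (con ½ :* h :* x :- y)))) refl x y h t ⟩
  x * y + (¾ * (h * (x * x)) + t * ((½ * h * x - y) * (½ * h * x - y))) ∎)
  where
  open ≡-Reasoning
  h = ½ ^ℚ k
  t = 2ℚ ^ℚ k
  ¾ = ½ + ½ * ½

-- Indicators and positive linear functionals

infixr 5 _when_
_when_ : ∀ {P : Set} → ℚ → Dec P → ℚ
q when yes _ = q
q when no _ = 0ℚ

-- Averages over the cube, sums over the cube and sums over coordinates share linearity and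
-- monotonicity; the abstraction lets the interchange of any two of them be proved once.
record Functional (X : Set) : Set where
  field
    ∫ : (X → ℚ) → ℚ
    ∫-cong : ∀ {g h} → (∀ x → g x ≡ h x) → ∫ g ≡ ∫ h
    ∫-+ : ∀ g h → ∫ (λ x → g x + h x) ≡ ∫ g + ∫ h
    ∫-*ˡ : ∀ c g → ∫ (λ x → c * g x) ≡ c * ∫ g
    ∫-mono : ∀ {g h} → (∀ x → g x ≤ h x) → ∫ g ≤ ∫ h

  ∫-0 : ∫ (λ _ → 0ℚ) ≡ 0ℚ
  ∫-0 = trans (∫-cong (λ _ → sym (*-zeroˡ 0ℚ))) (trans (∫-*ˡ 0ℚ (λ _ → 0ℚ)) (*-zeroˡ (∫ (λ _ → 0ℚ))))

  ∫-nonNeg : ∀ {g} → (∀ x → 0ℚ ≤ g x) → 0ℚ ≤ ∫ g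
  ∫-nonNeg p = ≤-trans (≤-reflexive (sym ∫-0)) (∫-mono p)

  ∫-*ʳ : ∀ c g → ∫ (λ x → g x * c) ≡ ∫ g * c
  ∫-*ʳ c g = trans (∫-cong (λ x → *-comm (g x) c)) (trans (∫-*ˡ c g) (*-comm c _))

  ∫-lin : ∀ c g h → ∫ (λ x → c * (g x + h x)) ≡ c * (∫ g + ∫ h)
  ∫-lin c g h = trans (∫-*ˡ c _) (cong (c *_) (∫-+ g h))

  ∫-neg : ∀ g → ∫ (λ x → - g x) ≡ - ∫ g
  ∫-neg g = trans (∫-cong (λ x → solve 1 (λ a → :- a := con (- 1ℚ) :* a) refl (g x)))
            (trans (∫-*ˡ (- 1ℚ) g) (solve 1 (λ a → con (- 1ℚ) :* a := :- a) refl (∫ g)))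

  ∫-- : ∀ g h → ∫ (λ x → g x - h x) ≡ ∫ g - ∫ h
  ∫-- g h = trans (∫-+ g (λ x → - h x)) (cong (∫ g +_) (∫-neg h))

open Functional public

private
  wsum : ℚ → ∀ {n} → (Cube n → ℚ) → ℚ
  wsum w {zero} g = g []
  wsum w {suc n} g = w * (wsum w (λ T → g (false ∷ T)) + wsum w (λ T → g (true ∷ T)))

  finsum : ∀ {n} → (Fin n → ℚ) → ℚ
  finsum {zero} g = 0ℚ
  finsum {suc n} g = g zero + finsum (g ∘ suc)

opaque
  -- The weight acts once per coordinate, so `½` gives the uniform mean and `1` the plain sum, and
  -- points and frequencies are treated by one construction. Opacity keeps goals folded; evaluation
  -- goes through `cubeF-[]` and `cubeF-∷`.
  cubeF : ∀ w → 0ℚ ≤ w → ∀ n → Functional (Cube n)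
  cubeF w 0≤w n = record { ∫ = wsum w ; ∫-cong = c ; ∫-+ = p n ; ∫-*ˡ = s n ; ∫-mono = m }
    where
    c : ∀ {n} {g h : Cube n → ℚ} → (∀ x → g x ≡ h x) → wsum w g ≡ wsum w h
    c {zero} e = e []
    c {suc n} e = cong (w *_) (cong₂ _+_ (c (e ∘ (false ∷_))) (c (e ∘ (true ∷_))))
    p : ∀ n (g h : Cube n → ℚ) → wsum w (λ x → g x + h x) ≡ wsum w g + wsum w h
    p zero g h = refl
    p (suc n) g h = trans (cong (w *_) (cong₂ _+_ (p n _ _) (p n _ _)))
      (solve 5 (λ w a b c d → w :* ((a :+ b) :+ (c :+ d)) := w :* (a :+ c) :+ w :* (b :+ d)) refl w
        (wsum w (g ∘ (false ∷_))) (wsum w (h ∘ (false ∷_))) (wsum w (g ∘ (true ∷_))) (wsum w (h ∘ (true ∷_))))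
    s : ∀ n k (g : Cube n → ℚ) → wsum w (λ x → k * g x) ≡ k * wsum w g
    s zero k g = refl
    s (suc n) k g = trans (cong (w *_) (cong₂ _+_ (s n k _) (s n k _)))
      (solve 4 (λ w k a b → w :* (k :* a :+ k :* b) := k :* (w :* (a :+ b))) refl w k (wsum w (g ∘ (false ∷_))) (wsum w (g ∘ (true ∷_))))
    m : ∀ {n} {g h : Cube n → ℚ} → (∀ x → g x ≤ h x) → wsum w g ≤ wsum w h
    m {zero} e = e []
    m {suc n} e = *-monoˡ w 0≤w (+-mono-≤ (m (e ∘ (false ∷_))) (m (e ∘ (true ∷_))))

  cubeF-[] : ∀ {w} {p : 0ℚ ≤ w} (g : Cube 0 → ℚ) → ∫ (cubeF w p 0) g ≡ g []
  cubeF-[] g = refl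

  cubeF-∷ : ∀ {w} {p : 0ℚ ≤ w} {n} (g : Cube (suc n) → ℚ) →
    ∫ (cubeF w p (suc n)) g ≡ w * (∫ (cubeF w p n) (g ∘ (false ∷_)) + ∫ (cubeF w p n) (g ∘ (true ∷_)))
  cubeF-∷ g = refl

  finF : ∀ n → Functional (Fin n)
  finF n = record { ∫ = finsum ; ∫-cong = c ; ∫-+ = p n ; ∫-*ˡ = s n ; ∫-mono = m }
    where
    c : ∀ {n} {g h : Fin n → ℚ} → (∀ x → g x ≡ h x) → finsum g ≡ finsum h
    c {zero} e = refl
    c {suc n} e = cong₂ _+_ (e zero) (c (e ∘ suc))
    p : ∀ n (g h : Fin n → ℚ) → finsum (λ x → g x + h x) ≡ finsum g + finsum h
    p zero g h = refl
    p (suc n) g h = trans (cong ((g zero + h zero) +_) (p n _ _))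
      (solve 4 (λ a b c d → (a :+ b) :+ (c :+ d) := (a :+ c) :+ (b :+ d)) refl (g zero) (h zero) (finsum (g ∘ suc)) (finsum (h ∘ suc)))
    s : ∀ n k (g : Fin n → ℚ) → finsum (λ x → k * g x) ≡ k * finsum g
    s zero k g = sym (*-zeroʳ k)
    s (suc n) k g = trans (cong (k * g zero +_) (s n k _)) (sym (*-distribˡ-+ k _ _))
    m : ∀ {n} {g h : Fin n → ℚ} → (∀ x → g x ≤ h x) → finsum g ≤ finsum h
    m {zero} e = ≤-refl
    m {suc n} e = +-mono-≤ (e zero) (m (e ∘ suc))

  finF-[] : (g : Fin 0 → ℚ) → ∫ (finF 0) g ≡ 0ℚ
  finF-[] g = refl

  finF-∷ : ∀ {n} (g : Fin (suc n) → ℚ) → ∫ (finF (suc n)) g ≡ g zero + ∫ (finF n) (g ∘ suc)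
  finF-∷ g = refl

EF ΣF : ∀ n → Functional (Cube n)
EF = cubeF ½ 0≤½
ΣF = cubeF 1ℚ 0≤1

E ∑ : ∀ {n} → (Cube n → ℚ) → ℚ
E {n} = ∫ (EF n)
∑ {n} = ∫ (ΣF n)

∑-∷ : ∀ {n} (g : Cube (suc n) → ℚ) → ∑ g ≡ ∑ (g ∘ (false ∷_)) + ∑ (g ∘ (true ∷_))
∑-∷ g = trans (cubeF-∷ g) (*-identityˡ _)

∫-cubeF-swap : ∀ {X : Set} (L : Functional X) {w} {p : 0ℚ ≤ w} {n} (g : X → Cube n → ℚ) →
  ∫ L (λ x → ∫ (cubeF w p n) (g x)) ≡ ∫ (cubeF w p n) (λ T → ∫ L (λ x → g x T))
∫-cubeF-swap L {n = zero} g = trans (∫-cong L (λ x → cubeF-[] (g x))) (sym (cubeF-[] _))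
∫-cubeF-swap L {w} {n = suc n} g = begin
  ∫ L (λ x → ∫ (cubeF w _ (suc n)) (g x))
    ≡⟨ ∫-cong L (λ x → cubeF-∷ (g x)) ⟩
  ∫ L (λ x → w * (∫ (cubeF w _ n) (g x ∘ (false ∷_)) + ∫ (cubeF w _ n) (g x ∘ (true ∷_))))
    ≡⟨ ∫-lin L w _ _ ⟩
  w * (∫ L (λ x → ∫ (cubeF w _ n) (g x ∘ (false ∷_))) + ∫ L (λ x → ∫ (cubeF w _ n) (g x ∘ (true ∷_))))
    ≡⟨ cong (w *_) (cong₂ _+_ (∫-cubeF-swap L (λ x → g x ∘ (false ∷_))) (∫-cubeF-swap L (λ x → g x ∘ (true ∷_)))) ⟩
  w * (∫ (cubeF w _ n) (λ T → ∫ L (λ x → g x (false ∷ T))) + ∫ (cubeF w _ n) (λ T → ∫ L (λ x → g x (true ∷ T))))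
    ≡⟨ sym (cubeF-∷ _) ⟩
  ∫ (cubeF w _ (suc n)) (λ T → ∫ L (λ x → g x T)) ∎
  where open ≡-Reasoning

∫-finF-swap : ∀ {X : Set} (L : Functional X) {n} (g : X → Fin n → ℚ) →
  ∫ L (λ x → ∫ (finF n) (g x)) ≡ ∫ (finF n) (λ i → ∫ L (λ x → g x i))
∫-finF-swap L {zero} g = trans (∫-cong L (λ x → finF-[] (g x))) (trans (∫-0 L) (sym (finF-[] _)))
∫-finF-swap L {suc n} g = trans (∫-cong L (λ x → finF-∷ (g x))) (trans (∫-+ L _ _)
  (trans (cong (∫ L (λ x → g x zero) +_) (∫-finF-swap L (λ x → g x ∘ suc))) (sym (finF-∷ _))))

-- Fourier analysis on the cube

infix 8 _²
_² : ℚ → ℚ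
a ² = a * a

sgn : Bool → ℚ
sgn true = - 1ℚ
sgn false = 1ℚ

-- The character as a product of signs, one per coordinate, which fits recursion on the cube and
-- factors along a mask.
χᵣ : ∀ {n} → Cube n → Cube n → ℚ
χᵣ [] [] = 1ℚ
χᵣ (s ∷ S) (x ∷ X) = sgn (s ∧ x) * χᵣ S X

hat : ∀ {n} → (Cube n → ℚ) → Cube n → ℚ
hat f T = E (λ x → f x * χᵣ T x)

-- The inverse Fourier transform of arbitrary coefficients; `u` need not be the transform of a
-- Boolean function.
ev : ∀ {n} → (Cube n → ℚ) → Cube n → ℚ
ev u x = ∑ (λ T → u T * χᵣ T x)

pair : ∀ {n} → (Cube n → ℚ) → (Cube n → ℚ) → ℚ
pair f u = ∑ (λ T → hat f T * u T)

norm² : ∀ {n} → (Cube n → ℚ) → ℚ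
norm² u = ∑ (λ T → u T ²)

hat-[] : (f : Cube 0 → ℚ) → hat f [] ≡ f []
hat-[] f = trans (cubeF-[] _) (*-identityʳ _)

hat-false : ∀ {n} (f : Cube (suc n) → ℚ) T → hat f (false ∷ T) ≡ hat (λ x → ½ * (f (false ∷ x) + f (true ∷ x))) T
hat-false f T = trans (cubeF-∷ _) (trans (sym (∫-lin (EF _) ½ _ _))
  (∫-cong (EF _) (λ x → solve 3 (λ a b c → con ½ :* (a :* (con 1ℚ :* c) :+ b :* (con 1ℚ :* c)) := con ½ :* (a :+ b) :* c) refl (f (false ∷ x)) (f (true ∷ x)) (χᵣ T x))))

hat-true : ∀ {n} (f : Cube (suc n) → ℚ) T → hat f (true ∷ T) ≡ hat (λ x → ½ * (f (false ∷ x) - f (true ∷ x))) T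
hat-true f T = trans (cubeF-∷ _) (trans (sym (∫-lin (EF _) ½ _ _))
  (∫-cong (EF _) (λ x → solve 3 (λ a b c → con ½ :* (a :* (con 1ℚ :* c) :+ b :* (con (- 1ℚ) :* c)) := con ½ :* (a :- b) :* c) refl (f (false ∷ x)) (f (true ∷ x)) (χᵣ T x))))

hat-cong : ∀ {n} {f g : Cube n → ℚ} → (∀ x → f x ≡ g x) → ∀ T → hat f T ≡ hat g T
hat-cong e T = ∫-cong (EF _) (λ x → cong (_* χᵣ T x) (e x))

hat-+ : ∀ {n} (f g : Cube n → ℚ) T → hat (λ x → f x + g x) T ≡ hat f T + hat g T
hat-+ f g T = trans (∫-cong (EF _) (λ x → *-distribʳ-+ (χᵣ T x) (f x) (g x))) (∫-+ (EF _) _ _)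

hat-*ˡ : ∀ {n} c (f : Cube n → ℚ) T → hat (λ x → c * f x) T ≡ c * hat f T
hat-*ˡ c f T = trans (∫-cong (EF _) (λ x → *-assoc c (f x) (χᵣ T x))) (∫-*ˡ (EF _) c _)

parseval : ∀ {n} (f : Cube n → ℚ) → norm² (hat f) ≡ E (λ x → f x ²)
parseval {zero} f = trans (cubeF-[] _) (trans (cong _² (hat-[] f)) (sym (cubeF-[] _)))
parseval {suc n} f = begin
  norm² (hat f) ≡⟨ ∑-∷ _ ⟩
  ∑ (λ T → hat f (false ∷ T) ²) + ∑ (λ T → hat f (true ∷ T) ²)
    ≡⟨ cong₂ _+_ (∫-cong (ΣF n) (λ T → cong _² (hat-false f T))) (∫-cong (ΣF n) (λ T → cong _² (hat-true f T))) ⟩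
  norm² (hat s) + norm² (hat d) ≡⟨ cong₂ _+_ (parseval s) (parseval d) ⟩
  E (λ x → s x ²) + E (λ x → d x ²) ≡⟨ sym (∫-+ (EF n) _ _) ⟩
  E (λ x → s x ² + d x ²)
    ≡⟨ ∫-cong (EF n) (λ x → solve 2 (λ a b → con ½ :* (a :+ b) :* (con ½ :* (a :+ b)) :+ con ½ :* (a :- b) :* (con ½ :* (a :- b)) := con ½ :* (a :* a :+ b :* b)) refl (f (false ∷ x)) (f (true ∷ x))) ⟩
  E (λ x → ½ * (f (false ∷ x) ² + f (true ∷ x) ²)) ≡⟨ ∫-lin (EF n) ½ _ _ ⟩
  ½ * (E (λ x → f (false ∷ x) ²) + E (λ x → f (true ∷ x) ²)) ≡⟨ sym (cubeF-∷ _) ⟩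
  E (λ x → f x ²) ∎
  where
  open ≡-Reasoning
  s d : Cube n → ℚ
  s x = ½ * (f (false ∷ x) + f (true ∷ x))
  d x = ½ * (f (false ∷ x) - f (true ∷ x))

ev-[] : (u : Cube 0 → ℚ) → ev u [] ≡ u []
ev-[] u = trans (cubeF-[] _) (*-identityʳ _)

ev-false : ∀ {n} (u : Cube (suc n) → ℚ) x → ev u (false ∷ x) ≡ ev (u ∘ (false ∷_)) x + ev (u ∘ (true ∷_)) x
ev-false u x = trans (∑-∷ _) (cong₂ _+_
  (∫-cong (ΣF _) (λ T → cong (u (false ∷ T) *_) (*-identityˡ (χᵣ T x))))
  (∫-cong (ΣF _) (λ T → cong (u (true ∷ T) *_) (*-identityˡ (χᵣ T x)))))

ev-true : ∀ {n} (u : Cube (suc n) → ℚ) x → ev u (true ∷ x) ≡ ev (u ∘ (false ∷_)) x - ev (u ∘ (true ∷_)) x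
ev-true u x = trans (∑-∷ _) (cong₂ _+_
  (∫-cong (ΣF _) (λ T → cong (u (false ∷ T) *_) (*-identityˡ (χᵣ T x))))
  (trans (∫-cong (ΣF _) (λ T → solve 2 (λ a c → a :* (con (- 1ℚ) :* c) := :- (a :* c)) refl (u (true ∷ T)) (χᵣ T x))) (∫-neg (ΣF _) _)))

parseval-ev : ∀ {n} (u : Cube n → ℚ) → E (λ x → ev u x ²) ≡ norm² u
parseval-ev {zero} u = trans (cubeF-[] _) (trans (cong _² (ev-[] u)) (sym (cubeF-[] _)))
parseval-ev {suc n} u = begin
  E (λ x → ev u x ²) ≡⟨ cubeF-∷ _ ⟩
  ½ * (E (λ x → ev u (false ∷ x) ²) + E (λ x → ev u (true ∷ x) ²)) ≡⟨ sym (∫-lin (EF n) ½ _ _) ⟩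
  E (λ x → ½ * (ev u (false ∷ x) ² + ev u (true ∷ x) ²))
    ≡⟨ ∫-cong (EF n) (λ x → trans (cong₂ (λ a b → ½ * (a ² + b ²)) (ev-false u x) (ev-true u x))
         (solve 2 (λ a b → con ½ :* ((a :+ b) :* (a :+ b) :+ (a :- b) :* (a :- b)) := a :* a :+ b :* b) refl (ev u₀ x) (ev u₁ x))) ⟩
  E (λ x → ev u₀ x ² + ev u₁ x ²) ≡⟨ ∫-+ (EF n) _ _ ⟩
  E (λ x → ev u₀ x ²) + E (λ x → ev u₁ x ²) ≡⟨ cong₂ _+_ (parseval-ev u₀) (parseval-ev u₁) ⟩
  norm² u₀ + norm² u₁ ≡⟨ sym (∑-∷ _) ⟩
  norm² u ∎
  where
  open ≡-Reasoning
  u₀ u₁ : Cube n → ℚ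
  u₀ = u ∘ (false ∷_)
  u₁ = u ∘ (true ∷_)

plancherel : ∀ {n} (f u : Cube n → ℚ) → pair f u ≡ E (λ x → f x * ev u x)
plancherel {n} f u = begin
  ∑ (λ T → E (λ x → f x * χᵣ T x) * u T) ≡⟨ ∫-cong (ΣF n) (λ T → sym (∫-*ʳ (EF n) (u T) _)) ⟩
  ∑ (λ T → E (λ x → f x * χᵣ T x * u T)) ≡⟨ sym (∫-cubeF-swap (EF n) _) ⟩
  E (λ x → ∑ (λ T → f x * χᵣ T x * u T))
    ≡⟨ ∫-cong (EF n) (λ x → trans (∫-cong (ΣF n) (λ T → solve 3 (λ a b c → a :* b :* c := a :* (c :* b)) refl (f x) (χᵣ T x) (u T))) (∫-*ˡ (ΣF n) (f x) _)) ⟩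
  E (λ x → f x * ev u x) ∎
  where open ≡-Reasoning

-- The squared 2-norm of the noise operator with parameter `√3` applied to `ev u`; working with the
-- square keeps it rational.
noisy² : ∀ {n} → (Cube n → ℚ) → ℚ
noisy² u = ∑ (λ T → (3ℚ ^ℚ card T) * u T ²)

noisy²-nonNeg : ∀ {n} (u : Cube n → ℚ) → 0ℚ ≤ noisy² u
noisy²-nonNeg u = ∫-nonNeg (ΣF _) (λ T → 0≤* (^-nonNeg 0≤3 (card T)) (0≤sq (u T)))

noisy²-∷ : ∀ {n} (u : Cube (suc n) → ℚ) → noisy² u ≡ noisy² (u ∘ (false ∷_)) + 3ℚ * noisy² (u ∘ (true ∷_))
noisy²-∷ u = trans (∑-∷ _) (cong (noisy² (u ∘ (false ∷_)) +_)
  (trans (∫-cong (ΣF _) (λ T → *-assoc 3ℚ (3ℚ ^ℚ card T) (u (true ∷ T) ²))) (∫-*ˡ (ΣF _) 3ℚ _)))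

-- Averaging over the sign of one coordinate cancels the odd terms. The only mixed term left is
-- `4pqrs`, at most `2p²s² + 2q²r²`, and this turns the coefficient 1 of those two products into 3.
bonami-step : ∀ p q r s →
  ½ * ((p + q) ² * (r + s) ² + (p - q) ² * (r - s) ²) ≤ (p ² * r ² + 3ℚ * (p ² * s ²)) + (3ℚ * (q ² * r ²) + q ² * s ²)
bonami-step p q r s = ≤-gap (2ℚ * (p * s - q * r) ²) (0≤* 0≤2 (0≤sq (p * s - q * r)))
  (solve 4 (λ p q r s → (p :* p :* (r :* r) :+ con 3ℚ :* (p :* p :* (s :* s))) :+ (con 3ℚ :* (q :* q :* (r :* r)) :+ q :* q :* (s :* s))
     := con ½ :* ((p :+ q) :* (p :+ q) :* ((r :+ s) :* (r :+ s)) :+ (p :- q) :* (p :- q) :* ((r :- s) :* (r :- s)))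
        :+ con 2ℚ :* ((p :* s :- q :* r) :* (p :* s :- q :* r))) refl p q r s)

bonami-close : ∀ a b c d → 0ℚ ≤ b → 0ℚ ≤ d → (a * c + 3ℚ * (a * d)) + (3ℚ * (b * c) + b * d) ≤ (a + 3ℚ * b) * (c + 3ℚ * d)
bonami-close a b c d 0≤b 0≤d = ≤-gap ((3ℚ * 3ℚ - 1ℚ) * (b * d)) (0≤* (nonNegative⁻¹ (3ℚ * 3ℚ - 1ℚ)) (0≤* 0≤b 0≤d))
  (solve 4 (λ a b c d → (a :+ con 3ℚ :* b) :* (c :+ con 3ℚ :* d)
     := (a :* c :+ con 3ℚ :* (a :* d)) :+ (con 3ℚ :* (b :* c) :+ b :* d) :+ con (3ℚ * 3ℚ - 1ℚ) :* (b :* d)) refl a b c d)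

-- Bonami's (2,4)-inequality.  Proving it for two functions at once lets the
-- cross terms be handled by the induction hypothesis, without Cauchy–Schwarz.
bonami : ∀ {n} (u w : Cube n → ℚ) → E (λ x → ev u x ² * ev w x ²) ≤ noisy² u * noisy² w
bonami {zero} u w = ≤-reflexive (trans (cubeF-[] _) (trans (cong₂ (λ a b → a ² * b ²) (ev-[] u) (ev-[] w))
  (sym (cong₂ _*_ (trans (cubeF-[] _) (*-identityˡ (u [] ²))) (trans (cubeF-[] _) (*-identityˡ (w [] ²)))))))
bonami {suc n} u w = begin
  E (λ x → ev u x ² * ev w x ²) ≡⟨ cubeF-∷ _ ⟩
  ½ * (E (λ x → ev u (false ∷ x) ² * ev w (false ∷ x) ²) + E (λ x → ev u (true ∷ x) ² * ev w (true ∷ x) ²))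
    ≡⟨ sym (∫-lin (EF n) ½ _ _) ⟩
  E (λ x → ½ * (ev u (false ∷ x) ² * ev w (false ∷ x) ² + ev u (true ∷ x) ² * ev w (true ∷ x) ²))
    ≤⟨ ∫-mono (EF n) pointwise ⟩
  E (λ x → (ev u₀ x ² * ev w₀ x ² + 3ℚ * (ev u₀ x ² * ev w₁ x ²)) + (3ℚ * (ev u₁ x ² * ev w₀ x ²) + ev u₁ x ² * ev w₁ x ²))
    ≡⟨ trans (∫-+ (EF n) _ _) (cong₂ _+_ (trans (∫-+ (EF n) _ _) (cong (E (λ x → ev u₀ x ² * ev w₀ x ²) +_) (∫-*ˡ (EF n) 3ℚ _)))
                                          (trans (∫-+ (EF n) _ _) (cong (_+ E (λ x → ev u₁ x ² * ev w₁ x ²)) (∫-*ˡ (EF n) 3ℚ _)))) ⟩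
  (E (λ x → ev u₀ x ² * ev w₀ x ²) + 3ℚ * E (λ x → ev u₀ x ² * ev w₁ x ²)) + (3ℚ * E (λ x → ev u₁ x ² * ev w₀ x ²) + E (λ x → ev u₁ x ² * ev w₁ x ²))
    ≤⟨ +-mono-≤ (+-mono-≤ (bonami u₀ w₀) (*-monoˡ 3ℚ 0≤3 (bonami u₀ w₁))) (+-mono-≤ (*-monoˡ 3ℚ 0≤3 (bonami u₁ w₀)) (bonami u₁ w₁)) ⟩
  (a * c + 3ℚ * (a * d)) + (3ℚ * (b * c) + b * d)
    ≤⟨ bonami-close a b c d (noisy²-nonNeg u₁) (noisy²-nonNeg w₁) ⟩
  (a + 3ℚ * b) * (c + 3ℚ * d) ≡⟨ sym (cong₂ _*_ (noisy²-∷ u) (noisy²-∷ w)) ⟩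
  noisy² u * noisy² w ∎
  where
  open ≤-Reasoning
  u₀ = u ∘ (false ∷_)
  u₁ = u ∘ (true ∷_)
  w₀ = w ∘ (false ∷_)
  w₁ = w ∘ (true ∷_)
  a = noisy² u₀
  b = noisy² u₁
  c = noisy² w₀
  d = noisy² w₁
  pointwise : ∀ x → ½ * (ev u (false ∷ x) ² * ev w (false ∷ x) ² + ev u (true ∷ x) ² * ev w (true ∷ x) ²)
    ≤ (ev u₀ x ² * ev w₀ x ² + 3ℚ * (ev u₀ x ² * ev w₁ x ²)) + (3ℚ * (ev u₁ x ² * ev w₀ x ²) + ev u₁ x ² * ev w₁ x ²)
  pointwise x = ≤-trans (≤-reflexive (cong₂ (λ a b → ½ * (a + b))
    (cong₂ (λ a b → a ² * b ²) (ev-false u x) (ev-false w x)) (cong₂ (λ a b → a ² * b ²) (ev-true u x) (ev-true w x))))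
    (bonami-step (ev u₀ x) (ev u₁ x) (ev w₀ x) (ev w₁ x))

-- Restrictions of functions and slices of coefficients

neg : ∀ {n} → Cube n → Cube n
neg [] = []
neg (a ∷ A) = not a ∷ neg A

-- The two blocks have cubes of their own, of dimensions `card A` and `card (neg A)`, so that a
-- restriction is a function on a genuine smaller cube and the induction hypothesis applies to it.
merge : ∀ {n} (A : Cube n) → Cube (card A) → Cube (card (neg A)) → Cube n
merge [] S R = []
merge (true ∷ A) (s ∷ S) R = s ∷ merge A S R
merge (false ∷ A) S (r ∷ R) = r ∷ merge A S R

sel : ∀ {n} (A : Cube n) → Cube n → Cube (card A)
sel [] [] = []
sel (true ∷ A) (t ∷ T) = t ∷ sel A T
sel (false ∷ A) (t ∷ T) = sel A T

sel-merge : ∀ {n} (A : Cube n) S R → sel A (merge A S R) ≡ S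
sel-merge [] [] R = refl
sel-merge (true ∷ A) (s ∷ S) R = cong (s ∷_) (sel-merge A S R)
sel-merge (false ∷ A) S (r ∷ R) = sel-merge A S R

sel-neg-merge : ∀ {n} (A : Cube n) S R → sel (neg A) (merge A S R) ≡ R
sel-neg-merge [] S [] = refl
sel-neg-merge (true ∷ A) (s ∷ S) R = sel-neg-merge A S R
sel-neg-merge (false ∷ A) S (r ∷ R) = cong (r ∷_) (sel-neg-merge A S R)

merge-sel : ∀ {n} (A : Cube n) T → merge A (sel A T) (sel (neg A) T) ≡ T
merge-sel [] [] = refl
merge-sel (true ∷ A) (t ∷ T) = cong (t ∷_) (merge-sel A T)
merge-sel (false ∷ A) (t ∷ T) = cong (t ∷_) (merge-sel A T)

card-merge : ∀ {n} (A : Cube n) S R → card (merge A S R) ≡ card S ℕ.+ card R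
card-merge [] [] [] = refl
card-merge (true ∷ A) (true ∷ S) R = cong suc (card-merge A S R)
card-merge (true ∷ A) (false ∷ S) R = card-merge A S R
card-merge (false ∷ A) S (true ∷ R) = trans (cong suc (card-merge A S R)) (sym (ℕₚ.+-suc (card S) (card R)))
card-merge (false ∷ A) S (false ∷ R) = card-merge A S R

card-sel : ∀ {n} (A : Cube n) T → card (sel A T) ℕ.+ card (sel (neg A) T) ≡ card T
card-sel A T = trans (sym (card-merge A (sel A T) (sel (neg A) T))) (cong card (merge-sel A T))

-- Double complementation is not the identity by computation, and the two selections live in
-- different types; only their sizes are compared.
card-sel-neg-neg : ∀ {n} (A : Cube n) T → card (sel (neg (neg A)) T) ≡ card (sel A T)
card-sel-neg-neg [] [] = refl
card-sel-neg-neg (true ∷ A) (true ∷ T) = cong suc (card-sel-neg-neg A T)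
card-sel-neg-neg (true ∷ A) (false ∷ T) = card-sel-neg-neg A T
card-sel-neg-neg (false ∷ A) (t ∷ T) = card-sel-neg-neg A T

χᵣ-merge : ∀ {n} (A : Cube n) S R x z → χᵣ (merge A S R) (merge A x z) ≡ χᵣ S x * χᵣ R z
χᵣ-merge [] [] [] [] [] = refl
χᵣ-merge (true ∷ A) (s ∷ S) R (x ∷ X) z = trans (cong (sgn (s ∧ x) *_) (χᵣ-merge A S R X z)) (sym (*-assoc (sgn (s ∧ x)) _ _))
χᵣ-merge (false ∷ A) S (r ∷ R) X (z ∷ Z) = trans (cong (sgn (r ∧ z) *_) (χᵣ-merge A S R X Z))
  (solve 3 (λ a b c → a :* (b :* c) := b :* (a :* c)) refl (sgn (r ∧ z)) (χᵣ S X) (χᵣ R Z))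

∫-split : ∀ {w} {p : 0ℚ ≤ w} {n} (A : Cube n) (g : Cube n → ℚ) →
  ∫ (cubeF w p n) g ≡ ∫ (cubeF w p (card A)) (λ S → ∫ (cubeF w p (card (neg A))) (λ R → g (merge A S R)))
∫-split [] g = trans (cubeF-[] g) (sym (trans (cubeF-[] _) (cubeF-[] _)))
∫-split {w} (true ∷ A) g = trans (cubeF-∷ g) (trans (cong (w *_) (cong₂ _+_ (∫-split A _) (∫-split A _))) (sym (cubeF-∷ _)))
∫-split {w} (false ∷ A) g = trans (cubeF-∷ g) (trans (cong (w *_) (cong₂ _+_ (∫-split A _) (∫-split A _)))
  (sym (trans (∫-cong (cubeF w _ _) (λ S → cubeF-∷ _)) (∫-lin (cubeF w _ _) w _ _))))

hat-merge : ∀ {n} (A : Cube n) (f : Cube n → ℚ) S R → hat f (merge A S R) ≡ hat (λ z → hat (λ x → f (merge A x z)) S) R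
hat-merge A f S R = begin
  E (λ x → f x * χᵣ (merge A S R) x) ≡⟨ ∫-split A _ ⟩
  E (λ x → E (λ z → f (merge A x z) * χᵣ (merge A S R) (merge A x z)))
    ≡⟨ ∫-cong (EF _) (λ x → ∫-cong (EF _) (λ z → trans (cong (f (merge A x z) *_) (χᵣ-merge A S R x z)) (sym (*-assoc (f (merge A x z)) _ _)))) ⟩
  E (λ x → E (λ z → f (merge A x z) * χᵣ S x * χᵣ R z)) ≡⟨ ∫-cubeF-swap (EF _) _ ⟩
  E (λ z → E (λ x → f (merge A x z) * χᵣ S x * χᵣ R z)) ≡⟨ ∫-cong (EF _) (λ z → ∫-*ʳ (EF _) (χᵣ R z) _) ⟩
  E (λ z → E (λ x → f (merge A x z) * χᵣ S x) * χᵣ R z) ∎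
  where open ≡-Reasoning

restr : ∀ {n} {X : Set} (A : Cube n) → (Cube n → X) → Cube (card (neg A)) → Cube (card A) → X
restr A f z x = f (merge A x z)

slice : ∀ {n} (A : Cube n) → (Cube n → ℚ) → Cube (card A) → Cube (card (neg A)) → ℚ
slice A u S R = u (merge A S R)

-- Plancherel in the variables outside `A` alone: the coordinates of `A` remain frequencies, the
-- others become a point `z`. Through this identity the recursion passes to restrictions.
pair-split : ∀ {n} (A : Cube n) (f u : Cube n → ℚ) →
  pair f u ≡ E (λ z → ∑ (λ S → hat (restr A f z) S * ev (slice A u S) z))
pair-split A f u = begin
  pair f u ≡⟨ ∫-split A _ ⟩
  ∑ (λ S → ∑ (λ R → hat f (merge A S R) * u (merge A S R)))
    ≡⟨ ∫-cong (ΣF _) (λ S → ∫-cong (ΣF _) (λ R → cong (_* u (merge A S R)) (hat-merge A f S R))) ⟩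
  ∑ (λ S → pair (λ z → hat (restr A f z) S) (slice A u S)) ≡⟨ ∫-cong (ΣF _) (λ S → plancherel (λ z → hat (restr A f z) S) (slice A u S)) ⟩
  ∑ (λ S → E (λ z → hat (restr A f z) S * ev (slice A u S) z)) ≡⟨ sym (∫-cubeF-swap (EF _) _) ⟩
  E (λ z → ∑ (λ S → hat (restr A f z) S * ev (slice A u S) z)) ∎
  where open ≡-Reasoning

-- Parseval in the variables outside `A`. With `c` the size, the mean influence of the restrictions
-- is the share of the influence that lies in `A`.
hat²-split : ∀ {n} (A : Cube n) (c : Cube (card A) → ℚ) (f : Cube n → ℚ) →
  E (λ z → ∑ (λ S → c S * hat (restr A f z) S ²)) ≡ ∑ (λ T → c (sel A T) * hat f T ²)
hat²-split A c f = begin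
  E (λ z → ∑ (λ S → c S * hat (restr A f z) S ²)) ≡⟨ ∫-cubeF-swap (EF _) _ ⟩
  ∑ (λ S → E (λ z → c S * hat (restr A f z) S ²)) ≡⟨ ∫-cong (ΣF _) (λ S → ∫-*ˡ (EF _) (c S) _) ⟩
  ∑ (λ S → c S * E (λ z → hat (restr A f z) S ²)) ≡⟨ ∫-cong (ΣF _) (λ S → cong (c S *_) (sym (parseval (λ z → hat (restr A f z) S)))) ⟩
  ∑ (λ S → c S * norm² (hat (λ z → hat (restr A f z) S)))
    ≡⟨ ∫-cong (ΣF _) (λ S → sym (∫-*ˡ (ΣF _) (c S) _)) ⟩
  ∑ (λ S → ∑ (λ R → c S * hat (λ z → hat (restr A f z) S) R ²))
    ≡⟨ ∫-cong (ΣF _) (λ S → ∫-cong (ΣF _) (λ R → cong₂ (λ a b → c a * b ²) (sym (sel-merge A S R)) (sym (hat-merge A f S R)))) ⟩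
  ∑ (λ S → ∑ (λ R → c (sel A (merge A S R)) * hat f (merge A S R) ²)) ≡⟨ sym (∫-split A _) ⟩
  ∑ (λ T → c (sel A T) * hat f T ²) ∎
  where open ≡-Reasoning

ev²-split : ∀ {n} (A : Cube n) (c : Cube (card A) → ℚ) (u : Cube n → ℚ) →
  E (λ z → ∑ (λ S → c S * ev (slice A u S) z ²)) ≡ ∑ (λ T → c (sel A T) * u T ²)
ev²-split A c u = begin
  E (λ z → ∑ (λ S → c S * ev (slice A u S) z ²)) ≡⟨ ∫-cubeF-swap (EF _) _ ⟩
  ∑ (λ S → E (λ z → c S * ev (slice A u S) z ²)) ≡⟨ ∫-cong (ΣF _) (λ S → trans (∫-*ˡ (EF _) (c S) _) (cong (c S *_) (parseval-ev (slice A u S)))) ⟩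
  ∑ (λ S → c S * norm² (slice A u S)) ≡⟨ ∫-cong (ΣF _) (λ S → sym (∫-*ˡ (ΣF _) (c S) _)) ⟩
  ∑ (λ S → ∑ (λ R → c S * u (merge A S R) ²))
    ≡⟨ ∫-cong (ΣF _) (λ S → ∫-cong (ΣF _) (λ R → cong (λ a → c a * u (merge A S R) ²) (sym (sel-merge A S R)))) ⟩
  ∑ (λ S → ∑ (λ R → c (sel A (merge A S R)) * u (merge A S R) ²)) ≡⟨ sym (∫-split A _) ⟩
  ∑ (λ T → c (sel A T) * u T ²) ∎
  where open ≡-Reasoning

-- Influences and discrete derivatives

ι : ℕ → ℚ
ι zero = 0ℚ
ι (suc k) = 1ℚ + ι k

ι-nonNeg : ∀ k → 0ℚ ≤ ι k
ι-nonNeg zero = ≤-refl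
ι-nonNeg (suc k) = 0≤+ 0≤1 (ι-nonNeg k)

ι-mono : ∀ {a b} → a ℕ.≤ b → ι a ≤ ι b
ι-mono {b = b} ℕ.z≤n = ι-nonNeg b
ι-mono (ℕ.s≤s p) = +-mono-≤ (≤-refl {1ℚ}) (ι-mono p)

ι-+ : ∀ a b → ι (a ℕ.+ b) ≡ ι a + ι b
ι-+ zero b = sym (+-identityˡ _)
ι-+ (suc a) b = trans (cong (1ℚ +_) (ι-+ a b)) (sym (+-assoc 1ℚ (ι a) (ι b)))

ι≤2^ : ∀ k → ι k ≤ 2ℚ ^ℚ k
ι≤2^ zero = 0≤1
ι≤2^ (suc k) = ≤-trans (+-mono-≤ (1≤^ 1≤2 k) (ι≤2^ k)) (≤-reflexive (solve 1 (λ a → a :+ a := con 2ℚ :* a) refl (2ℚ ^ℚ k)))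

influence : ∀ {n} → (Cube n → ℚ) → ℚ
influence f = ∑ (λ T → ι (card T) * hat f T ²)

influence-nonNeg : ∀ {n} (f : Cube n → ℚ) → 0ℚ ≤ influence f
influence-nonNeg f = ∫-nonNeg (ΣF _) (λ T → 0≤* (ι-nonNeg (card T)) (0≤sq (hat f T)))

norm²-nonNeg : ∀ {n} (u : Cube n → ℚ) → 0ℚ ≤ norm² u
norm²-nonNeg u = ∫-nonNeg (ΣF _) (λ T → 0≤sq (u T))

flip : ∀ {n} → Fin n → Cube n → Cube n
flip zero (b ∷ x) = not b ∷ x
flip (suc i) (b ∷ x) = b ∷ flip i x

E-flip : ∀ {n} i (g : Cube n → ℚ) → E (g ∘ flip i) ≡ E g
E-flip zero g = trans (cubeF-∷ _) (trans (cong (½ *_) (+-comm (E (g ∘ (true ∷_))) (E (g ∘ (false ∷_))))) (sym (cubeF-∷ _)))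
E-flip (suc i) g = trans (cubeF-∷ _) (trans (cong (½ *_) (cong₂ _+_ (E-flip i _) (E-flip i _))) (sym (cubeF-∷ _)))

χᵣ-flip : ∀ {n} i (T x : Cube n) → χᵣ T x ≡ sgn (lookup T i) * χᵣ T (flip i x)
χᵣ-flip zero (true ∷ T) (true ∷ x) = solve 1 (λ c → con (- 1ℚ) :* c := con (- 1ℚ) :* (con 1ℚ :* c)) refl (χᵣ T x)
χᵣ-flip zero (true ∷ T) (false ∷ x) = solve 1 (λ c → con 1ℚ :* c := con (- 1ℚ) :* (con (- 1ℚ) :* c)) refl (χᵣ T x)
χᵣ-flip zero (false ∷ T) (b ∷ x) = sym (*-identityˡ _)
χᵣ-flip (suc i) (t ∷ T) (b ∷ x) = trans (cong (sgn (t ∧ b) *_) (χᵣ-flip i T x))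
  (solve 3 (λ a b c → a :* (b :* c) := b :* (a :* c)) refl (sgn (t ∧ b)) (sgn (lookup T i)) (χᵣ T (flip i x)))

hat-flip : ∀ {n} i (f : Cube n → ℚ) T → hat (f ∘ flip i) T ≡ sgn (lookup T i) * hat f T
hat-flip i f T = begin
  E (λ x → f (flip i x) * χᵣ T x)
    ≡⟨ ∫-cong (EF _) (λ x → trans (cong (f (flip i x) *_) (χᵣ-flip i T x))
         (solve 3 (λ a b c → a :* (b :* c) := b :* (a :* c)) refl (f (flip i x)) (sgn (lookup T i)) (χᵣ T (flip i x)))) ⟩
  E (λ x → sgn (lookup T i) * (f (flip i x) * χᵣ T (flip i x))) ≡⟨ ∫-*ˡ (EF _) (sgn (lookup T i)) _ ⟩
  sgn (lookup T i) * E (λ x → f (flip i x) * χᵣ T (flip i x)) ≡⟨ cong (sgn (lookup T i) *_) (E-flip i (λ x → f x * χᵣ T x)) ⟩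
  sgn (lookup T i) * hat f T ∎
  where open ≡-Reasoning

∂ : ∀ {n} → Fin n → (Cube n → ℚ) → Cube n → ℚ
∂ i f x = ½ * (f x - f (flip i x))

hat-∂ : ∀ {n} i (f : Cube n → ℚ) T → hat (∂ i f) T ≡ val (lookup T i) * hat f T
hat-∂ i f T = begin
  hat (∂ i f) T ≡⟨ hat-*ˡ ½ (λ x → f x - f (flip i x)) T ⟩
  ½ * hat (λ x → f x - f (flip i x)) T
    ≡⟨ cong (½ *_) (trans (hat-cong (λ x → cong (f x +_) (solve 1 (λ a → :- a := con (- 1ℚ) :* a) refl (f (flip i x)))) T)
         (trans (hat-+ f (λ x → - 1ℚ * f (flip i x)) T) (cong (hat f T +_) (trans (hat-*ˡ (- 1ℚ) (f ∘ flip i) T) (cong (- 1ℚ *_) (hat-flip i f T)))))) ⟩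
  ½ * (hat f T + - 1ℚ * (sgn (lookup T i) * hat f T)) ≡⟨ close (lookup T i) (hat f T) ⟩
  val (lookup T i) * hat f T ∎
  where
  open ≡-Reasoning
  close : ∀ b a → ½ * (a + - 1ℚ * (sgn b * a)) ≡ val b * a
  close true a = solve 1 (λ a → con ½ :* (a :+ con (- 1ℚ) :* (con (- 1ℚ) :* a)) := con 1ℚ :* a) refl a
  close false a = solve 1 (λ a → con ½ :* (a :+ con (- 1ℚ) :* (con 1ℚ :* a)) := con 0ℚ :* a) refl a

val² : ∀ b a → (val b * a) ² ≡ val b * a ²
val² true a = solve 1 (λ a → con 1ℚ :* a :* (con 1ℚ :* a) := con 1ℚ :* (a :* a)) refl a
val² false a = solve 1 (λ a → con 0ℚ :* a :* (con 0ℚ :* a) := con 0ℚ :* (a :* a)) refl a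

E-∂² : ∀ {n} i (f : Cube n → ℚ) → E (λ x → ∂ i f x ²) ≡ ∑ (λ T → val (lookup T i) * hat f T ²)
E-∂² i f = trans (sym (parseval (∂ i f))) (∫-cong (ΣF _) (λ T → trans (cong _² (hat-∂ i f T)) (val² (lookup T i) (hat f T))))

∑-val-lookup : ∀ {n} (T : Cube n) → ∫ (finF n) (λ i → val (lookup T i)) ≡ ι (card T)
∑-val-lookup [] = finF-[] _
∑-val-lookup (true ∷ T) = trans (finF-∷ _) (cong (1ℚ +_) (∑-val-lookup T))
∑-val-lookup (false ∷ T) = trans (finF-∷ _) (trans (+-identityˡ _) (∑-val-lookup T))

∑-degree : ∀ {n} (u : Cube n → ℚ) → ∫ (finF n) (λ i → ∑ (λ T → val (lookup T i) * u T ²)) ≡ ∑ (λ T → ι (card T) * u T ²)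
∑-degree u = trans (sym (∫-finF-swap (ΣF _) _)) (∫-cong (ΣF _) (λ T → trans (∫-*ʳ (finF _) (u T ²) _) (cong (_* u T ²) (∑-val-lookup T))))

centred : ∀ {n} → (Cube n → Bool) → ℚ → Cube n → ℚ
centred φ c x = val (φ x) - c

-- Above the level `½ ^ℚ h` the factor `2^h * K` is at least 1, and inserting its cube produces the
-- fourth power, which is what Bonami's inequality controls.
young : ∀ h K → K ≤ (½ ^ℚ h) + (2ℚ ^ℚ h) * (2ℚ ^ℚ h) * (2ℚ ^ℚ h) * (K ² * K ²)
young h K with ≤-total K (½ ^ℚ h)
... | inj₁ K≤ = ≤-trans K≤ (≤+ʳ _ (0≤* (0≤* (0≤* (0≤2^ h) (0≤2^ h)) (0≤2^ h)) (0≤* (0≤sq K) (0≤sq K))))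
... | inj₂ ≤K = ≤-trans (≤-trans (≤-reflexive (sym (*-identityˡ K))) (≤-trans (*-monoʳ K 0≤K 1≤cube)
    (≤-reflexive (solve 2 (λ z k → z :* k :* (z :* k) :* (z :* k) :* k := z :* z :* z :* (k :* k :* (k :* k))) refl z K))))
    (≤+ˡ (½ ^ℚ h) (0≤½^ h))
  where
  z = 2ℚ ^ℚ h
  0≤K : 0ℚ ≤ K
  0≤K = ≤-trans (0≤½^ h) ≤K
  1≤zK : 1ℚ ≤ z * K
  1≤zK = ≤-trans (≤-reflexive (sym (2^*½^ h))) (*-monoˡ z (0≤2^ h) ≤K)
  1≤cube : 1ℚ ≤ z * K * (z * K) * (z * K)
  1≤cube = *-mono-≤ {1ℚ} {z * K * (z * K)} {1ℚ} {z * K} 0≤1 0≤1 (*-mono-≤ {1ℚ} {z * K} {1ℚ} {z * K} 0≤1 0≤1 1≤zK 1≤zK) 1≤zK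

-- The error `½ * ½ ^ℚ h` is written as a multiple of `½ * ½`, the square of the derivative's value:
-- after averaging it becomes influence instead of an additive constant.
half-young : ∀ h K → ½ * K ≤ 2ℚ * (½ ^ℚ h) * (½ * ½) + (2ℚ ^ℚ h) * (2ℚ ^ℚ h) * (2ℚ ^ℚ h) * (K ² * K ²)
half-young h K = ≤-trans (*-monoˡ ½ 0≤½ (young h K))
  (≤-gap (½ * (z * z * z * (K ² * K ²))) (0≤* 0≤½ (0≤* (0≤* (0≤* (0≤2^ h) (0≤2^ h)) (0≤2^ h)) (0≤* (0≤sq K) (0≤sq K))))
    (solve 2 (λ e w → con 2ℚ :* e :* (con ½ :* con ½) :+ w := con ½ :* (e :+ w) :+ con ½ :* w) refl (½ ^ℚ h) (z * z * z * (K ² * K ²))))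
  where z = 2ℚ ^ℚ h

-- The derivative of a Boolean function takes the values 0 and ±½, so it is
-- controlled by its square even when paired with a function that is not small.
∂-young : ∀ h {n} (φ : Cube n → Bool) c i K x → ∂ i (centred φ c) x * K
  ≤ 2ℚ * (½ ^ℚ h) * ∂ i (centred φ c) x ² + (2ℚ ^ℚ h) * (2ℚ ^ℚ h) * (2ℚ ^ℚ h) * (K ² * K ²)
∂-young h φ c i K x = cases (φ x) (φ (flip i x))
  where
  z³ = (2ℚ ^ℚ h) * (2ℚ ^ℚ h) * (2ℚ ^ℚ h)
  d : Bool → Bool → ℚ
  d a b = ½ * ((val a - c) - (val b - c))
  Goal : ℚ → Set
  Goal d = d * K ≤ 2ℚ * (½ ^ℚ h) * d ² + z³ * (K ² * K ²)
  0≤K⁴ : 0ℚ ≤ z³ * (K ² * K ²)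
  0≤K⁴ = 0≤* (0≤* (0≤* (0≤2^ h) (0≤2^ h)) (0≤2^ h)) (0≤* (0≤sq K) (0≤sq K))
  zeroGoal : Goal 0ℚ
  zeroGoal = ≤-gap (z³ * (K ² * K ²)) 0≤K⁴ (solve 3 (λ k e w → con 2ℚ :* e :* (con 0ℚ :* con 0ℚ) :+ w := con 0ℚ :* k :+ w) refl K (½ ^ℚ h) (z³ * (K ² * K ²)))
  negGoal : Goal (- ½)
  negGoal = ≤-trans (≤-reflexive (solve 1 (λ k → con (- ½) :* k := con ½ :* (:- k)) refl K)) (≤-trans (half-young h (- K))
    (≤-reflexive (solve 3 (λ k e w → con 2ℚ :* e :* (con ½ :* con ½) :+ w :* ((:- k) :* (:- k) :* ((:- k) :* (:- k))) := con 2ℚ :* e :* (con (- ½) :* con (- ½)) :+ w :* (k :* k :* (k :* k))) refl K (½ ^ℚ h) z³)))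
  same : ∀ a → ½ * ((a - c) - (a - c)) ≡ 0ℚ
  same a = solve 2 (λ a c → con ½ :* ((a :- c) :- (a :- c)) := con 0ℚ) refl a c
  cases : ∀ a b → Goal (d a b)
  cases true true = subst Goal (sym (same 1ℚ)) zeroGoal
  cases false false = subst Goal (sym (same 0ℚ)) zeroGoal
  cases true false = subst Goal (solve 1 (λ c → con ½ := con ½ :* ((con 1ℚ :- c) :- (con 0ℚ :- c))) refl c) (half-young h K)
  cases false true = subst Goal (solve 1 (λ c → con (- ½) := con ½ :* ((con 0ℚ :- c) :- (con 1ℚ :- c))) refl c) negGoal

-- On sets containing `i` the transforms of `f` and of its derivative agree, so `f` may be replaced
-- by `∂ i f`; then `∂-young` is applied at every point and Bonami to the fourth power.
pair-through : ∀ h {n} (φ : Cube n → Bool) c i (v : Cube n → ℚ) → (∀ T → v T ≡ val (lookup T i) * v T) →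
  pair (centred φ c) v ≤ 2ℚ * (½ ^ℚ h) * ∑ (λ T → val (lookup T i) * hat (centred φ c) T ²)
    + (2ℚ ^ℚ h) * (2ℚ ^ℚ h) * (2ℚ ^ℚ h) * (noisy² v * noisy² v)
pair-through h {n} φ c i v supp = begin
  pair f v
    ≡⟨ ∫-cong (ΣF n) (λ T → trans (cong (hat f T *_) (supp T)) (trans (solve 3 (λ a b c → a :* (b :* c) := b :* a :* c) refl (hat f T) (val (lookup T i)) (v T)) (cong (_* v T) (sym (hat-∂ i f T))))) ⟩
  pair (∂ i f) v ≡⟨ plancherel (∂ i f) v ⟩
  E (λ x → ∂ i f x * ev v x) ≤⟨ ∫-mono (EF n) (λ x → ∂-young h φ c i (ev v x) x) ⟩
  E (λ x → 2ℚ * (½ ^ℚ h) * ∂ i f x ² + z³ * (ev v x ² * ev v x ²))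
    ≡⟨ trans (∫-+ (EF n) _ _) (cong₂ _+_ (∫-*ˡ (EF n) (2ℚ * (½ ^ℚ h)) _) (∫-*ˡ (EF n) z³ _)) ⟩
  2ℚ * (½ ^ℚ h) * E (λ x → ∂ i f x ²) + z³ * E (λ x → ev v x ² * ev v x ²)
    ≤⟨ +-mono-≤ (≤-reflexive (cong (2ℚ * (½ ^ℚ h) *_) (E-∂² i f))) (*-monoˡ z³ (0≤* (0≤* (0≤2^ h) (0≤2^ h)) (0≤2^ h)) (bonami v v)) ⟩
  2ℚ * (½ ^ℚ h) * ∑ (λ T → val (lookup T i) * hat f T ²) + z³ * (noisy² v * noisy² v) ∎
  where
  open ≤-Reasoning
  f = centred φ c
  z³ = (2ℚ ^ℚ h) * (2ℚ ^ℚ h) * (2ℚ ^ℚ h)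

-- Sets of small size

pair-cong : ∀ {n} (f : Cube n → ℚ) {u v : Cube n → ℚ} → (∀ T → u T ≡ v T) → pair f u ≡ pair f v
pair-cong f e = ∫-cong (ΣF _) (λ T → cong (hat f T *_) (e T))

pair-+ : ∀ {n} (f u v : Cube n → ℚ) → pair f (λ T → u T + v T) ≡ pair f u + pair f v
pair-+ f u v = trans (∫-cong (ΣF _) (λ T → *-distribˡ-+ (hat f T) (u T) (v T))) (∫-+ (ΣF _) _ _)

pair-≤ : ∀ k {n} (f u : Cube n → ℚ) → pair f u ≤ (½ ^ℚ k) * E (λ x → f x ²) + (2ℚ ^ℚ k) * norm² u
pair-≤ k f u = ≤-trans (∫-mono (ΣF _) (λ T → xy≤ k (hat f T) (u T))) (≤-reflexive
  (trans (∫-+ (ΣF _) _ _) (cong₂ _+_ (trans (∫-*ˡ (ΣF _) (½ ^ℚ k) _) (cong ((½ ^ℚ k) *_) (parseval f))) (∫-*ˡ (ΣF _) (2ℚ ^ℚ k) _))))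

on : ∀ {n} → (Cube n → Bool) → (Cube n → ℚ) → Cube n → ℚ
on p u T = val (p T) * u T

val-split : ∀ b a → a ≡ val b * a + val (not b) * a
val-split true a = solve 1 (λ a → a := con 1ℚ :* a :+ con 0ℚ :* a) refl a
val-split false a = solve 1 (λ a → a := con 0ℚ :* a :+ con 1ℚ :* a) refl a

pair-on : ∀ {n} p (f u : Cube n → ℚ) → pair f u ≡ pair f (on p u) + pair f (on (not ∘ p) u)
pair-on p f u = trans (pair-cong f (λ T → val-split (p T) (u T))) (pair-+ f _ _)

norm²-on : ∀ {n} p (u : Cube n → ℚ) → norm² u ≡ norm² (on p u) + norm² (on (not ∘ p) u)
norm²-on p u = trans (∫-cong (ΣF _) (λ T → trans (val-split (p T) (u T ²))
    (cong₂ _+_ (sym (val² (p T) (u T))) (sym (val² (not (p T)) (u T)))))) (∫-+ (ΣF _) _ _)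

-- Each entry is kept or deleted. Successive deletions compose without any record of the masks used,
-- and pointwise bounds on squares are inherited.
_⊑_ : ∀ {n} → (Cube n → ℚ) → (Cube n → ℚ) → Set
v ⊑ u = ∀ T → v T ≡ 0ℚ ⊎ v T ≡ u T

⊑-trans : ∀ {n} {u v w : Cube n → ℚ} → u ⊑ v → v ⊑ w → u ⊑ w
⊑-trans p q T with p T | q T
... | inj₁ e | _ = inj₁ e
... | inj₂ e | inj₁ e' = inj₁ (trans e e')
... | inj₂ e | inj₂ e' = inj₂ (trans e e')

on-⊑ : ∀ {n} p (u : Cube n → ℚ) → on p u ⊑ u
on-⊑ p u T with p T
... | true = inj₂ (*-identityˡ (u T))
... | false = inj₁ (*-zeroˡ (u T))

⊑-² : ∀ {n} {u v : Cube n → ℚ} → v ⊑ u → ∀ T → v T ² ≤ u T ²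
⊑-² {u = u} p T with p T
... | inj₁ e = ≤-trans (≤-reflexive (trans (cong _² e) (*-zeroˡ 0ℚ))) (0≤sq (u T))
... | inj₂ e = ≤-reflexive (cong _² e)

⊑-norm² : ∀ {n} {u v : Cube n → ℚ} → v ⊑ u → norm² v ≤ norm² u
⊑-norm² p = ∫-mono (ΣF _) (⊑-² p)

noisy²-degree : ∀ τ {n} (v : Cube n → ℚ) → (∀ T → v T ≡ 0ℚ ⊎ card T ℕ.≤ τ) → noisy² v ≤ (3ℚ ^ℚ τ) * norm² v
noisy²-degree τ v deg = ≤-trans (∫-mono (ΣF _) point) (≤-reflexive (∫-*ˡ (ΣF _) (3ℚ ^ℚ τ) _))
  where
  point : ∀ T → (3ℚ ^ℚ card T) * v T ² ≤ (3ℚ ^ℚ τ) * v T ²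
  point T with deg T
  ... | inj₁ e = ≤-reflexive (trans (cong (λ a → (3ℚ ^ℚ card T) * a ²) e) (trans (*-zeroʳ (3ℚ ^ℚ card T)) (sym (trans (cong (λ a → (3ℚ ^ℚ τ) * a ²) e) (*-zeroʳ (3ℚ ^ℚ τ))))))
  ... | inj₂ p = *-monoʳ (v T ²) (0≤sq (v T)) (^-monoʳ (≤-gap 2ℚ 0≤2 refl) p)

coeffInf : ∀ {n} → (Cube n → ℚ) → Fin n → ℚ
coeffInf v i = ∑ (λ T → val (lookup T i) * v T ²)

-- The reciprocal of the influence up to which a coordinate is light, `2^(2h+5τ)`. Here `2^(4τ)`
-- absorbs the square of the noise factor `3^τ`, `2^τ` is the gain, and `2^(2h)` lowers the `2^(3h)`
-- of `∂-young` to `2^h`.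
lightness : ℕ → ℕ → ℚ
lightness h τ = (2ℚ ^ℚ h) * (2ℚ ^ℚ h) * ((2ℚ ^ℚ τ) * (2ℚ ^ℚ τ) * ((2ℚ ^ℚ τ) * (2ℚ ^ℚ τ)) * (2ℚ ^ℚ τ))

0≤val : ∀ b → 0ℚ ≤ val b
0≤val true = 0≤1
0≤val false = ≤-refl

coeffInf-nonNeg : ∀ {n} (v : Cube n → ℚ) i → 0ℚ ≤ coeffInf v i
coeffInf-nonNeg v i = ∫-nonNeg (ΣF _) (λ T → 0≤* (0≤val (lookup T i)) (0≤sq (v T)))

-- Of the two factors `noisy² w`, one is bounded through the small influence of `i`, the other is
-- kept as `norm² w`, so that the errors of different coordinates add up to a total mass.
pair-light : ∀ h τ {n} (φ : Cube n → Bool) c i (w v : Cube n → ℚ) → (∀ T → w T ≡ 0ℚ ⊎ card T ℕ.≤ τ) →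
  (∀ T → w T ² ≤ v T ²) → (∀ T → w T ≡ val (lookup T i) * w T) → coeffInf v i * lightness h τ ≤ 1ℚ →
  pair (centred φ c) w ≤ 2ℚ * (½ ^ℚ h) * ∑ (λ T → val (lookup T i) * hat (centred φ c) T ²) + (2ℚ ^ℚ h) * (½ ^ℚ τ) * norm² w
pair-light h τ φ c i w v deg w≤v supp light =
  ≤-trans (pair-through h φ c i w supp) (+-monoʳ-≤ (2ℚ * (½ ^ℚ h) * coeffInf (hat (centred φ c)) i) (begin
  Z * Z * Z * (noisy² w * noisy² w)
    ≤⟨ *-monoˡ (Z * Z * Z) 0≤Z³ (*-mono-≤ (noisy²-nonNeg w) (noisy²-nonNeg w) noisy≤ noisy≤) ⟩
  Z * Z * Z * (W * W * norm² w * (W * W * norm² w))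
    ≤⟨ *-monoˡ (Z * Z * Z) 0≤Z³ (*-monoˡ (W * W * norm² w) (0≤* (0≤* (0≤2^ τ) (0≤2^ τ)) (norm²-nonNeg w)) (*-monoˡ (W * W) (0≤* (0≤2^ τ) (0≤2^ τ)) norm²≤)) ⟩
  Z * Z * Z * (W * W * norm² w * (W * W * coeffInf v i))
    ≡⟨ solve 4 (λ z w a b → z :* z :* z :* (w :* w :* a :* (w :* w :* b)) := z :* z :* z :* (w :* w :* a :* (w :* w :* b)) :* con 1ℚ) refl Z W (norm² w) (coeffInf v i) ⟩
  Z * Z * Z * (W * W * norm² w * (W * W * coeffInf v i)) * 1ℚ
    ≡⟨ cong (Z * Z * Z * (W * W * norm² w * (W * W * coeffInf v i)) *_) (sym (2^*½^ τ)) ⟩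
  Z * Z * Z * (W * W * norm² w * (W * W * coeffInf v i)) * (W * (½ ^ℚ τ))
    ≡⟨ solve 5 (λ z w a b h → z :* z :* z :* (w :* w :* a :* (w :* w :* b)) :* (w :* h) := z :* h :* a :* (b :* (z :* z :* (w :* w :* (w :* w) :* w)))) refl Z W (norm² w) (coeffInf v i) (½ ^ℚ τ) ⟩
  Z * (½ ^ℚ τ) * norm² w * (coeffInf v i * lightness h τ)
    ≤⟨ *-monoˡ (Z * (½ ^ℚ τ) * norm² w) (0≤* (0≤* (0≤2^ h) (0≤½^ τ)) (norm²-nonNeg w)) light ⟩
  Z * (½ ^ℚ τ) * norm² w * 1ℚ ≡⟨ *-identityʳ _ ⟩
  Z * (½ ^ℚ τ) * norm² w ∎))
  where
  open ≤-Reasoning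
  Z = 2ℚ ^ℚ h
  W = 2ℚ ^ℚ τ
  0≤Z³ : 0ℚ ≤ Z * Z * Z
  0≤Z³ = 0≤* (0≤* (0≤2^ h) (0≤2^ h)) (0≤2^ h)
  noisy≤ : noisy² w ≤ W * W * norm² w
  noisy≤ = ≤-trans (noisy²-degree τ w deg) (*-monoʳ (norm² w) (norm²-nonNeg w)
    (≤-trans (^-monoˡ 0≤3 (≤-gap {3ℚ} {2ℚ * 2ℚ} 1ℚ 0≤1 refl) τ) (≤-reflexive (^-distrib-* 2ℚ 2ℚ τ))))
  norm²≤ : norm² w ≤ coeffInf v i
  norm²≤ = ∫-mono (ΣF _) (λ T → ≤-trans (≤-reflexive (trans (cong _² (supp T)) (val² (lookup T i) (w T)))) (*-monoˡ (val (lookup T i)) (0≤val (lookup T i)) (w≤v T)))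

-- Every deleted set is charged to the one light coordinate at which it disappears, so the masses
-- telescope. Lightness refers to the fixed `v` and not to what is left; survivors therefore contain
-- heavy coordinates of `v` only. The enumeration `ρ` allows recursion on the number of coordinates
-- still to be treated while the cube stays the same.
peel : ∀ h τ {n} (φ : Cube n → Bool) c (v : Cube n → ℚ) m (ρ : Fin m → Fin n) (w : Cube n → ℚ) →
  (∀ T → w T ≡ 0ℚ ⊎ card T ℕ.≤ τ) → w ⊑ v →
  Σ (Cube n → ℚ) λ w′ → (w′ ⊑ w)
    × (∀ j T → coeffInf v (ρ j) * lightness h τ ≤ 1ℚ → lookup T (ρ j) ≡ true → w′ T ≡ 0ℚ)
    × (pair (centred φ c) w ≤ pair (centred φ c) w′
        + (2ℚ * (½ ^ℚ h) * ∫ (finF m) (λ j → ∑ (λ T → val (lookup T (ρ j)) * hat (centred φ c) T ²))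
        + (2ℚ ^ℚ h) * (½ ^ℚ τ) * (norm² w - norm² w′)))
peel h τ φ c v zero ρ w deg w⊑v = w , (λ T → inj₂ refl) , (λ ()) ,
  ≤-reflexive (trans (solve 4 (λ p a b d → p := p :+ (a :* con 0ℚ :+ b :* (d :- d))) refl (pair (centred φ c) w) (2ℚ * (½ ^ℚ h)) ((2ℚ ^ℚ h) * (½ ^ℚ τ)) (norm² w))
    (cong (λ o → pair (centred φ c) w + (2ℚ * (½ ^ℚ h) * o + (2ℚ ^ℚ h) * (½ ^ℚ τ) * (norm² w - norm² w))) (sym (finF-[] _))))
peel h τ φ c v (suc m) ρ w deg w⊑v with coeffInf v (ρ zero) * lightness h τ ≤? 1ℚ
... | no heavy = let w′ , sub , van , bd = peel h τ φ c v m (ρ ∘ suc) w deg w⊑v in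
  w′ , sub , (λ { zero T l _ → ⊥-elim (heavy l) ; (suc j) → van j }) ,
  ≤-trans bd (+-monoʳ-≤ (pair (centred φ c) w′) (+-monoˡ-≤ ((2ℚ ^ℚ h) * (½ ^ℚ τ) * (norm² w - norm² w′))
    (*-monoˡ (2ℚ * (½ ^ℚ h)) (0≤* 0≤2 (0≤½^ h))
      (≤-trans (≤+ˡ (coeffInf (hat (centred φ c)) (ρ zero)) (coeffInf-nonNeg (hat (centred φ c)) (ρ zero)))
        (≤-reflexive (sym (finF-∷ (λ j → coeffInf (hat (centred φ c)) (ρ j)))))))))
... | yes light = let w′ , sub , van , bd = peel h τ φ c v m (ρ ∘ suc) wo
                                              (λ T → degsub T (on-⊑ (not ∘ p) w T) (deg T)) (⊑-trans (on-⊑ (not ∘ p) w) w⊑v) in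
  w′ , ⊑-trans sub (on-⊑ (not ∘ p) w) ,
  (λ { zero T _ l → gone T l (sub T) ; (suc j) → van j }) ,
  (begin
  pair f w ≡⟨ pair-on p f w ⟩
  pair f wi + pair f wo
    ≤⟨ +-mono-≤ (pair-light h τ φ c (ρ zero) wi v (λ T → degsub T (on-⊑ p w T) (deg T)) (⊑-² (⊑-trans (on-⊑ p w) w⊑v)) idem light) bd ⟩
  (a * i₀ + b * norm² wi) + (pair f w′ + (a * is + b * (norm² wo - norm² w′)))
    ≡⟨ solve 8 (λ a b i j x y z p → (a :* i :+ b :* x) :+ (p :+ (a :* j :+ b :* (y :- z))) := p :+ (a :* (i :+ j) :+ b :* (x :+ y :- z))) refl a b i₀ is (norm² wi) (norm² wo) (norm² w′) (pair f w′) ⟩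
  pair f w′ + (a * (i₀ + is) + b * (norm² wi + norm² wo - norm² w′))
    ≡⟨ cong₂ (λ s t → pair f w′ + (a * s + b * (t - norm² w′))) (sym (finF-∷ _)) (sym (norm²-on p w)) ⟩
  _ ∎)
  where
  open ≤-Reasoning
  f = centred φ c
  p : Cube _ → Bool
  p T = lookup T (ρ zero)
  wi wo : Cube _ → ℚ
  wi = on p w
  wo = on (not ∘ p) w
  a = 2ℚ * (½ ^ℚ h)
  b = (2ℚ ^ℚ h) * (½ ^ℚ τ)
  i₀ = ∑ (λ T → val (lookup T (ρ zero)) * hat f T ²)
  is = ∫ (finF m) (λ j → ∑ (λ T → val (lookup T (ρ (suc j))) * hat f T ²))
  degsub : ∀ T {x} → x ≡ 0ℚ ⊎ x ≡ w T → w T ≡ 0ℚ ⊎ card T ℕ.≤ τ → x ≡ 0ℚ ⊎ card T ℕ.≤ τ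
  degsub T (inj₁ e) _ = inj₁ e
  degsub T (inj₂ e) (inj₁ e') = inj₁ (trans e e')
  degsub T (inj₂ e) (inj₂ q) = inj₂ q
  idem : ∀ T → wi T ≡ val (lookup T (ρ zero)) * wi T
  idem T with lookup T (ρ zero)
  ... | true = sym (*-identityˡ _)
  ... | false = solve 1 (λ a → con 0ℚ :* a := con 0ℚ :* (con 0ℚ :* a)) refl (w T)
  gone : ∀ T {x} → lookup T (ρ zero) ≡ true → x ≡ 0ℚ ⊎ x ≡ wo T → x ≡ 0ℚ
  gone T l (inj₁ e) = e
  gone T l (inj₂ e) = trans e (trans (cong (λ t → val (not t) * w T) l) (*-zeroˡ (w T)))

-- Sets made of influential coordinates only

prodT : ∀ {n} → (Fin n → ℚ) → Cube n → ℚ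
prodT μ [] = 1ℚ
prodT μ (true ∷ T) = μ zero * prodT (μ ∘ suc) T
prodT μ (false ∷ T) = prodT (μ ∘ suc) T

prodT-nonNeg : ∀ {n} (μ : Fin n → ℚ) → (∀ i → 0ℚ ≤ μ i) → ∀ T → 0ℚ ≤ prodT μ T
prodT-nonNeg μ p [] = 0≤1
prodT-nonNeg μ p (true ∷ T) = 0≤* (p zero) (prodT-nonNeg (μ ∘ suc) (p ∘ suc) T)
prodT-nonNeg μ p (false ∷ T) = prodT-nonNeg (μ ∘ suc) (p ∘ suc) T

prodT-∅ : ∀ {n} (μ : Fin n → ℚ) T → card T ≡ 0 → prodT μ T ≡ 1ℚ
prodT-∅ μ [] e = refl
prodT-∅ μ (false ∷ T) e = prodT-∅ (μ ∘ suc) T e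

-- The sum is the product of all `1 + μ i`, and `(1 + m)(1 - m - s) ≤ 1 - s` bounds it by
-- `1 / (1 - ∑ μ)` without an exponential function.
∑-prodT : ∀ {n} (μ : Fin n → ℚ) → (∀ i → 0ℚ ≤ μ i) → ∑ (prodT μ) * (1ℚ - ∫ (finF n) μ) ≤ 1ℚ
∑-prodT {zero} μ 0≤μ = ≤-reflexive (trans (cong₂ (λ a b → a * (1ℚ - b)) (cubeF-[] _) (finF-[] μ)) refl)
∑-prodT {suc n} μ 0≤μ = begin
  ∑ (prodT μ) * (1ℚ - ∫ (finF (suc n)) μ)
    ≡⟨ cong₂ (λ a b → a * (1ℚ - b)) (trans (∑-∷ _) (cong (P +_) (∫-*ˡ (ΣF n) (μ zero) _))) (finF-∷ μ) ⟩
  (P + m * P) * (1ℚ - (m + s))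
    ≤⟨ ≤-gap (P * (m * m + m * s)) (0≤* 0≤P (0≤+ (0≤sq m) (0≤* (0≤μ zero) (∫-nonNeg (finF n) (0≤μ ∘ suc)))))
         (solve 3 (λ P m s → P :* (con 1ℚ :- s) := (P :+ m :* P) :* (con 1ℚ :- (m :+ s)) :+ P :* (m :* m :+ m :* s)) refl P m s) ⟩
  P * (1ℚ - s) ≤⟨ ∑-prodT (μ ∘ suc) (0≤μ ∘ suc) ⟩
  1ℚ ∎
  where
  open ≤-Reasoning
  P = ∑ (prodT (μ ∘ suc))
  m = μ zero
  s = ∫ (finF n) (μ ∘ suc)
  0≤P : 0ℚ ≤ P
  0≤P = ∫-nonNeg (ΣF n) (prodT-nonNeg (μ ∘ suc) (0≤μ ∘ suc))

∑-card-0 : ∀ {n} (g : Cube n → ℚ) → ∑ (λ T → g T when (card T ℕ.≟ 0)) ≡ g (replicate n false)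
∑-card-0 {zero} g = cubeF-[] _
∑-card-0 {suc n} g = trans (∑-∷ _) (trans (cong₂ _+_ (∑-card-0 (g ∘ (false ∷_))) (∫-0 (ΣF n))) (+-identityʳ _))

-- The empty product contributes exactly 1 to the total, which is at most `1 / (1 - s)`; what
-- remains is at most `s / (1 - s) ≤ 2s`. The 1 is split off by adding the indicator of the empty
-- set to `w²`.
∑-prodT-nonempty : ∀ {n} (μ : Fin n → ℚ) (w : Cube n → ℚ) → (∀ i → 0ℚ ≤ μ i) → (∀ T → w T ² ≤ prodT μ T) →
  (∀ T → card T ≡ 0 → w T ≡ 0ℚ) → ∫ (finF n) μ ≤ ½ → norm² w ≤ 2ℚ * ∫ (finF n) μ
∑-prodT-nonempty {n} μ w 0≤μ w≤ w∅ s≤½ = ≤-gap (gap₁ + (gap₂ + gap₃)) (0≤+ (gap-≤ norm+1≤P) (0≤+ (gap-≤ (∑-prodT μ 0≤μ)) 0≤gap₃))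
  (solve 3 (λ s P N → con 2ℚ :* s := N :+ ((P :- (N :+ con 1ℚ)) :+ ((con 1ℚ :- P :* (con 1ℚ :- s)) :+ s :* (con 2ℚ :- P)))) refl s P (norm² w))
  where
  s = ∫ (finF n) μ
  P = ∑ (prodT μ)
  0≤P : 0ℚ ≤ P
  0≤P = ∫-nonNeg (ΣF n) (prodT-nonNeg μ 0≤μ)
  gap₁ = P - (norm² w + 1ℚ)
  gap₂ = 1ℚ - P * (1ℚ - s)
  gap₃ = s * (2ℚ - P)
  point : ∀ T → w T ² + (1ℚ when (card T ℕ.≟ 0)) ≤ prodT μ T
  point T with card T ℕ.≟ 0
  ... | yes e = ≤-reflexive (trans (cong (λ a → a ² + 1ℚ) (w∅ T e)) (sym (prodT-∅ μ T e)))
  ... | no _ = ≤-trans (≤-reflexive (+-identityʳ _)) (w≤ T)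
  norm+1≤P : norm² w + 1ℚ ≤ P
  norm+1≤P = ≤-trans (≤-reflexive (trans (cong (norm² w +_) (sym (∑-card-0 (λ _ → 1ℚ)))) (sym (∫-+ (ΣF n) _ _)))) (∫-mono (ΣF n) point)
  P≤2 : P ≤ 2ℚ
  P≤2 = ≤-gap (2ℚ * (gap₂ + P * (½ - s))) (0≤* 0≤2 (0≤+ (gap-≤ (∑-prodT μ 0≤μ)) (0≤* 0≤P (gap-≤ s≤½))))
    (solve 2 (λ s P → con 2ℚ := P :+ con 2ℚ :* ((con 1ℚ :- P :* (con 1ℚ :- s)) :+ P :* (con ½ :- s))) refl s P)
  0≤gap₃ : 0ℚ ≤ gap₃
  0≤gap₃ = 0≤* (∫-nonNeg (finF n) 0≤μ) (gap-≤ P≤2)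

prodT-dichotomy : ∀ q → 0ℚ ≤ q → ∀ {n} (μ : Fin n → ℚ) T →
  (Σ (Fin n) λ i → lookup T i ≡ true × μ i ≤ q) ⊎ (q ^ℚ card T ≤ prodT μ T)
prodT-dichotomy q 0≤q μ [] = inj₂ ≤-refl
prodT-dichotomy q 0≤q μ (false ∷ T) with prodT-dichotomy q 0≤q (μ ∘ suc) T
... | inj₁ (i , l , p) = inj₁ (suc i , l , p)
... | inj₂ p = inj₂ p
prodT-dichotomy q 0≤q μ (true ∷ T) with prodT-dichotomy q 0≤q (μ ∘ suc) T | ≤-total (μ zero) q
... | inj₁ (i , l , p) | _ = inj₁ (suc i , l , p)
... | inj₂ p | inj₁ r = inj₁ (zero , refl , r)
... | inj₂ p | inj₂ r = inj₂ (*-mono-≤ 0≤q (^-nonNeg 0≤q (card T)) r p)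

≤½^ : ∀ a {x} → x * (2ℚ ^ℚ a) ≤ 1ℚ → x ≤ ½ ^ℚ a
≤½^ a {x} p = ≤-trans (≤-reflexive (begin
  x                              ≡⟨ sym (*-identityʳ x) ⟩
  x * 1ℚ                         ≡⟨ cong (x *_) (sym (2^*½^ a)) ⟩
  x * ((2ℚ ^ℚ a) * (½ ^ℚ a))     ≡⟨ sym (*-assoc x _ _) ⟩
  x * (2ℚ ^ℚ a) * (½ ^ℚ a)       ∎))
  (≤-trans (*-monoʳ (½ ^ℚ a) (0≤½^ a) p) (≤-reflexive (*-identityˡ (½ ^ℚ a))))
  where open ≡-Reasoning

½^≤½ : ∀ {a} → 1 ℕ.≤ a → ½ ^ℚ a ≤ ½
½^≤½ {a} 1≤a = ½^-antimono {1} {a} 1≤a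

-- Of `2h + 9τ`, the part `2h + 5τ` cancels the lightness and one `τ` the passage from mass to total
-- degree. The remaining `3τ` cover a mass up to `2^(2l)` with `l < τ` and leave a gain.
leafExp : ℕ → ℕ → ℕ
leafExp h τ = (h ℕ.* 2) ℕ.+ (τ ℕ.* 9)

leafExp-lightness : ∀ h τ → (½ ^ℚ leafExp h τ) * lightness h τ * (2ℚ ^ℚ τ) ≡ (½ ^ℚ τ) * (½ ^ℚ τ) * (½ ^ℚ τ)
leafExp-lightness h τ = begin
  (½ ^ℚ leafExp h τ) * lightness h τ * W
    ≡⟨ cong (λ q → q * lightness h τ * W) (trans (^-+ ½ (h ℕ.* 2) (τ ℕ.* 9)) (cong₂ _*_ (^-* ½ h 2) (^-* ½ τ 9))) ⟩
  (z ^ℚ 2) * (w ^ℚ 9) * lightness h τ * W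
    ≡⟨ solve 4 (λ Z z W w → (z :* (z :* con 1ℚ)) :* (w :* (w :* (w :* (w :* (w :* (w :* (w :* (w :* (w :* con 1ℚ))))))))) :* (Z :* Z :* (W :* W :* (W :* W) :* W)) :* W
         := (Z :* z) :* (Z :* z) :* ((W :* w) :* (W :* w) :* (W :* w) :* (W :* w) :* (W :* w) :* (W :* w)) :* (w :* w :* w)) refl Z z W w ⟩
  (Z * z) * (Z * z) * ((W * w) * (W * w) * (W * w) * (W * w) * (W * w) * (W * w)) * (w * w * w)
    ≡⟨ cong₂ (λ a b → a * a * (b * b * b * b * b * b) * (w * w * w)) (2^*½^ h) (2^*½^ τ) ⟩
  1ℚ * 1ℚ * (1ℚ * 1ℚ * 1ℚ * 1ℚ * 1ℚ * 1ℚ) * (w * w * w) ≡⟨ *-identityˡ (w * w * w) ⟩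
  w * w * w ∎
  where
  open ≡-Reasoning
  Z = 2ℚ ^ℚ h
  z = ½ ^ℚ h
  W = 2ℚ ^ℚ τ
  w = ½ ^ℚ τ

-- The numbers `μ i` are influences rescaled so that the lightness threshold becomes `q`. All
-- coordinates of a surviving `T` exceed it, so the bound `q ^ℚ card T` on its square lies below the
-- product of its `μ i`. These products sum to at most twice `∑ μ`, a small multiple of the total
-- degree of `v`.
norm²-heavy : ∀ h τ l {n} (v w : Cube n → ℚ) → (∀ T → card T ≡ 0 → v T ≡ 0ℚ) →
  (∀ T → v T ≡ 0ℚ ⊎ card T ℕ.≤ τ) → (∀ T → v T ² * (2ℚ ^ℚ (leafExp h τ ℕ.* card T)) ≤ 1ℚ) →
  norm² v ≤ 2ℚ ^ℚ (l ℕ.+ l) → l ℕ.< τ → w ⊑ v →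
  (∀ i T → coeffInf v i * lightness h τ ≤ 1ℚ → lookup T i ≡ true → w T ≡ 0ℚ) →
  norm² w ≤ (½ ^ℚ τ) * norm² v
norm²-heavy h τ l {n} v w v∅ deg small N≤ l<τ w⊑v van =
  ≤-trans (∑-prodT-nonempty μ w 0≤μ w²≤ (λ T e → sub0 T e (w⊑v T)) ∑μ≤½) (begin
  2ℚ * ∫ (finF n) μ            ≤⟨ *-monoˡ 2ℚ 0≤2 ∑μ≤ ⟩
  2ℚ * (ω * ω * ω * norm² v)   ≡⟨ solve 2 (λ w N → con 2ℚ :* (w :* w :* w :* N) := w :* (con 2ℚ :* w) :* (w :* N)) refl ω (norm² v) ⟩
  ω * (2ℚ * ω) * (ω * norm² v) ≤⟨ *-monoʳ (ω * norm² v) (0≤* (0≤½^ τ) (norm²-nonNeg v)) (*-mono-≤ {ω} {1ℚ} {2ℚ * ω} {1ℚ} (0≤½^ τ) (0≤* 0≤2 (0≤½^ τ)) ω≤1 2ω≤1) ⟩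
  1ℚ * 1ℚ * (ω * norm² v)      ≡⟨ *-identityˡ (ω * norm² v) ⟩
  ω * norm² v ∎)
  where
  open ≤-Reasoning
  e = leafExp h τ
  q = ½ ^ℚ e
  ω = ½ ^ℚ τ
  μ : Fin n → ℚ
  μ i = q * lightness h τ * coeffInf v i
  0≤light : 0ℚ ≤ lightness h τ
  0≤light = 0≤* (0≤* (0≤2^ h) (0≤2^ h)) (0≤* (0≤* (0≤* (0≤2^ τ) (0≤2^ τ)) (0≤* (0≤2^ τ) (0≤2^ τ))) (0≤2^ τ))
  0≤μ : ∀ i → 0ℚ ≤ μ i
  0≤μ i = 0≤* (0≤* (0≤½^ e) 0≤light) (coeffInf-nonNeg v i)
  sub0 : ∀ T {x} → card T ≡ 0 → x ≡ 0ℚ ⊎ x ≡ v T → x ≡ 0ℚ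
  sub0 T e (inj₁ p) = p
  sub0 T e (inj₂ p) = trans p (v∅ T e)
  2ω≤1 : 2ℚ * ω ≤ 1ℚ
  2ω≤1 = *-monoˡ 2ℚ 0≤2 (½^≤½ {τ} (ℕₚ.≤-trans (ℕ.s≤s ℕ.z≤n) l<τ))
  ω≤1 : ω ≤ 1ℚ
  ω≤1 = ½^-antimono {0} {τ} ℕ.z≤n
  w²≤ : ∀ T → w T ² ≤ prodT μ T
  w²≤ T with prodT-dichotomy q (0≤½^ e) μ T
  ... | inj₁ (i , l , μ≤q) = ≤-trans (≤-reflexive (cong _² (van i T light l))) (prodT-nonNeg μ 0≤μ T)
    where
    light : coeffInf v i * lightness h τ ≤ 1ℚ
    light = ≤-trans (≤-reflexive (trans (sym (*-identityˡ (coeffInf v i * lightness h τ))) (trans (cong (_* (coeffInf v i * lightness h τ)) (sym (2^*½^ e)))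
      (solve 4 (λ a b c d → a :* b :* (c :* d) := a :* (b :* d :* c)) refl (2ℚ ^ℚ e) q (coeffInf v i) (lightness h τ)))))
      (≤-trans (*-monoˡ (2ℚ ^ℚ e) (0≤2^ e) μ≤q) (≤-reflexive (2^*½^ e)))
  ... | inj₂ p = ≤-trans (⊑-² w⊑v T) (≤-trans (≤½^ (e ℕ.* card T) (small T)) (≤-trans (≤-reflexive (^-* ½ e (card T))) p))
  degree≤ : ∑ (λ T → ι (card T) * v T ²) ≤ (2ℚ ^ℚ τ) * norm² v
  degree≤ = ≤-trans (∫-mono (ΣF n) point) (≤-reflexive (∫-*ˡ (ΣF n) (2ℚ ^ℚ τ) _))
    where
    point : ∀ T → ι (card T) * v T ² ≤ (2ℚ ^ℚ τ) * v T ²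
    point T with deg T
    ... | inj₁ p = ≤-reflexive (trans (cong (λ a → ι (card T) * a ²) p) (trans (*-zeroʳ (ι (card T))) (sym (trans (cong (λ a → (2ℚ ^ℚ τ) * a ²) p) (*-zeroʳ (2ℚ ^ℚ τ))))))
    ... | inj₂ p = *-monoʳ (v T ²) (0≤sq (v T)) (≤-trans (ι-mono p) (ι≤2^ τ))
  ∑μ≤ : ∫ (finF n) μ ≤ ω * ω * ω * norm² v
  ∑μ≤ = begin
    ∫ (finF n) μ ≡⟨ ∫-*ˡ (finF n) (q * lightness h τ) (coeffInf v) ⟩
    q * lightness h τ * ∫ (finF n) (coeffInf v) ≡⟨ cong (q * lightness h τ *_) (∑-degree v) ⟩
    q * lightness h τ * ∑ (λ T → ι (card T) * v T ²) ≤⟨ *-monoˡ (q * lightness h τ) (0≤* (0≤½^ e) 0≤light) degree≤ ⟩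
    q * lightness h τ * ((2ℚ ^ℚ τ) * norm² v) ≡⟨ sym (*-assoc (q * lightness h τ) (2ℚ ^ℚ τ) (norm² v)) ⟩
    q * lightness h τ * (2ℚ ^ℚ τ) * norm² v ≡⟨ cong (_* norm² v) (leafExp-lightness h τ) ⟩
    ω * ω * ω * norm² v ∎
  2^lω≤1 : (2ℚ ^ℚ l) * ω ≤ 1ℚ
  2^lω≤1 = ≤-trans (*-monoʳ ω (0≤½^ τ) (^-monoʳ 1≤2 (ℕₚ.<⇒≤ l<τ))) (≤-reflexive (2^*½^ τ))
  ∑μ≤½ : ∫ (finF n) μ ≤ ½
  ∑μ≤½ = begin
    ∫ (finF n) μ ≤⟨ ∑μ≤ ⟩
    ω * ω * ω * norm² v ≤⟨ *-monoˡ (ω * ω * ω) (0≤* (0≤* (0≤½^ τ) (0≤½^ τ)) (0≤½^ τ)) N≤ ⟩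
    ω * ω * ω * (2ℚ ^ℚ (l ℕ.+ l)) ≡⟨ cong (ω * ω * ω *_) (^-+ 2ℚ l l) ⟩
    ω * ω * ω * ((2ℚ ^ℚ l) * (2ℚ ^ℚ l)) ≡⟨ solve 2 (λ w a → w :* w :* w :* (a :* a) := a :* w :* (a :* w) :* w) refl ω (2ℚ ^ℚ l) ⟩
    (2ℚ ^ℚ l) * ω * ((2ℚ ^ℚ l) * ω) * ω
      ≤⟨ *-monoʳ ω (0≤½^ τ) (*-mono-≤ {(2ℚ ^ℚ l) * ω} {1ℚ} {(2ℚ ^ℚ l) * ω} {1ℚ} (0≤* (0≤2^ l) (0≤½^ τ)) (0≤* (0≤2^ l) (0≤½^ τ)) 2^lω≤1 2^lω≤1) ⟩
    1ℚ * 1ℚ * ω ≡⟨ *-identityˡ ω ⟩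
    ω ≤⟨ ½^≤½ {τ} (ℕₚ.≤-trans (ℕ.s≤s ℕ.z≤n) l<τ) ⟩
    ½ ∎

pair-lowDegree : ∀ h τ l k {n} (φ : Cube n → Bool) c (v : Cube n → ℚ) → (∀ T → card T ≡ 0 → v T ≡ 0ℚ) →
  (∀ T → v T ≡ 0ℚ ⊎ card T ℕ.≤ τ) → (∀ T → v T ² * (2ℚ ^ℚ (leafExp h τ ℕ.* card T)) ≤ 1ℚ) →
  norm² v ≤ 2ℚ ^ℚ (l ℕ.+ l) → l ℕ.< τ →
  pair (centred φ c) v ≤ (½ ^ℚ k) * E (λ x → centred φ c x ²) + 2ℚ * (½ ^ℚ h) * influence (centred φ c)
    + ((2ℚ ^ℚ k) * (½ ^ℚ τ) + (2ℚ ^ℚ h) * (½ ^ℚ τ)) * norm² v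
pair-lowDegree h τ l k {n} φ c v v∅ deg small N≤ l<τ
  with w , w⊑v , van , bd ← peel h τ φ c v n (λ i → i) v deg (λ T → inj₂ refl) = begin
  pair f v ≤⟨ bd ⟩
  pair f w + (a * ∫ (finF n) (coeffInf (hat f)) + b * (N - norm² w))
    ≤⟨ +-mono-≤ (≤-trans (pair-≤ k f w) (+-monoʳ-≤ ((½ ^ℚ k) * V) (*-monoˡ (2ℚ ^ℚ k) (0≤2^ k) (norm²-heavy h τ l v w v∅ deg small N≤ l<τ w⊑v van))))
         (+-mono-≤ (≤-reflexive (cong (a *_) (∑-degree (hat f)))) (*-monoˡ b (0≤* (0≤2^ h) (0≤½^ τ)) (≤-gap (norm² w) (norm²-nonNeg w) (solve 2 (λ x y → x := (x :- y) :+ y) refl N (norm² w))))) ⟩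
  ((½ ^ℚ k) * V + (2ℚ ^ℚ k) * ((½ ^ℚ τ) * N)) + (a * influence f + b * N)
    ≡⟨ solve 7 (λ hv t w N a i b → (hv :+ t :* (w :* N)) :+ (a :* i :+ b :* N) := hv :+ a :* i :+ (t :* w :+ b) :* N) refl ((½ ^ℚ k) * V) (2ℚ ^ℚ k) (½ ^ℚ τ) N a (influence f) b ⟩
  (½ ^ℚ k) * V + a * influence f + ((2ℚ ^ℚ k) * (½ ^ℚ τ) + b) * N ∎
  where
  open ≤-Reasoning
  f = centred φ c
  V = E (λ x → f x ²)
  N = norm² v
  a = 2ℚ * (½ ^ℚ h)
  b = (2ℚ ^ℚ h) * (½ ^ℚ τ)

-- Splitting the coordinates along a mask

when-cong : ∀ {P Q : Set} q (d : Dec P) (d′ : Dec Q) → (P → Q) → (Q → P) → q when d ≡ q when d′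
when-cong q (yes p) (yes p′) f g = refl
when-cong q (no ¬p) (no ¬p′) f g = refl
when-cong q (yes p) (no ¬p′) f g = ⊥-elim (¬p′ (f p))
when-cong q (no ¬p) (yes p′) f g = ⊥-elim (¬p (g p′))

when-nonNeg : ∀ {P : Set} {q} → 0ℚ ≤ q → (d : Dec P) → 0ℚ ≤ (q when d)
when-nonNeg p (yes _) = p
when-nonNeg p (no _) = ≤-refl

when-≤ : ∀ {P : Set} {q} → 0ℚ ≤ q → (d : Dec P) → (q when d) ≤ q
when-≤ p (yes _) = ≤-refl
when-≤ p (no _) = p

card-≤ : ∀ {n} (T : Cube n) → card T ℕ.≤ n
card-≤ [] = ℕ.z≤n
card-≤ (true ∷ T) = ℕ.s≤s (card-≤ T)
card-≤ (false ∷ T) = ℕₚ.m≤n⇒m≤1+n (card-≤ T)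

∫-when-toℕ : ∀ q m c → c ℕ.< m → ∫ (finF m) (λ b → q when (c ℕ.≟ toℕ b)) ≡ q
∫-when-toℕ q (suc m) zero _ = trans (finF-∷ _) (trans (cong (q +_) (∫-0 (finF m))) (+-identityʳ q))
∫-when-toℕ q (suc m) (suc c) (ℕ.s≤s c<m) = trans (finF-∷ _) (trans (+-identityˡ _)
  (trans (∫-cong (finF m) (λ b → when-cong q (suc c ℕ.≟ suc (toℕ b)) (c ℕ.≟ toℕ b) ℕₚ.suc-injective (cong suc))) (∫-when-toℕ q m c c<m)))

stratum : ∀ {n} → (Cube n → ℚ) → ℕ → ℚ
stratum w b = ∑ (λ R → w R ² when (card R ℕ.≟ b))

stratum-nonNeg : ∀ {n} (w : Cube n → ℚ) b → 0ℚ ≤ stratum w b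
stratum-nonNeg w b = ∫-nonNeg (ΣF _) (λ R → when-nonNeg (0≤sq (w R)) (card R ℕ.≟ b))

∑-strata : ∀ (c : ℕ → ℚ) {n} (w : Cube n → ℚ) →
  ∑ (λ R → c (card R) * w R ²) ≡ ∫ (finF (suc n)) (λ b → c (toℕ b) * stratum w (toℕ b))
∑-strata c {n} w = begin
  ∑ (λ R → c (card R) * w R ²)
    ≡⟨ ∫-cong (ΣF n) (λ R → sym (∫-when-toℕ (c (card R) * w R ²) (suc n) (card R) (ℕ.s≤s (card-≤ R)))) ⟩
  ∑ (λ R → ∫ (finF (suc n)) (λ b → (c (card R) * w R ²) when (card R ℕ.≟ toℕ b))) ≡⟨ ∫-finF-swap (ΣF n) _ ⟩
  ∫ (finF (suc n)) (λ b → ∑ (λ R → (c (card R) * w R ²) when (card R ℕ.≟ toℕ b)))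
    ≡⟨ ∫-cong (finF (suc n)) (λ b → trans (∫-cong (ΣF n) (λ R → fix (w R ²) (card R ℕ.≟ toℕ b))) (∫-*ˡ (ΣF n) (c (toℕ b)) _)) ⟩
  ∫ (finF (suc n)) (λ b → c (toℕ b) * stratum w (toℕ b)) ∎
  where
  open ≡-Reasoning
  fix : ∀ {i j} q (d : Dec (i ≡ j)) → (c i * q) when d ≡ c j * (q when d)
  fix q (yes refl) = refl
  fix {j = j} q (no _) = sym (*-zeroʳ (c j))

-- Cauchy-Schwarz with weights `2^-b`, whose sum is at most 2; the inductive step is
-- `(a + b)² ≤ 2a² + 2b²`.
geometric-CS : ∀ m (y : Fin m → ℚ) → ∫ (finF m) y ² ≤ 2ℚ * ∫ (finF m) (λ b → (2ℚ ^ℚ toℕ b) * y b ²)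
geometric-CS zero y = ≤-reflexive (trans (cong _² (finF-[] y)) (sym (cong (2ℚ *_) (finF-[] _))))
geometric-CS (suc m) y = begin
  ∫ (finF (suc m)) y ² ≡⟨ cong _² (finF-∷ y) ⟩
  (y₀ + s) ²
    ≤⟨ ≤-gap ((y₀ - s) ²) (0≤sq (y₀ - s)) (solve 2 (λ a b → con 2ℚ :* (a :* a) :+ con 2ℚ :* (b :* b) := (a :+ b) :* (a :+ b) :+ (a :- b) :* (a :- b)) refl y₀ s) ⟩
  2ℚ * y₀ ² + 2ℚ * s ²
    ≤⟨ +-monoʳ-≤ (2ℚ * y₀ ²) (*-monoˡ 2ℚ 0≤2 (geometric-CS m (y ∘ suc))) ⟩
  2ℚ * y₀ ² + 2ℚ * (2ℚ * t)
    ≡⟨ solve 2 (λ a t → con 2ℚ :* (a :* a) :+ con 2ℚ :* (con 2ℚ :* t) := con 2ℚ :* (con 1ℚ :* (a :* a) :+ con 2ℚ :* t)) refl y₀ t ⟩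
  2ℚ * (1ℚ * y₀ ² + 2ℚ * t)
    ≡⟨ cong (λ r → 2ℚ * (1ℚ * y₀ ² + r)) (trans (sym (∫-*ˡ (finF m) 2ℚ _)) (∫-cong (finF m) (λ b → sym (*-assoc 2ℚ (2ℚ ^ℚ toℕ b) (y (suc b) ²))))) ⟩
  2ℚ * (1ℚ * y₀ ² + ∫ (finF m) (λ b → (2ℚ ^ℚ toℕ (suc b)) * y (suc b) ²)) ≡⟨ cong (2ℚ *_) (sym (finF-∷ _)) ⟩
  2ℚ * ∫ (finF (suc m)) (λ b → (2ℚ ^ℚ toℕ b) * y b ²) ∎
  where
  open ≤-Reasoning
  y₀ = y zero
  s = ∫ (finF m) (y ∘ suc)
  t = ∫ (finF m) (λ b → (2ℚ ^ℚ toℕ b) * y (suc b) ²)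

-- The factor `2^b` stems from `geometric-CS` and `9^b` from the square of the noise weight. Since
-- `18 ≤ 2^5`, five of the six available powers suffice, and the sixth leaves `½^(a+b)`; strictness
-- of `τ < a + b` pays for the leading 2.
2·18^b≤ : ∀ a b τ → τ ℕ.< a ℕ.+ b → 2ℚ * ((2ℚ ^ℚ b) * ((3ℚ ^ℚ b) * (3ℚ ^ℚ b))) * (½ ^ℚ (6 ℕ.* (a ℕ.+ b))) ≤ ½ ^ℚ τ
2·18^b≤ a b τ τ<t = begin
  2ℚ * ((2ℚ ^ℚ b) * ((3ℚ ^ℚ b) * (3ℚ ^ℚ b))) * (½ ^ℚ (6 ℕ.* t))
    ≤⟨ *-mono-≤ (0≤* 0≤2 (0≤* (0≤2^ b) (0≤* (^-nonNeg 0≤3 b) (^-nonNeg 0≤3 b)))) (0≤½^ (6 ℕ.* t)) (*-monoˡ 2ℚ 0≤2 18^b≤) (½^-antimono {5 ℕ.* b ℕ.+ t} {6 ℕ.* t} exps) ⟩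
  2ℚ * (2ℚ ^ℚ (5 ℕ.* b)) * (½ ^ℚ (5 ℕ.* b ℕ.+ t))
    ≡⟨ cong (2ℚ * (2ℚ ^ℚ (5 ℕ.* b)) *_) (^-+ ½ (5 ℕ.* b) t) ⟩
  2ℚ * (2ℚ ^ℚ (5 ℕ.* b)) * ((½ ^ℚ (5 ℕ.* b)) * (½ ^ℚ t))
    ≡⟨ solve 3 (λ x y z → con 2ℚ :* x :* (y :* z) := x :* y :* (con 2ℚ :* z)) refl (2ℚ ^ℚ (5 ℕ.* b)) (½ ^ℚ (5 ℕ.* b)) (½ ^ℚ t) ⟩
  (2ℚ ^ℚ (5 ℕ.* b)) * (½ ^ℚ (5 ℕ.* b)) * (2ℚ * (½ ^ℚ t)) ≡⟨ cong (_* (2ℚ * (½ ^ℚ t))) (2^*½^ (5 ℕ.* b)) ⟩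
  1ℚ * (2ℚ * (½ ^ℚ t)) ≡⟨ *-identityˡ _ ⟩
  2ℚ * (½ ^ℚ t) ≤⟨ *-monoˡ 2ℚ 0≤2 (½^-antimono {suc τ} {t} τ<t) ⟩
  2ℚ * (½ * (½ ^ℚ τ)) ≡⟨ solve 1 (λ x → con 2ℚ :* (con ½ :* x) := x) refl (½ ^ℚ τ) ⟩
  ½ ^ℚ τ ∎
  where
  open ≤-Reasoning
  t = a ℕ.+ b
  exps : 5 ℕ.* b ℕ.+ t ℕ.≤ 6 ℕ.* t
  exps = ℕₚ.≤-trans (ℕₚ.+-monoˡ-≤ t (ℕₚ.*-monoʳ-≤ 5 (ℕₚ.m≤n+m b a))) (ℕₚ.≤-reflexive (ℕₚ.+-comm (5 ℕ.* t) t))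
  18^b≤ : (2ℚ ^ℚ b) * ((3ℚ ^ℚ b) * (3ℚ ^ℚ b)) ≤ 2ℚ ^ℚ (5 ℕ.* b)
  18^b≤ = ≤-trans (≤-reflexive (trans (cong ((2ℚ ^ℚ b) *_) (sym (^-distrib-* 3ℚ 3ℚ b))) (sym (^-distrib-* 2ℚ (3ℚ * 3ℚ) b))))
    (≤-trans (^-monoˡ (0≤* 0≤2 (0≤* 0≤3 0≤3)) (≤-gap {2ℚ * (3ℚ * 3ℚ)} {2ℚ ^ℚ 5} (2ℚ * (2ℚ * 2ℚ + 3ℚ)) (0≤* 0≤2 (0≤+ (0≤* 0≤2 0≤2) 0≤3)) refl) b) (≤-reflexive (sym (^-* 2ℚ 5 b))))

-- After the square is distributed over the strata, one of the two copies of each stratum is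
-- replaced by its lightness bound and the other is kept, so the result is linear in `norm² w`.
-- Strata with `a + b ≤ τ` are empty.
noisy²-tail : ∀ e a τ {n} (w : Cube n → ℚ) → (∀ b → stratum w b * (2ℚ ^ℚ (e ℕ.* a ℕ.+ 6 ℕ.* (a ℕ.+ b))) ≤ 1ℚ) →
  (∀ R → w R ≡ 0ℚ ⊎ τ ℕ.< a ℕ.+ card R) → noisy² w * noisy² w * (2ℚ ^ℚ (e ℕ.* a)) ≤ (½ ^ℚ τ) * norm² w
noisy²-tail e a τ {n} w light large = begin
  noisy² w * noisy² w * X ≡⟨ cong (λ s → s ² * X) (∑-strata (3ℚ ^ℚ_) w) ⟩
  ∫ (finF (suc n)) y ² * X ≤⟨ *-monoʳ X (0≤2^ (e ℕ.* a)) (geometric-CS (suc n) y) ⟩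
  2ℚ * ∫ (finF (suc n)) (λ b → (2ℚ ^ℚ toℕ b) * y b ²) * X
    ≡⟨ trans (cong (_* X) (sym (∫-*ˡ (finF (suc n)) 2ℚ _))) (sym (∫-*ʳ (finF (suc n)) X _)) ⟩
  ∫ (finF (suc n)) (λ b → 2ℚ * ((2ℚ ^ℚ toℕ b) * y b ²) * X) ≤⟨ ∫-mono (finF (suc n)) (λ b → point (toℕ b)) ⟩
  ∫ (finF (suc n)) (λ b → (½ ^ℚ τ) * stratum w (toℕ b)) ≡⟨ sym (∑-strata (λ _ → ½ ^ℚ τ) w) ⟩
  ∑ (λ R → (½ ^ℚ τ) * w R ²) ≡⟨ ∫-*ˡ (ΣF n) (½ ^ℚ τ) _ ⟩
  (½ ^ℚ τ) * norm² w ∎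
  where
  open ≤-Reasoning
  X = 2ℚ ^ℚ (e ℕ.* a)
  y : Fin (suc n) → ℚ
  y b = (3ℚ ^ℚ toℕ b) * stratum w (toℕ b)
  empty : ∀ b → a ℕ.+ b ℕ.≤ τ → stratum w b ≡ 0ℚ
  empty b p = trans (∫-cong (ΣF n) zero-at) (∫-0 (ΣF n))
    where
    zero-at : ∀ R → (w R ² when (card R ℕ.≟ b)) ≡ 0ℚ
    zero-at R with card R ℕ.≟ b | large R
    ... | no _ | _ = refl
    ... | yes _ | inj₁ e = trans (cong _² e) (*-zeroˡ 0ℚ)
    ... | yes refl | inj₂ q = ⊥-elim (ℕₚ.<-irrefl refl (ℕₚ.<-≤-trans q p))
  scaled : ∀ b → stratum w b * X ≤ ½ ^ℚ (6 ℕ.* (a ℕ.+ b))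
  scaled b = ≤½^ (6 ℕ.* (a ℕ.+ b)) (≤-trans (≤-reflexive (trans (*-assoc (stratum w b) X _) (cong (stratum w b *_) (sym (^-+ 2ℚ (e ℕ.* a) (6 ℕ.* (a ℕ.+ b))))))) (light b))
  point : ∀ b → 2ℚ * ((2ℚ ^ℚ b) * ((3ℚ ^ℚ b) * stratum w b) ²) * X ≤ (½ ^ℚ τ) * stratum w b
  point b with (a ℕ.+ b) ℕ.≤? τ
  ... | yes p = ≤-reflexive (trans (cong (λ s → 2ℚ * ((2ℚ ^ℚ b) * ((3ℚ ^ℚ b) * s) ²) * X) (empty b p))
                  (trans (solve 3 (λ x y z → con 2ℚ :* (x :* ((y :* con 0ℚ) :* (y :* con 0ℚ))) :* z := con 0ℚ) refl (2ℚ ^ℚ b) (3ℚ ^ℚ b) X)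
                    (sym (trans (cong ((½ ^ℚ τ) *_) (empty b p)) (*-zeroʳ (½ ^ℚ τ))))))
  ... | no ¬p = begin
    2ℚ * (B * (T * s) ²) * X ≡⟨ solve 4 (λ b t s x → con 2ℚ :* (b :* ((t :* s) :* (t :* s))) :* x := con 2ℚ :* (b :* (t :* t)) :* (s :* x) :* s) refl B T s X ⟩
    2ℚ * (B * (T * T)) * (s * X) * s
      ≤⟨ *-monoʳ s (stratum-nonNeg w b) (*-monoˡ (2ℚ * (B * (T * T))) (0≤* 0≤2 (0≤* (0≤2^ b) (0≤* (^-nonNeg 0≤3 b) (^-nonNeg 0≤3 b)))) (scaled b)) ⟩
    2ℚ * (B * (T * T)) * (½ ^ℚ (6 ℕ.* (a ℕ.+ b))) * s ≤⟨ *-monoʳ s (stratum-nonNeg w b) (2·18^b≤ a b τ (ℕₚ.≰⇒> ¬p)) ⟩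
    (½ ^ℚ τ) * s ∎
    where
    B = 2ℚ ^ℚ b
    T = 3ℚ ^ℚ b
    s = stratum w b

-- Binomial coefficients (`t` choose `k`) and random masks

bin : ℕ → ℕ → ℚ
bin zero t = 1ℚ
bin (suc k) zero = 0ℚ
bin (suc k) (suc t) = bin (suc k) t + bin k t

bin-nonNeg : ∀ k t → 0ℚ ≤ bin k t
bin-nonNeg zero t = 0≤1
bin-nonNeg (suc k) zero = ≤-refl
bin-nonNeg (suc k) (suc t) = 0≤+ (bin-nonNeg (suc k) t) (bin-nonNeg k t)

bin≤^ : ∀ k t → bin k t ≤ ι t ^ℚ k
bin≤^ zero t = ≤-refl
bin≤^ (suc k) zero = ≤-reflexive (sym (*-zeroˡ (0ℚ ^ℚ k)))
bin≤^ (suc k) (suc t) = begin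
  bin (suc k) t + bin k t ≤⟨ +-mono-≤ (bin≤^ (suc k) t) (bin≤^ k t) ⟩
  ι t * (ι t ^ℚ k) + (ι t ^ℚ k) ≡⟨ solve 2 (λ a b → a :* b :+ b := (con 1ℚ :+ a) :* b) refl (ι t) (ι t ^ℚ k) ⟩
  (1ℚ + ι t) * (ι t ^ℚ k) ≤⟨ *-monoˡ (1ℚ + ι t) (0≤+ 0≤1 (ι-nonNeg t)) (^-monoˡ (ι-nonNeg t) (≤+ˡ 1ℚ 0≤1) k) ⟩
  (1ℚ + ι t) * ((1ℚ + ι t) ^ℚ k) ∎
  where open ≤-Reasoning

1≤bin : ∀ k t → k ℕ.≤ t → 1ℚ ≤ bin k t
1≤bin zero t p = ≤-refl
1≤bin (suc k) (suc t) (ℕ.s≤s p) = ≤-trans (1≤bin k t p) (≤+ˡ (bin (suc k) t) (bin-nonNeg (suc k) t))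

-- A fixed `k`-subset of `T` lies inside a uniformly random mask with probability `2^-k`; the
-- induction is Pascal's rule, one coordinate at a time.
E-bin-sel : ∀ {n} (T : Cube n) k → E (λ A → bin k (card (sel A T))) ≡ (½ ^ℚ k) * bin k (card T)
E-bin-neg : ∀ {n} (T : Cube n) k → E (λ A → bin k (card (sel (neg A) T))) ≡ (½ ^ℚ k) * bin k (card T)

bin-step : ∀ {n} (g : ℕ → Cube n → ℚ) t k → E (g (suc k)) ≡ (½ ^ℚ suc k) * bin (suc k) t → E (g k) ≡ (½ ^ℚ k) * bin k t →
  ½ * (E (λ A → g (suc k) A + g k A) + E (g (suc k))) ≡ (½ ^ℚ suc k) * bin (suc k) (suc t)
bin-step g t k e₁ e₀ = trans (cong (½ *_) (cong (_+ E (g (suc k))) (∫-+ (EF _) (g (suc k)) (g k))))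
  (trans (cong₂ (λ a b → ½ * ((a + b) + a)) e₁ e₀)
  (solve 3 (λ h x y → con ½ :* (((con ½ :* h) :* x :+ h :* y) :+ (con ½ :* h) :* x) := con ½ :* h :* (x :+ y)) refl (½ ^ℚ k) (bin (suc k) t) (bin k t)))

E-const : ∀ {n} c → E {n} (λ _ → c) ≡ c
E-const {zero} c = cubeF-[] _
E-const {suc n} c = trans (cubeF-∷ _) (trans (cong (λ a → ½ * (a + a)) (E-const {n} c)) (solve 1 (λ c → con ½ :* (c :+ c) := c) refl c))

half-double : ∀ a → ½ * (a + a) ≡ a
half-double a = solve 1 (λ c → con ½ :* (c :+ c) := c) refl a

E-bin-sel [] k = trans (cubeF-[] _) (base k)
  where
  base : ∀ k → bin k 0 ≡ (½ ^ℚ k) * bin k 0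
  base zero = refl
  base (suc k) = sym (*-zeroʳ (½ ^ℚ suc k))
E-bin-sel (t ∷ T) zero = E-const 1ℚ
E-bin-sel (true ∷ T) (suc k) = trans (cubeF-∷ _) (trans (cong (½ *_) (+-comm (E (λ A → bin (suc k) (card (sel A T)))) (E (λ A → bin (suc k) (card (sel A T)) + bin k (card (sel A T))))))
  (bin-step (λ k A → bin k (card (sel A T))) (card T) k (E-bin-sel T (suc k)) (E-bin-sel T k)))
E-bin-sel (false ∷ T) (suc k) = trans (cubeF-∷ _) (trans (half-double (E (λ A → bin (suc k) (card (sel A T))))) (E-bin-sel T (suc k)))

E-bin-neg [] k = trans (cubeF-[] _) (base k)
  where
  base : ∀ k → bin k 0 ≡ (½ ^ℚ k) * bin k 0
  base zero = refl
  base (suc k) = sym (*-zeroʳ (½ ^ℚ suc k))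
E-bin-neg (t ∷ T) zero = E-const 1ℚ
E-bin-neg (true ∷ T) (suc k) = trans (cubeF-∷ _)
  (bin-step (λ k A → bin k (card (sel (neg A) T))) (card T) k (E-bin-neg T (suc k)) (E-bin-neg T k))
E-bin-neg (false ∷ T) (suc k) = trans (cubeF-∷ _) (trans (half-double (E (λ A → bin (suc k) (card (sel (neg A) T))))) (E-bin-neg T (suc k)))

attain : ∀ {n} (g : Cube n → ℚ) b → E g ≤ b → Σ (Cube n) λ x → g x ≤ b
attain {zero} g b p = [] , ≤-trans (≤-reflexive (sym (cubeF-[] g))) p
attain {suc n} g b p with E (g ∘ (false ∷_)) ≤? b | E (g ∘ (true ∷_)) ≤? b
... | yes q | _ = let x , r = attain (g ∘ (false ∷_)) b q in false ∷ x , r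
... | no _ | yes q = let x , r = attain (g ∘ (true ∷_)) b q in true ∷ x , r
... | no q | no q′ = ⊥-elim (<-irrefl refl (<-≤-trans both (≤-trans (≤-reflexive (sym (cubeF-∷ g))) p)))
  where
  both : b < ½ * (E (g ∘ (false ∷_)) + E (g ∘ (true ∷_)))
  both = subst (_< ½ * (E (g ∘ (false ∷_)) + E (g ∘ (true ∷_)))) (half-double b) (*-monoʳ-<-pos ½ (+-mono-< (≰⇒> q) (≰⇒> q′)))

-- By averaging over all masks: a triple of T lies on one side of a random mask with probability 1/4.
balanced-mask : ∀ {n} (u : Cube n → ℚ) → Σ (Cube n) λ A →
  ∑ (λ T → bin 3 (card (sel A T)) * u T ²) + ∑ (λ T → bin 3 (card (sel (neg A) T)) * u T ²) ≤ ½ * ½ * ∑ (λ T → bin 3 (card T) * u T ²)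
balanced-mask {n} u = attain g (½ * ½ * ∑ (λ T → bin 3 (card T) * u T ²)) (≤-reflexive (begin
  E g ≡⟨ ∫-+ (EF n) _ _ ⟩
  E (λ A → ∑ (λ T → bin 3 (card (sel A T)) * u T ²)) + E (λ A → ∑ (λ T → bin 3 (card (sel (neg A) T)) * u T ²))
    ≡⟨ cong₂ _+_ (side (λ A T → bin 3 (card (sel A T))) (λ T → E-bin-sel T 3)) (side (λ A T → bin 3 (card (sel (neg A) T))) (λ T → E-bin-neg T 3)) ⟩
  (½ ^ℚ 3) * M + (½ ^ℚ 3) * M ≡⟨ solve 1 (λ m → con (½ ^ℚ 3) :* m :+ con (½ ^ℚ 3) :* m := con (½ * ½) :* m) refl M ⟩
  ½ * ½ * M ∎))
  where
  open ≡-Reasoning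
  M = ∑ (λ T → bin 3 (card T) * u T ²)
  g : Cube n → ℚ
  g A = ∑ (λ T → bin 3 (card (sel A T)) * u T ²) + ∑ (λ T → bin 3 (card (sel (neg A) T)) * u T ²)
  side : (s : Cube n → Cube n → ℚ) → (∀ T → E (λ A → s A T) ≡ (½ ^ℚ 3) * bin 3 (card T)) →
    E (λ A → ∑ (λ T → s A T * u T ²)) ≡ (½ ^ℚ 3) * M
  side s e = trans (∫-cubeF-swap (EF n) _) (trans (∫-cong (ΣF n) (λ T → trans (∫-*ʳ (EF n) (u T ²) _) (trans (cong (_* u T ²) (e T)) (*-assoc (½ ^ℚ 3) (bin 3 (card T)) (u T ²))))) (∫-*ˡ (ΣF n) (½ ^ℚ 3) _))

∫-lin₂ : ∀ {X : Set} (L : Functional X) a g b h → ∫ L (λ x → a * g x + b * h x) ≡ a * ∫ L g + b * ∫ L h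
∫-lin₂ L a g b h = trans (∫-+ L _ _) (cong₂ _+_ (∫-*ˡ L a g) (∫-*ˡ L b h))

-- Triples rather than pairs: the weight of this term must decay by more than the factor 2 per
-- round by which the weight of the energy grows.
cubic : ∀ {n} → (Cube n → ℚ) → ℚ
cubic u = ∑ (λ T → bin 3 (card T) * u T ²)

cubic-nonNeg : ∀ {n} (u : Cube n → ℚ) → 0ℚ ≤ cubic u
cubic-nonNeg u = ∫-nonNeg (ΣF _) (λ T → 0≤* (bin-nonNeg 3 (card T)) (0≤sq (u T)))

-- The inductive inequality and its transfer from restrictions

energy : ∀ {n} → (Cube n → ℚ) → ℚ
energy f = E (λ x → f x ²)

energy-nonNeg : ∀ {n} (f : Cube n → ℚ) → 0ℚ ≤ energy f
energy-nonNeg f = ∫-nonNeg (EF _) (λ x → 0≤sq (f x))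

-- The dimension is quantified inside because restrictions live on smaller cubes. The constant `c`
-- is not tied to the mean of `φ`: restriction changes the mean but keeps `c`. Restricted functions
-- may then have a nonzero coefficient at the empty set, and the size condition says little there,
-- so `u` has to vanish at it.
PairingBound : (α β γ ζ : ℚ) → ℕ → Set
PairingBound α β γ ζ e = ∀ {n} (φ : Cube n → Bool) c (u : Cube n → ℚ) → 0ℚ ≤ c → c ≤ 1ℚ →
  (∀ T → card T ≡ 0 → u T ≡ 0ℚ) → (∀ T → u T ² * (2ℚ ^ℚ (e ℕ.* card T)) ≤ 1ℚ) →
  pair (centred φ c) u ≤ (α * energy (centred φ c) + β * norm² u) + (γ * cubic u + ζ * influence (centred φ c))

truncate : ℚ → ℚ → ℚ
truncate X F = F when (F ² * X ≤? 1ℚ)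

truncate-bound : ∀ X F → truncate X F ² * X ≤ 1ℚ
truncate-bound X F with F ² * X ≤? 1ℚ
... | yes p = p
... | no _ = ≤-trans (≤-reflexive (solve 1 (λ x → con 0ℚ :* con 0ℚ :* x := con 0ℚ) refl X)) 0≤1

truncate-² : ∀ X F → truncate X F ² ≤ F ²
truncate-² X F with F ² * X ≤? 1ℚ
... | yes p = ≤-refl
... | no _ = 0≤sq F

-- Where `F` is cut off, `1 < F² * X`, hence `F² ≤ F² * F² * X`: the loss becomes a fourth moment,
-- which can be averaged by Bonami.
truncate-tail : ∀ k X → 0ℚ ≤ X → ∀ x F → x * F ≤ x * truncate X F + ((½ ^ℚ k) * x ² + (2ℚ ^ℚ k) * (F ² * F ² * X))
truncate-tail k X 0≤X x F with F ² * X ≤? 1ℚ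
... | yes p = ≤+ʳ _ (0≤+ (0≤* (0≤½^ k) (0≤sq x)) (0≤* (0≤2^ k) (0≤* (0≤* (0≤sq F) (0≤sq F)) 0≤X)))
... | no ¬p = ≤-trans (xy≤ k x F) (≤-trans (+-monoʳ-≤ ((½ ^ℚ k) * x ²) (*-monoˡ (2ℚ ^ℚ k) (0≤2^ k) F²≤))
    (≤-reflexive (solve 2 (λ x r → r := x :* con 0ℚ :+ r) refl x ((½ ^ℚ k) * x ² + (2ℚ ^ℚ k) * (F ² * F ² * X)))))
  where
  F²≤ : F ² ≤ F ² * F ² * X
  F²≤ = ≤-trans (≤-reflexive (sym (*-identityʳ (F ²)))) (≤-trans (*-monoˡ (F ²) (0≤sq F) (<⇒≤ (≰⇒> ¬p))) (≤-reflexive (sym (*-assoc (F ²) (F ²) X))))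

energy-split : ∀ {n} (A : Cube n) (f : Cube n → ℚ) → E (λ z → energy (restr A f z)) ≡ energy f
energy-split A f = trans (∫-cubeF-swap (EF _) _) (sym (∫-split A _))

norm²-split : ∀ {n} (A : Cube n) (u : Cube n → ℚ) → ∑ (λ S → norm² (slice A u S)) ≡ norm² u
norm²-split A u = sym (∫-split A _)

-- The variables outside `A` are fixed at `z`, `bound` is used for each restriction with truncated
-- coefficients, and the result is averaged over `z`. By linearity and the splitting identities the
-- averaging itself loses nothing; the cost is that of truncation, a little energy and the tail
-- controlled by the light strata.
branch : ∀ {α β γ ζ e} → 0ℚ ≤ β → 0ℚ ≤ γ → PairingBound α β γ ζ e → ∀ k τ {n} (A : Cube n) (φ : Cube n → Bool) c (v : Cube n → ℚ) →
  0ℚ ≤ c → c ≤ 1ℚ → (∀ T → card (sel A T) ≡ 0 → v T ≡ 0ℚ) →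
  (∀ S b → stratum (slice A v S) b * (2ℚ ^ℚ (e ℕ.* card S ℕ.+ 6 ℕ.* (card S ℕ.+ b))) ≤ 1ℚ) →
  (∀ T → v T ≡ 0ℚ ⊎ τ ℕ.< card T) →
  pair (centred φ c) v ≤ ((α + (½ ^ℚ k)) * energy (centred φ c) + (β + (2ℚ ^ℚ k) * (½ ^ℚ τ)) * norm² v)
    + (γ * ∑ (λ T → bin 3 (card (sel A T)) * v T ²) + ζ * ∑ (λ T → ι (card (sel A T)) * hat (centred φ c) T ²))
branch {α} {β} {γ} {ζ} {e} 0≤β 0≤γ bound k τ {n} A φ c v 0≤c c≤1 v∅ light large = begin
  pair f v ≡⟨ pair-split A f v ⟩
  E (λ z → ∑ (λ S → x z S * F z S)) ≤⟨ ∫-mono (EF _) perz ⟩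
  E (λ z → ((α * energy (f′ z) + β * ∑ (λ S → F z S ²)) + (γ * ∑ (λ S → bin 3 (card S) * F z S ²) + ζ * influence (f′ z)))
         + ((½ ^ℚ k) * energy (f′ z) + (2ℚ ^ℚ k) * ∑ (λ S → Q z S)))
    ≡⟨ trans (∫-+ (EF _) _ _) (cong₂ _+_ (trans (∫-+ (EF _) _ _) (cong₂ _+_ (∫-lin₂ (EF _) α _ β _) (∫-lin₂ (EF _) γ _ ζ _))) (∫-lin₂ (EF _) (½ ^ℚ k) _ (2ℚ ^ℚ k) _)) ⟩
  ((α * E (λ z → energy (f′ z)) + β * E (λ z → ∑ (λ S → F z S ²))) + (γ * E (λ z → ∑ (λ S → bin 3 (card S) * F z S ²)) + ζ * E (λ z → influence (f′ z))))
         + ((½ ^ℚ k) * E (λ z → energy (f′ z)) + (2ℚ ^ℚ k) * E (λ z → ∑ (λ S → Q z S)))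
    ≡⟨ cong₂ _+_ (cong₂ _+_ (cong₂ (λ a b → α * a + β * b) (energy-split A f) E∑F²) (cong₂ (λ a b → γ * a + ζ * b) (ev²-split A (λ S → bin 3 (card S)) v) (hat²-split A (λ S → ι (card S)) f)))
                 (cong (λ a → (½ ^ℚ k) * a + (2ℚ ^ℚ k) * E (λ z → ∑ (λ S → Q z S))) (energy-split A f)) ⟩
  ((α * V + β * N) + R) + ((½ ^ℚ k) * V + (2ℚ ^ℚ k) * E (λ z → ∑ (λ S → Q z S)))
    ≤⟨ +-monoʳ-≤ ((α * V + β * N) + R) (+-monoʳ-≤ ((½ ^ℚ k) * V) (*-monoˡ (2ℚ ^ℚ k) (0≤2^ k) tail)) ⟩
  ((α * V + β * N) + R) + ((½ ^ℚ k) * V + (2ℚ ^ℚ k) * ((½ ^ℚ τ) * N))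
    ≡⟨ solve 8 (λ a b V N R h t w → ((a :* V :+ b :* N) :+ R) :+ (h :* V :+ t :* (w :* N)) := ((a :+ h) :* V :+ (b :+ t :* w) :* N) :+ R) refl α β V N R (½ ^ℚ k) (2ℚ ^ℚ k) (½ ^ℚ τ) ⟩
  ((α + (½ ^ℚ k)) * V + (β + (2ℚ ^ℚ k) * (½ ^ℚ τ)) * N) + R ∎
  where
  open ≤-Reasoning
  f = centred φ c
  f′ : Cube (card (neg A)) → Cube (card A) → ℚ
  f′ z = restr A f z
  x F Q h : Cube (card (neg A)) → Cube (card A) → ℚ
  X : Cube (card A) → ℚ
  X S = 2ℚ ^ℚ (e ℕ.* card S)
  x z S = hat (f′ z) S
  F z S = ev (slice A v S) z
  Q z S = F z S ² * F z S ² * X S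
  h z S = truncate (X S) (F z S)
  V = energy f
  N = norm² v
  R = γ * ∑ (λ T → bin 3 (card (sel A T)) * v T ²) + ζ * ∑ (λ T → ι (card (sel A T)) * hat f T ²)
  slice-∅ : ∀ S → card S ≡ 0 → ∀ z → F z S ≡ 0ℚ
  slice-∅ S p z = trans (∫-cong (ΣF _) (λ R → trans (cong (_* χᵣ R z) (v∅ (merge A S R) (trans (cong card (sel-merge A S R)) p))) (*-zeroˡ (χᵣ R z)))) (∫-0 (ΣF _))
  h-∅ : ∀ z S → card S ≡ 0 → h z S ≡ 0ℚ
  h-∅ z S p = trans (cong (truncate (X S)) (slice-∅ S p z)) (trunc0 (0ℚ ² * X S ≤? 1ℚ))
    where
    trunc0 : ∀ {P : Set} (d : Dec P) → 0ℚ when d ≡ 0ℚ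
    trunc0 (yes _) = refl
    trunc0 (no _) = refl
  perz : ∀ z → ∑ (λ S → x z S * F z S)
    ≤ ((α * energy (f′ z) + β * ∑ (λ S → F z S ²)) + (γ * ∑ (λ S → bin 3 (card S) * F z S ²) + ζ * influence (f′ z)))
         + ((½ ^ℚ k) * energy (f′ z) + (2ℚ ^ℚ k) * ∑ (λ S → Q z S))
  perz z = begin
    ∑ (λ S → x z S * F z S) ≤⟨ ∫-mono (ΣF _) (λ S → truncate-tail k (X S) (0≤2^ (e ℕ.* card S)) (x z S) (F z S)) ⟩
    ∑ (λ S → x z S * h z S + ((½ ^ℚ k) * x z S ² + (2ℚ ^ℚ k) * Q z S))
      ≡⟨ trans (∫-+ (ΣF _) _ _) (cong (pair (f′ z) (h z) +_) (trans (∫-lin₂ (ΣF _) (½ ^ℚ k) (λ S → x z S ²) (2ℚ ^ℚ k) (Q z)) (cong (λ a → (½ ^ℚ k) * a + (2ℚ ^ℚ k) * ∑ (Q z)) (parseval (f′ z))))) ⟩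
    pair (f′ z) (h z) + ((½ ^ℚ k) * energy (f′ z) + (2ℚ ^ℚ k) * ∑ (Q z))
      ≤⟨ +-monoˡ-≤ ((½ ^ℚ k) * energy (f′ z) + (2ℚ ^ℚ k) * ∑ (Q z)) (bound (restr A φ z) c (h z) 0≤c c≤1 (h-∅ z) (λ S → truncate-bound (X S) (F z S))) ⟩
    ((α * energy (f′ z) + β * norm² (h z)) + (γ * cubic (h z) + ζ * influence (f′ z))) + ((½ ^ℚ k) * energy (f′ z) + (2ℚ ^ℚ k) * ∑ (Q z))
      ≤⟨ +-monoˡ-≤ ((½ ^ℚ k) * energy (f′ z) + (2ℚ ^ℚ k) * ∑ (Q z)) (+-mono-≤
           (+-monoʳ-≤ (α * energy (f′ z)) (*-monoˡ β 0≤β (∫-mono (ΣF _) (λ S → truncate-² (X S) (F z S)))))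
           (+-monoˡ-≤ (ζ * influence (f′ z)) (*-monoˡ γ 0≤γ (∫-mono (ΣF _) (λ S → *-monoˡ (bin 3 (card S)) (bin-nonNeg 3 (card S)) (truncate-² (X S) (F z S))))))) ⟩
    _ ∎
  E∑F² : E (λ z → ∑ (λ S → F z S ²)) ≡ N
  E∑F² = trans (∫-cong (EF _) (λ z → ∫-cong (ΣF _) (λ S → sym (*-identityˡ (F z S ²)))))
    (trans (ev²-split A (λ _ → 1ℚ) v) (∫-cong (ΣF _) (λ T → *-identityˡ (v T ²))))
  tail : E (λ z → ∑ (λ S → Q z S)) ≤ (½ ^ℚ τ) * N
  tail = begin
    E (λ z → ∑ (λ S → Q z S)) ≡⟨ ∫-cubeF-swap (EF _) _ ⟩
    ∑ (λ S → E (λ z → F z S ² * F z S ² * X S)) ≡⟨ ∫-cong (ΣF _) (λ S → ∫-*ʳ (EF _) (X S) _) ⟩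
    ∑ (λ S → E (λ z → F z S ² * F z S ²) * X S)
      ≤⟨ ∫-mono (ΣF _) (λ S → *-monoʳ (X S) (0≤2^ (e ℕ.* card S)) (bonami (slice A v S) (slice A v S))) ⟩
    ∑ (λ S → noisy² (slice A v S) * noisy² (slice A v S) * X S)
      ≤⟨ ∫-mono (ΣF _) (λ S → noisy²-tail e (card S) τ (slice A v S) (light S) (big S)) ⟩
    ∑ (λ S → (½ ^ℚ τ) * norm² (slice A v S)) ≡⟨ ∫-*ˡ (ΣF _) (½ ^ℚ τ) _ ⟩
    (½ ^ℚ τ) * ∑ (λ S → norm² (slice A v S)) ≡⟨ cong ((½ ^ℚ τ) *_) (norm²-split A v) ⟩
    (½ ^ℚ τ) * N ∎
    where
    big : ∀ S R → slice A v S R ≡ 0ℚ ⊎ τ ℕ.< card S ℕ.+ card R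
    big S R with large (merge A S R)
    ... | inj₁ p = inj₁ p
    ... | inj₂ p = inj₂ (subst (τ ℕ.<_) (card-merge A S R) p)

-- Light and heavy strata of a mask

does-true : ∀ {P : Set} (d : Dec P) → does d ≡ true → P
does-true (yes p) _ = p

does-false : ∀ {P : Set} (d : Dec P) → does d ≡ false → ¬ P
does-false (no ¬p) _ = ¬p

on-false : ∀ {n} (p : Cube n → Bool) u T → p T ≡ false → on p u T ≡ 0ℚ
on-false p u T e = trans (cong (λ b → val b * u T) e) (*-zeroˡ (u T))

-- The strata |T∖A| = b are kept apart, and the factor 2^(6(a+b)) pays for Bonami's 9^b, so that
-- no balance between the two sides of the mask is needed.
weight : ℕ → ℕ → ℕ → ℚ
weight e a b = 2ℚ ^ℚ (e ℕ.* a ℕ.+ 6 ℕ.* (a ℕ.+ b))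

lightAt : ∀ e {n} (A : Cube n) (u : Cube n → ℚ) S b → Dec (stratum (slice A u S) b * weight e (card S) b ≤ 1ℚ)
lightAt e A u S b = stratum (slice A u S) b * weight e (card S) b ≤? 1ℚ

nonzero : ℕ → Bool
nonzero zero = false
nonzero (suc _) = true

nonzero-false : ∀ {a} → nonzero a ≡ false → a ≡ 0
nonzero-false {zero} _ = refl

-- Sets with empty trace on `A` are rejected: they would become the empty frequency of the
-- restricted problem, where `PairingBound` demands 0. Otherwise the verdict depends on `R` only
-- through its size, so each stratum is kept or dropped as a whole.
lightBool : ℕ → ∀ {n} (A : Cube n) (u : Cube n → ℚ) → Cube (card A) → Cube (card (neg A)) → Bool
lightBool e A u S R = nonzero (card S) ∧ does (lightAt e A u S (card R))

light : ℕ → ∀ {n} (A : Cube n) (u : Cube n → ℚ) → Cube n → Bool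
light e A u T = lightBool e A u (sel A T) (sel (neg A) T)

light-merge : ∀ e {n} (A : Cube n) u S R → light e A u (merge A S R) ≡ lightBool e A u S R
light-merge e A u S R = cong₂ (lightBool e A u) (sel-merge A S R) (sel-neg-merge A S R)

∧-false : ∀ a b → a ∧ b ≡ false → a ≡ false ⊎ b ≡ false
∧-false false b e = inj₁ refl
∧-false true b e = inj₂ e

light-∅ : ∀ e {n} (A : Cube n) u r T → card (sel A T) ≡ 0 → on (light e A u) r T ≡ 0ℚ
light-∅ e A u r T p = on-false (light e A u) r T (cong (λ a → nonzero a ∧ does (lightAt e A u (sel A T) (card (sel (neg A) T)))) p)

stratum-mono : ∀ {n} (v w : Cube n → ℚ) → (∀ R → v R ² ≤ w R ²) → ∀ b → stratum v b ≤ stratum w b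
stratum-mono v w p b = ∫-mono (ΣF _) (λ R → point R (card R ℕ.≟ b))
  where
  point : ∀ R {P : Set} (d : Dec P) → (v R ² when d) ≤ (w R ² when d)
  point R (yes _) = p R
  point R (no _) = ≤-refl

light-stratum : ∀ e {n} (A : Cube n) u r → r ⊑ u → ∀ S b →
  stratum (slice A (on (light e A u) r) S) b * weight e (card S) b ≤ 1ℚ
light-stratum e A u r r⊑u S b with lightAt e A u S b in eq
... | yes p = ≤-trans (*-monoʳ (weight e (card S) b) (0≤2^ (e ℕ.* card S ℕ.+ 6 ℕ.* (card S ℕ.+ b))) (stratum-mono (slice A (on (light e A u) r) S) (slice A u S) (λ R → ⊑-² (⊑-trans (on-⊑ (light e A u) r) r⊑u) (merge A S R)) b)) p
... | no ¬p = ≤-trans (≤-reflexive (trans (cong (_* weight e (card S) b) (trans (∫-cong (ΣF _) vanish) (∫-0 (ΣF _)))) (*-zeroˡ (weight e (card S) b)))) 0≤1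
  where
  vanish : ∀ R → (slice A (on (light e A u) r) S R ² when (card R ℕ.≟ b)) ≡ 0ℚ
  vanish R with card R ℕ.≟ b
  ... | no _ = refl
  ... | yes refl = trans (cong _² (on-false (light e A u) r (merge A S R) (trans (light-merge e A u S R) dark))) (*-zeroˡ 0ℚ)
    where
    ∧-zeroʳ′ : ∀ a → a ∧ false ≡ false
    ∧-zeroʳ′ true = refl
    ∧-zeroʳ′ false = refl
    dark : lightBool e A u S R ≡ false
    dark = trans (cong (λ d → nonzero (card S) ∧ does d) eq) (∧-zeroʳ′ (nonzero (card S)))

card≡0⇒ : ∀ {n} (T : Cube n) → card T ≡ 0 → T ≡ replicate n false
card≡0⇒ [] e = refl
card≡0⇒ (false ∷ T) e = cong (false ∷_) (card≡0⇒ T e)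

2^-mono : ∀ {a b} → a ℕ.≤ b → 2ℚ ^ℚ a ≤ 2ℚ ^ℚ b
2^-mono = ^-monoʳ 1≤2

-- For a set inside `A` the stratum of size 0 consists of its own coefficient, so the size bound on
-- `u` already makes it light. This covers the sets that miss one side of the mask, where no heavy
-- stratum is available on that side.
light-inside : ∀ e {n} (A : Cube n) u → (∀ T → u T ² * (2ℚ ^ℚ ((e ℕ.+ 13) ℕ.* card T)) ≤ 1ℚ) →
  ∀ T → card (sel (neg A) T) ≡ 0 → 1 ℕ.≤ card T → light e A u T ≡ true
light-inside e A u small T p 1≤t with light e A u T in eq
... | true = refl
... | false with ∧-false (nonzero (card S)) (does (lightAt e A u S (card R))) eq
  where
  S = sel A T
  R = sel (neg A) T
... | inj₁ z = ⊥-elim (ℕₚ.<-irrefl refl (subst (1 ℕ.≤_) (trans (sym (card-sel A T)) (cong₂ ℕ._+_ (nonzero-false {card (sel A T)} z) p)) 1≤t))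
... | inj₂ z = ⊥-elim (does-false (lightAt e A u S (card R)) z (begin
  stratum (slice A u S) (card R) * weight e (card S) (card R)
    ≡⟨ cong₂ (λ b c → stratum (slice A u S) b * weight e c b) p cardS ⟩
  stratum (slice A u S) 0 * weight e (card T) 0
    ≡⟨ cong (_* weight e (card T) 0) (trans (∑-card-0 (λ R → slice A u S R ²)) (cong (λ X → u X ²) (trans (cong (merge A S) (sym (card≡0⇒ R p))) (merge-sel A T)))) ⟩
  u T ² * weight e (card T) 0
    ≤⟨ *-monoˡ (u T ²) (0≤sq (u T)) (2^-mono exps) ⟩
  u T ² * (2ℚ ^ℚ ((e ℕ.+ 13) ℕ.* card T)) ≤⟨ small T ⟩
  1ℚ ∎))
  where
  open ≤-Reasoning
  S = sel A T
  R = sel (neg A) T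
  cardS : card S ≡ card T
  cardS = trans (sym (ℕₚ.+-identityʳ (card S))) (trans (cong (card S ℕ.+_) (sym p)) (card-sel A T))
  exps : e ℕ.* card T ℕ.+ 6 ℕ.* (card T ℕ.+ 0) ℕ.≤ (e ℕ.+ 13) ℕ.* card T
  exps = ℕₚ.≤-trans (ℕₚ.+-monoʳ-≤ (e ℕ.* card T) (ℕₚ.≤-trans (ℕₚ.≤-reflexive (cong (6 ℕ.*_) (ℕₚ.+-identityʳ (card T)))) (ℕₚ.*-monoˡ-≤ (card T) (ℕₚ.m≤m+n 6 7))))
    (ℕₚ.≤-reflexive (sym (ℕₚ.*-distribʳ-+ (card T) e 13)))

stratum≤ : ∀ {n} (w : Cube n → ℚ) b → stratum w b ≤ norm² w
stratum≤ w b = ∫-mono (ΣF _) (λ R → when-≤ (0≤sq (w R)) (card R ℕ.≟ b))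

-- The product on the right sums to (norm² u)² over all T, so these sets carry little mass.
heavy-point : ∀ e τ {n} (A : Cube n) u → (∀ T → u T ² * (2ℚ ^ℚ ((e ℕ.+ 13) ℕ.* card T)) ≤ 1ℚ) →
  ∀ T → τ ℕ.< card T → light e A u T ≡ false → light e (neg A) u T ≡ false →
  u T ² ≤ (½ ^ℚ τ) * (norm² (slice A u (sel A T)) * norm² (slice (neg A) u (sel (neg A) T)))
heavy-point e τ A u small T τ<t dA dB = by-sides (card SA) (card SB) refl refl
  where
  open ≤-Reasoning
  t xA xB : ℕ
  t = card T
  SA = sel A T
  SB = sel (neg A) T
  sA = stratum (slice A u SA) (card SB)
  wA = weight e (card SA) (card SB)
  sB = stratum (slice (neg A) u SB) (card (sel (neg (neg A)) T))
  wB = weight e (card SB) (card (sel (neg (neg A)) T))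
  heavy : ∀ {a c} x → nonzero a ∧ does (x ≤? 1ℚ) ≡ false → a ≡ suc c → 1ℚ ≤ x
  heavy x d refl = <⇒≤ (≰⇒> (does-false (x ≤? 1ℚ) d))
  xA = e ℕ.* card SA ℕ.+ 6 ℕ.* (card SA ℕ.+ card SB)
  xB = e ℕ.* card SB ℕ.+ 6 ℕ.* (card SB ℕ.+ card (sel (neg (neg A)) T))
  exps : xA ℕ.+ xB ℕ.+ t ≡ (e ℕ.+ 13) ℕ.* t
  exps = trans (cong (λ x → (e ℕ.* card SA ℕ.+ 6 ℕ.* (card SA ℕ.+ card SB)) ℕ.+ (e ℕ.* card SB ℕ.+ 6 ℕ.* (card SB ℕ.+ x)) ℕ.+ t) (card-sel-neg-neg A T))
    (trans (cong ((e ℕ.* card SA ℕ.+ 6 ℕ.* (card SA ℕ.+ card SB)) ℕ.+ (e ℕ.* card SB ℕ.+ 6 ℕ.* (card SB ℕ.+ card SA)) ℕ.+_) (sym (card-sel A T)))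
    (trans (solveℕ 3 (λ e a b → (e :⊗ a :⊕ conℕ 6 :⊗ (a :⊕ b)) :⊕ (e :⊗ b :⊕ conℕ 6 :⊗ (b :⊕ a)) :⊕ (a :⊕ b)
       :≡ (e :⊕ conℕ 13) :⊗ (a :⊕ b)) refl e (card SA) (card SB)) (cong ((e ℕ.+ 13) ℕ.*_) (card-sel A T))))
  scaled : u T ² * (wA * wB) ≤ ½ ^ℚ τ
  scaled = ≤-trans (≤½^ t (≤-trans (≤-reflexive (trans (*-assoc (u T ²) (wA * wB) (2ℚ ^ℚ t)) (cong (u T ² *_)
    (trans (cong (_* (2ℚ ^ℚ t)) (sym (^-+ 2ℚ xA xB)))
    (trans (sym (^-+ 2ℚ (xA ℕ.+ xB) t)) (cong (2ℚ ^ℚ_) exps)))))) (small T))) (½^-antimono {τ} {t} (ℕₚ.<⇒≤ τ<t))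
  1≤t : 1 ℕ.≤ card T
  1≤t = ℕₚ.≤-trans (ℕ.s≤s ℕ.z≤n) τ<t
  true≢false : ∀ {X : Set} → true ≡ false → X
  true≢false ()
  by-sides : ∀ a b → card SA ≡ a → card SB ≡ b → u T ² ≤ (½ ^ℚ τ) * (norm² (slice A u SA) * norm² (slice (neg A) u SB))
  -- A set that misses `A` lies inside `neg A` and is light there.
  by-sides zero _ eqa _ = true≢false (trans (sym (light-inside e (neg A) u small T (trans (card-sel-neg-neg A T) eqa) 1≤t)) dB)
  by-sides (suc _) zero _ eqb = true≢false (trans (sym (light-inside e A u small T eqb 1≤t)) dA)
  by-sides (suc _) (suc _) eqa eqb = begin
    u T ² ≡⟨ solve 1 (λ x → x := x :* (con 1ℚ :* con 1ℚ)) refl (u T ²) ⟩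
    u T ² * (1ℚ * 1ℚ)
      ≤⟨ *-monoˡ (u T ²) (0≤sq (u T)) (*-mono-≤ {1ℚ} {sA * wA} {1ℚ} {sB * wB} 0≤1 0≤1 (heavy (sA * wA) dA eqa) (heavy (sB * wB) dB eqb)) ⟩
    u T ² * (sA * wA * (sB * wB))
      ≡⟨ solve 5 (λ x s w r v → x :* (s :* w :* (r :* v)) := x :* (w :* v) :* (s :* r)) refl (u T ²) sA wA sB wB ⟩
    u T ² * (wA * wB) * (sA * sB)
      ≤⟨ *-mono-≤ (0≤* (0≤sq (u T)) (0≤* (0≤2^ xA) (0≤2^ xB))) (0≤* (stratum-nonNeg (slice A u SA) (card SB)) (stratum-nonNeg (slice (neg A) u SB) (card (sel (neg (neg A)) T))))
           scaled (*-mono-≤ (stratum-nonNeg (slice A u SA) (card SB)) (stratum-nonNeg (slice (neg A) u SB) (card (sel (neg (neg A)) T))) (stratum≤ (slice A u SA) (card SB)) (stratum≤ (slice (neg A) u SB) (card (sel (neg (neg A)) T)))) ⟩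
    (½ ^ℚ τ) * (norm² (slice A u SA) * norm² (slice (neg A) u SB)) ∎

norm²-exceptional : ∀ e τ {n} (A : Cube n) u → (∀ T → u T ² * (2ℚ ^ℚ ((e ℕ.+ 13) ℕ.* card T)) ≤ 1ℚ) →
  ∀ w → w ⊑ u → (∀ T → w T ≡ 0ℚ ⊎ (τ ℕ.< card T × light e A u T ≡ false × light e (neg A) u T ≡ false)) →
  norm² w ≤ (½ ^ℚ τ) * (norm² u * norm² u)
norm²-exceptional e τ {n} A u small w w⊑u cases = begin
  norm² w ≤⟨ ∫-mono (ΣF n) point ⟩
  ∑ (λ T → (½ ^ℚ τ) * (pA (sel A T) * pB (sel (neg A) T))) ≡⟨ ∫-*ˡ (ΣF n) (½ ^ℚ τ) _ ⟩
  (½ ^ℚ τ) * ∑ (λ T → pA (sel A T) * pB (sel (neg A) T)) ≡⟨ cong ((½ ^ℚ τ) *_) (trans (∫-split A _) total) ⟩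
  (½ ^ℚ τ) * (norm² u * norm² u) ∎
  where
  open ≤-Reasoning
  pA : Cube (card A) → ℚ
  pA S = norm² (slice A u S)
  pB : Cube (card (neg A)) → ℚ
  pB R = norm² (slice (neg A) u R)
  point : ∀ T → w T ² ≤ (½ ^ℚ τ) * (pA (sel A T) * pB (sel (neg A) T))
  point T with cases T
  ... | inj₁ p = ≤-trans (≤-reflexive (trans (cong _² p) (*-zeroˡ 0ℚ))) (0≤* (0≤½^ τ) (0≤* (norm²-nonNeg (slice A u (sel A T))) (norm²-nonNeg (slice (neg A) u (sel (neg A) T)))))
  ... | inj₂ (p , q , r) = ≤-trans (⊑-² w⊑u T) (heavy-point e τ A u small T p q r)
  total : ∑ (λ S → ∑ (λ R → pA (sel A (merge A S R)) * pB (sel (neg A) (merge A S R)))) ≡ norm² u * norm² u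
  total = trans (∫-cong (ΣF _) (λ S → trans (∫-cong (ΣF _) (λ R → cong₂ (λ a b → pA a * pB b) (sel-merge A S R) (sel-neg-merge A S R))) (∫-*ˡ (ΣF _) (pA S) pB)))
    (trans (∫-*ʳ (ΣF _) (∑ pB) pA) (cong₂ _*_ (norm²-split A u) (norm²-split (neg A) u)))

-- One round of the recursion

2^*½^≤ : ∀ a b c → a ℕ.+ c ℕ.≤ b → (2ℚ ^ℚ a) * (½ ^ℚ b) ≤ ½ ^ℚ c
2^*½^≤ a b c p = begin
  (2ℚ ^ℚ a) * (½ ^ℚ b) ≤⟨ *-monoˡ (2ℚ ^ℚ a) (0≤2^ a) (½^-antimono {a ℕ.+ c} {b} p) ⟩
  (2ℚ ^ℚ a) * (½ ^ℚ (a ℕ.+ c)) ≡⟨ cong ((2ℚ ^ℚ a) *_) (^-+ ½ a c) ⟩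
  (2ℚ ^ℚ a) * ((½ ^ℚ a) * (½ ^ℚ c)) ≡⟨ sym (*-assoc (2ℚ ^ℚ a) (½ ^ℚ a) (½ ^ℚ c)) ⟩
  (2ℚ ^ℚ a) * (½ ^ℚ a) * (½ ^ℚ c) ≡⟨ cong (_* (½ ^ℚ c)) (2^*½^ a) ⟩
  1ℚ * (½ ^ℚ c) ≡⟨ *-identityˡ (½ ^ℚ c) ⟩
  ½ ^ℚ c ∎
  where open ≤-Reasoning

energy≤1 : ∀ {n} (φ : Cube n → Bool) c → 0ℚ ≤ c → c ≤ 1ℚ → energy (centred φ c) ≤ 1ℚ
energy≤1 φ c 0≤c c≤1 = ≤-trans (∫-mono (EF _) (λ x → point (φ x))) (≤-reflexive (E-const 1ℚ))
  where
  point : ∀ b → (val b - c) ² ≤ 1ℚ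
  point true = ≤-gap (c * (1ℚ - c) + c) (0≤+ (0≤* 0≤c (gap-≤ c≤1)) 0≤c) (solve 1 (λ c → con 1ℚ := (con 1ℚ :- c) :* (con 1ℚ :- c) :+ (c :* (con 1ℚ :- c) :+ c)) refl c)
  point false = ≤-gap (c * (1ℚ - c) + (1ℚ - c)) (0≤+ (0≤* 0≤c (gap-≤ c≤1)) (gap-≤ c≤1)) (solve 1 (λ c → con 1ℚ := (con 0ℚ :- c) :* (con 0ℚ :- c) :+ (c :* (con 1ℚ :- c) :+ (con 1ℚ :- c))) refl c)

-- Here boundedness of the Boolean function replaces a moment bound on u.
pair-giant : ∀ l {n} (φ : Cube n → Bool) c (u : Cube n → ℚ) → 0ℚ ≤ c → c ≤ 1ℚ → 2ℚ ^ℚ (l ℕ.+ l) ≤ norm² u →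
  pair (centred φ c) u ≤ 2ℚ * (½ ^ℚ l) * norm² u
pair-giant l φ c u 0≤c c≤1 big = begin
  pair f u ≤⟨ ∫-mono (ΣF _) (λ T → ≤-trans (≤-reflexive (*-comm (hat f T) (u T))) (xy≤ l (u T) (hat f T))) ⟩
  ∑ (λ T → (½ ^ℚ l) * u T ² + (2ℚ ^ℚ l) * hat f T ²) ≡⟨ trans (∫-lin₂ (ΣF _) (½ ^ℚ l) (λ T → u T ²) (2ℚ ^ℚ l) (λ T → hat f T ²)) (cong (λ a → (½ ^ℚ l) * norm² u + (2ℚ ^ℚ l) * a) (parseval f)) ⟩
  (½ ^ℚ l) * norm² u + (2ℚ ^ℚ l) * energy f ≤⟨ +-monoʳ-≤ ((½ ^ℚ l) * norm² u) (*-monoˡ (2ℚ ^ℚ l) (0≤2^ l) (energy≤1 φ c 0≤c c≤1)) ⟩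
  (½ ^ℚ l) * norm² u + (2ℚ ^ℚ l) * 1ℚ ≡⟨ cong (λ a → (½ ^ℚ l) * norm² u + (2ℚ ^ℚ l) * a) (sym (2^*½^ l)) ⟩
  (½ ^ℚ l) * norm² u + (2ℚ ^ℚ l) * ((2ℚ ^ℚ l) * (½ ^ℚ l))
    ≡⟨ solve 3 (λ h N t → h :* N :+ t :* (t :* h) := h :* N :+ h :* (t :* t)) refl (½ ^ℚ l) (norm² u) (2ℚ ^ℚ l) ⟩
  (½ ^ℚ l) * norm² u + (½ ^ℚ l) * ((2ℚ ^ℚ l) * (2ℚ ^ℚ l)) ≡⟨ cong (λ a → (½ ^ℚ l) * norm² u + (½ ^ℚ l) * a) (sym (^-+ 2ℚ l l)) ⟩
  (½ ^ℚ l) * norm² u + (½ ^ℚ l) * (2ℚ ^ℚ (l ℕ.+ l)) ≤⟨ +-monoʳ-≤ ((½ ^ℚ l) * norm² u) (*-monoˡ (½ ^ℚ l) (0≤½^ l) big) ⟩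
  (½ ^ℚ l) * norm² u + (½ ^ℚ l) * norm² u ≡⟨ solve 2 (λ h N → h :* N :+ h :* N := con 2ℚ :* h :* N) refl (½ ^ℚ l) (norm² u) ⟩
  2ℚ * (½ ^ℚ l) * norm² u ∎
  where
  open ≤-Reasoning
  f = centred φ c

-- Large enough that `2^k`, `2^h` and `2^(k+2l)`, each multiplied by `½ ^ℚ τ`, are at most `½ ^ℚ l`;
-- the third is for the exceptional sets, whose mass bound is quadratic in `norm² u`.
threshold : ℕ → ℕ → ℕ → ℕ
threshold k h l = k ℕ.+ h ℕ.+ (l ℕ.+ l ℕ.+ l)

module _ (k h l : ℕ) where
  k+l≤threshold : k ℕ.+ l ℕ.≤ threshold k h l
  k+l≤threshold = ℕₚ.+-mono-≤ (ℕₚ.m≤m+n k h) (ℕₚ.m≤n+m l (l ℕ.+ l))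

  h+l≤threshold : h ℕ.+ l ℕ.≤ threshold k h l
  h+l≤threshold = ℕₚ.+-mono-≤ (ℕₚ.m≤n+m h k) (ℕₚ.m≤n+m l (l ℕ.+ l))

  k+3l≤threshold : k ℕ.+ (l ℕ.+ l) ℕ.+ l ℕ.≤ threshold k h l
  k+3l≤threshold = ℕₚ.≤-trans (ℕₚ.≤-reflexive (ℕₚ.+-assoc k (l ℕ.+ l) l)) (ℕₚ.+-monoˡ-≤ (l ℕ.+ l ℕ.+ l) (ℕₚ.m≤m+n k h))

  2≤threshold : 2 ℕ.≤ k → 2 ℕ.≤ threshold k h l
  2≤threshold p = ℕₚ.≤-trans p (ℕₚ.≤-trans (ℕₚ.m≤m+n k l) k+l≤threshold)

  l<threshold : 2 ℕ.≤ k → l ℕ.< threshold k h l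
  l<threshold p = ℕₚ.≤-trans (ℕₚ.+-monoˡ-≤ l (ℕₚ.≤-trans (ℕ.s≤s ℕ.z≤n) p)) k+l≤threshold

lowDegree : ℕ → ∀ {n} → Cube n → Bool
lowDegree τ T = does (card T ℕ.≤? τ)

pair-low : ∀ k h l e {n} (φ : Cube n → Bool) c (u : Cube n → ℚ) → 2 ℕ.≤ k → leafExp h (threshold k h l) ℕ.≤ e →
  (∀ T → card T ≡ 0 → u T ≡ 0ℚ) → (∀ T → u T ² * (2ℚ ^ℚ (e ℕ.* card T)) ≤ 1ℚ) → norm² u ≤ 2ℚ ^ℚ (l ℕ.+ l) →
  pair (centred φ c) (on (lowDegree (threshold k h l)) u)
    ≤ (½ ^ℚ k) * energy (centred φ c) + 2ℚ * (½ ^ℚ h) * influence (centred φ c) + 2ℚ * (½ ^ℚ l) * norm² u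
pair-low k h l e φ c u 2≤k e₀≤e u∅ small N≤ = ≤-trans
  (pair-lowDegree h τ l k φ c v v∅ deg small′ (≤-trans v≤u N≤) (l<threshold k h l 2≤k))
  (+-monoʳ-≤ ((½ ^ℚ k) * energy (centred φ c) + 2ℚ * (½ ^ℚ h) * influence (centred φ c))
    (*-mono-≤ (0≤+ (0≤* (0≤2^ k) (0≤½^ τ)) (0≤* (0≤2^ h) (0≤½^ τ))) (norm²-nonNeg v)
      (≤-trans (+-mono-≤ (2^*½^≤ k τ l (k+l≤threshold k h l)) (2^*½^≤ h τ l (h+l≤threshold k h l))) (≤-reflexive (solve 1 (λ a → a :+ a := con 2ℚ :* a) refl (½ ^ℚ l))))
      v≤u))
  where
  τ = threshold k h l
  v = on (lowDegree τ) u
  v⊑u : v ⊑ u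
  v⊑u = on-⊑ (lowDegree τ) u
  v≤u : norm² v ≤ norm² u
  v≤u = ⊑-norm² v⊑u
  v∅ : ∀ T → card T ≡ 0 → v T ≡ 0ℚ
  v∅ T p = trans (cong (val (lowDegree τ T) *_) (u∅ T p)) (*-zeroʳ (val (lowDegree τ T)))
  deg : ∀ T → v T ≡ 0ℚ ⊎ card T ℕ.≤ τ
  deg T with lowDegree τ T in eq
  ... | true = inj₂ (does-true (card T ℕ.≤? τ) eq)
  ... | false = inj₁ (*-zeroˡ (u T))
  small′ : ∀ T → v T ² * (2ℚ ^ℚ (leafExp h τ ℕ.* card T)) ≤ 1ℚ
  small′ T = ≤-trans (*-mono-≤ (0≤sq (v T)) (0≤2^ (leafExp h τ ℕ.* card T)) (⊑-² v⊑u T) (2^-mono (ℕₚ.*-monoˡ-≤ (card T) e₀≤e))) (small T)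

high-large : ∀ τ {n} (u : Cube n → ℚ) T → on (not ∘ lowDegree τ) u T ≡ 0ℚ ⊎ τ ℕ.< card T
high-large τ u T with lowDegree τ T in eq
... | true = inj₁ (*-zeroˡ (u T))
... | false = inj₂ (ℕₚ.≰⇒> (does-false (card T ℕ.≤? τ) eq))

-- With no round left, sets above the threshold are charged to `cubic`: by `2 ≤ k` they have at
-- least three elements and so contain a triple. The large coefficient `2 ^ℚ k` is brought down by
-- the rounds that follow.
leaf-bound : ∀ k h l → 2 ℕ.≤ k →
  PairingBound (2ℚ * (½ ^ℚ k)) (2ℚ * 2ℚ * (½ ^ℚ l)) (2ℚ ^ℚ k) (2ℚ * (½ ^ℚ h)) (leafExp h (threshold k h l))
leaf-bound k h l 2≤k {n} φ c u 0≤c c≤1 u∅ small with ≤-total (norm² u) (2ℚ ^ℚ (l ℕ.+ l))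
... | inj₂ big = ≤-trans (pair-giant l φ c u 0≤c c≤1 big)
  (≤-gap ((x * V + y * N) + (2ℚ ^ℚ k * C + z * I)) (0≤+ (0≤+ (0≤* 0≤x (energy-nonNeg f)) (0≤* 0≤y (norm²-nonNeg u))) (0≤+ (0≤* (0≤2^ k) (cubic-nonNeg u)) (0≤* 0≤z (influence-nonNeg f))))
    (solve 8 (λ x V h N t C z I → (x :* V :+ con 2ℚ :* con 2ℚ :* h :* N) :+ (t :* C :+ z :* I)
        := con 2ℚ :* h :* N :+ ((x :* V :+ con 2ℚ :* h :* N) :+ (t :* C :+ z :* I))) refl x V (½ ^ℚ l) N (2ℚ ^ℚ k) C z I))
  where
  f = centred φ c
  V = energy f
  N = norm² u
  C = cubic u
  I = influence f
  x = 2ℚ * (½ ^ℚ k)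
  y = 2ℚ * (½ ^ℚ l)
  z = 2ℚ * (½ ^ℚ h)
  0≤x : 0ℚ ≤ x
  0≤x = 0≤* 0≤2 (0≤½^ k)
  0≤y : 0ℚ ≤ y
  0≤y = 0≤* 0≤2 (0≤½^ l)
  0≤z : 0ℚ ≤ z
  0≤z = 0≤* 0≤2 (0≤½^ h)
... | inj₁ N≤ = begin
  pair f u ≡⟨ pair-on (lowDegree τ) f u ⟩
  pair f (on (lowDegree τ) u) + pair f hi
    ≤⟨ +-mono-≤ (pair-low k h l (leafExp h τ) φ c u 2≤k ℕₚ.≤-refl u∅ small N≤) (≤-trans (pair-≤ k f hi) (+-monoʳ-≤ ((½ ^ℚ k) * V) (*-monoˡ (2ℚ ^ℚ k) (0≤2^ k) hi≤))) ⟩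
  ((½ ^ℚ k) * V + z * I + 2ℚ * (½ ^ℚ l) * N) + ((½ ^ℚ k) * V + (2ℚ ^ℚ k) * C)
    ≤⟨ ≤-gap (2ℚ * (½ ^ℚ l) * N) (0≤* (0≤* 0≤2 (0≤½^ l)) (norm²-nonNeg u))
       (solve 8 (λ x V h N t C z I → (con 2ℚ :* x :* V :+ con 2ℚ :* con 2ℚ :* h :* N) :+ (t :* C :+ z :* I)
        := ((x :* V :+ z :* I :+ con 2ℚ :* h :* N) :+ (x :* V :+ t :* C)) :+ con 2ℚ :* h :* N) refl (½ ^ℚ k) V (½ ^ℚ l) N (2ℚ ^ℚ k) C z I) ⟩
  (2ℚ * (½ ^ℚ k) * V + 2ℚ * 2ℚ * (½ ^ℚ l) * N) + ((2ℚ ^ℚ k) * C + z * I) ∎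
  where
  open ≤-Reasoning
  τ = threshold k h l
  f = centred φ c
  V = energy f
  N = norm² u
  C = cubic u
  I = influence f
  z = 2ℚ * (½ ^ℚ h)
  hi = on (not ∘ lowDegree τ) u
  hi≤ : norm² hi ≤ C
  hi≤ = ∫-mono (ΣF n) point
    where
    point : ∀ T → hi T ² ≤ bin 3 (card T) * u T ²
    point T with high-large τ u T
    ... | inj₁ p = ≤-trans (≤-reflexive (trans (cong _² p) (*-zeroˡ 0ℚ))) (0≤* (bin-nonNeg 3 (card T)) (0≤sq (u T)))
    ... | inj₂ p = ≤-trans (⊑-² (on-⊑ (not ∘ lowDegree τ) u) T) (≤-trans (≤-reflexive (sym (*-identityˡ (u T ²))))
                     (*-monoʳ (u T ²) (0≤sq (u T)) (1≤bin 3 (card T) (ℕₚ.≤-trans (ℕ.s≤s (2≤threshold k h l 2≤k)) p))))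

-- The pieces are the low-degree part, one branch for each side, and the exceptional sets. Each
-- branch sees the full energy, so `α` doubles, and every one of the four pieces adds `½ ^ℚ k`. The
-- masses of the branches belong to disjoint sets and the traces of `T` on both sides add up to
-- `card T`, so `β` and `ζ` grow only additively. The balanced mask divides `γ` by 4.
step-moderate : ∀ k h l {α β γ ζ e} → 2 ℕ.≤ k → 0ℚ ≤ β → 0ℚ ≤ γ → leafExp h (threshold k h l) ℕ.≤ e →
  PairingBound α β γ ζ e → ∀ {n} (φ : Cube n → Bool) c (u : Cube n → ℚ) → 0ℚ ≤ c → c ≤ 1ℚ →
  (∀ T → card T ≡ 0 → u T ≡ 0ℚ) → (∀ T → u T ² * (2ℚ ^ℚ ((e ℕ.+ 13) ℕ.* card T)) ≤ 1ℚ) → norm² u ≤ 2ℚ ^ℚ (l ℕ.+ l) → ∀ A →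
  ∑ (λ T → bin 3 (card (sel A T)) * u T ²) + ∑ (λ T → bin 3 (card (sel (neg A) T)) * u T ²) ≤ ½ * ½ * cubic u →
  pair (centred φ c) u ≤ ((2ℚ * α + 2ℚ * 2ℚ * (½ ^ℚ k)) * energy (centred φ c) + (β + 2ℚ * 2ℚ * (½ ^ℚ l)) * norm² u)
    + (½ * ½ * γ * cubic u + (ζ + 2ℚ * (½ ^ℚ h)) * influence (centred φ c))
step-moderate k h l {α} {β} {γ} {ζ} {e} 2≤k 0≤β 0≤γ e₀≤e bound {n} φ c u 0≤c c≤1 u∅ small N≤ A balanced = begin
  pair f u ≡⟨ pair-on (lowDegree τ) f u ⟩
  pair f lo + pair f hi ≡⟨ cong (pair f lo +_) (pair-on (light e A u) f hi) ⟩
  pair f lo + (pair f vA + pair f rest) ≡⟨ cong (λ r → pair f lo + (pair f vA + r)) (pair-on (light e (neg A) u) f rest) ⟩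
  pair f lo + (pair f vA + (pair f vB + pair f exc))
    ≤⟨ +-mono-≤ (pair-low k h l (e ℕ.+ 13) φ c u 2≤k (ℕₚ.≤-trans e₀≤e (ℕₚ.m≤m+n e 13)) u∅ small N≤)
         (+-mono-≤ (side A hi (on-⊑ (not ∘ lowDegree τ) u) (high-large τ u)) (+-mono-≤ (side (neg A) rest rest⊑u rest-large) boundE)) ⟩
  (κ * V + z * I + 2ℚ * λ′ * N) + ((((α + κ) * V + (β + λ′) * nA) + (γ * CA + ζ * IA)) + ((((α + κ) * V + (β + λ′) * nB) + (γ * CB + ζ * IB)) + (κ * V + λ′ * N)))
    ≡⟨ regroup ⟩
  ((2ℚ * α + 2ℚ * 2ℚ * κ) * V + ((β + λ′) * (nA + nB) + 3ℚ * λ′ * N)) + (γ * (CA + CB) + (ζ * (IA + IB) + z * I))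
    ≤⟨ +-mono-≤ (+-monoʳ-≤ ((2ℚ * α + 2ℚ * 2ℚ * κ) * V) (+-monoˡ-≤ (3ℚ * λ′ * N) (*-monoˡ (β + λ′) (0≤+ 0≤β (0≤½^ l)) nA+nB≤N)))
         (+-mono-≤ (*-monoˡ γ 0≤γ balanced) (≤-reflexive (cong (λ i → ζ * i + z * I) IA+IB))) ⟩
  ((2ℚ * α + 2ℚ * 2ℚ * κ) * V + ((β + λ′) * N + 3ℚ * λ′ * N)) + (γ * (½ * ½ * C) + (ζ * I + z * I))
    ≡⟨ solve 9 (λ vv b l N g C zz I z → (vv :+ ((b :+ l) :* N :+ con 3ℚ :* l :* N)) :+ (g :* (con ½ :* con ½ :* C) :+ (zz :* I :+ z :* I))
         := (vv :+ (b :+ con 2ℚ :* con 2ℚ :* l) :* N) :+ (con ½ :* con ½ :* g :* C :+ (zz :+ z) :* I)) refl ((2ℚ * α + 2ℚ * 2ℚ * κ) * V) β λ′ N γ C ζ I z ⟩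
  ((2ℚ * α + 2ℚ * 2ℚ * κ) * V + (β + 2ℚ * 2ℚ * λ′) * N) + (½ * ½ * γ * C + (ζ + z) * I) ∎
  where
  open ≤-Reasoning
  τ = threshold k h l
  f = centred φ c
  V = energy f
  N = norm² u
  C = cubic u
  I = influence f
  κ = ½ ^ℚ k
  λ′ = ½ ^ℚ l
  z = 2ℚ * (½ ^ℚ h)
  lo = on (lowDegree τ) u
  hi = on (not ∘ lowDegree τ) u
  vA = on (light e A u) hi
  rest = on (not ∘ light e A u) hi
  vB = on (light e (neg A) u) rest
  exc = on (not ∘ light e (neg A) u) rest
  nA = norm² vA
  nB = norm² vB
  CA = ∑ (λ T → bin 3 (card (sel A T)) * u T ²)
  CB = ∑ (λ T → bin 3 (card (sel (neg A) T)) * u T ²)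
  IA = ∑ (λ T → ι (card (sel A T)) * hat f T ²)
  IB = ∑ (λ T → ι (card (sel (neg A) T)) * hat f T ²)
  rest⊑u : rest ⊑ u
  rest⊑u = ⊑-trans (on-⊑ (not ∘ light e A u) hi) (on-⊑ (not ∘ lowDegree τ) u)
  large-⊑ : ∀ {v w : Cube n → ℚ} → v ⊑ w → (∀ T → w T ≡ 0ℚ ⊎ τ ℕ.< card T) → ∀ T → v T ≡ 0ℚ ⊎ τ ℕ.< card T
  large-⊑ p q T with p T | q T
  ... | inj₁ e | _ = inj₁ e
  ... | inj₂ e | inj₁ e′ = inj₁ (trans e e′)
  ... | inj₂ _ | inj₂ r = inj₂ r
  rest-large : ∀ T → rest T ≡ 0ℚ ⊎ τ ℕ.< card T
  rest-large = large-⊑ (on-⊑ (not ∘ light e A u) hi) (high-large τ u)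
  2^k½^τ≤ : (2ℚ ^ℚ k) * (½ ^ℚ τ) ≤ λ′
  2^k½^τ≤ = 2^*½^≤ k τ l (k+l≤threshold k h l)
  side : ∀ (B : Cube n) (r : Cube n → ℚ) → r ⊑ u → (∀ T → r T ≡ 0ℚ ⊎ τ ℕ.< card T) →
    pair f (on (light e B u) r) ≤ ((α + κ) * V + (β + λ′) * norm² (on (light e B u) r))
      + (γ * ∑ (λ T → bin 3 (card (sel B T)) * u T ²) + ζ * ∑ (λ T → ι (card (sel B T)) * hat f T ²))
  side B r r⊑u r-large = ≤-trans
    (branch {α} {β} {γ} {ζ} {e} 0≤β 0≤γ bound k τ B φ c v 0≤c c≤1 (light-∅ e B u r) (light-stratum e B u r r⊑u) (large-⊑ (on-⊑ (light e B u) r) r-large))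
    (+-mono-≤ (+-monoʳ-≤ ((α + κ) * V) (*-monoʳ (norm² v) (norm²-nonNeg v) (+-monoʳ-≤ β 2^k½^τ≤)))
      (+-monoˡ-≤ (ζ * ∑ (λ T → ι (card (sel B T)) * hat f T ²)) (*-monoˡ γ 0≤γ
        (∫-mono (ΣF n) (λ T → *-monoˡ (bin 3 (card (sel B T))) (bin-nonNeg 3 (card (sel B T))) (⊑-² (⊑-trans (on-⊑ (light e B u) r) r⊑u) T))))))
    where v = on (light e B u) r
  exc-cases : ∀ T → exc T ≡ 0ℚ ⊎ (τ ℕ.< card T × light e A u T ≡ false × light e (neg A) u T ≡ false)
  exc-cases T = go (lowDegree τ T) (light e A u T) (light e (neg A) u T) (high-large τ u T) refl refl refl
    where
    go : ∀ a b d → hi T ≡ 0ℚ ⊎ τ ℕ.< card T → lowDegree τ T ≡ a → light e A u T ≡ b → light e (neg A) u T ≡ d →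
      exc T ≡ 0ℚ ⊎ (τ ℕ.< card T × light e A u T ≡ false × light e (neg A) u T ≡ false)
    go a b true _ _ _ q = inj₁ (on-false (not ∘ light e (neg A) u) rest T (cong not q))
    go a true false _ _ p q = inj₁ (trans (cong (val (not (light e (neg A) u T)) *_) (on-false (not ∘ light e A u) hi T (cong not p))) (*-zeroʳ (val (not (light e (neg A) u T)))))
    go a false false (inj₂ r) _ p q = inj₂ (r , p , q)
    go a false false (inj₁ r) _ p q = inj₁ (trans (cong (λ x → val (not (light e (neg A) u T)) * (val (not (light e A u T)) * x)) r)
      (solve 2 (λ a b → a :* (b :* con 0ℚ) := con 0ℚ) refl (val (not (light e (neg A) u T))) (val (not (light e A u T)))))
  boundE : pair f exc ≤ κ * V + λ′ * N
  boundE = ≤-trans (pair-≤ k f exc) (+-monoʳ-≤ (κ * V) (begin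
    (2ℚ ^ℚ k) * norm² exc
      ≤⟨ *-monoˡ (2ℚ ^ℚ k) (0≤2^ k) (norm²-exceptional e τ A u small exc (⊑-trans (on-⊑ (not ∘ light e (neg A) u) rest) rest⊑u) exc-cases) ⟩
    (2ℚ ^ℚ k) * ((½ ^ℚ τ) * (N * N))
      -- One of the two factors `N` is traded for the bound on moderate norms, which makes the
      -- estimate linear in the mass; the `2l` in the threshold pays for it.
      ≤⟨ *-monoˡ (2ℚ ^ℚ k) (0≤2^ k) (*-monoˡ (½ ^ℚ τ) (0≤½^ τ) (*-monoʳ N (norm²-nonNeg u) N≤)) ⟩
    (2ℚ ^ℚ k) * ((½ ^ℚ τ) * ((2ℚ ^ℚ (l ℕ.+ l)) * N))
      ≡⟨ solve 4 (λ a b c d → a :* (b :* (c :* d)) := a :* c :* b :* d) refl (2ℚ ^ℚ k) (½ ^ℚ τ) (2ℚ ^ℚ (l ℕ.+ l)) N ⟩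
    (2ℚ ^ℚ k) * (2ℚ ^ℚ (l ℕ.+ l)) * (½ ^ℚ τ) * N ≡⟨ cong (λ a → a * (½ ^ℚ τ) * N) (sym (^-+ 2ℚ k (l ℕ.+ l))) ⟩
    (2ℚ ^ℚ (k ℕ.+ (l ℕ.+ l))) * (½ ^ℚ τ) * N ≤⟨ *-monoʳ N (norm²-nonNeg u) (2^*½^≤ (k ℕ.+ (l ℕ.+ l)) τ l (k+3l≤threshold k h l)) ⟩
    λ′ * N ∎))
  nA+nB≤N : nA + nB ≤ N
  nA+nB≤N = ≤-gap (norm² lo + norm² exc) (0≤+ (norm²-nonNeg lo) (norm²-nonNeg exc))
    (trans (trans (norm²-on (lowDegree τ) u) (cong (norm² lo +_) (trans (norm²-on (light e A u) hi) (cong (nA +_) (norm²-on (light e (neg A) u) rest)))))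
      (solve 4 (λ a b c d → a :+ (b :+ (c :+ d)) := b :+ c :+ (a :+ d)) refl (norm² lo) nA nB (norm² exc)))
  IA+IB : IA + IB ≡ I
  IA+IB = trans (sym (∫-+ (ΣF n) _ _)) (∫-cong (ΣF n) (λ T → trans (sym (*-distribʳ-+ (hat f T ²) (ι (card (sel A T))) (ι (card (sel (neg A) T)))))
    (cong (_* hat f T ²) (trans (sym (ι-+ (card (sel A T)) (card (sel (neg A) T)))) (cong ι (card-sel A T))))))
  regroup : (κ * V + z * I + 2ℚ * λ′ * N) + ((((α + κ) * V + (β + λ′) * nA) + (γ * CA + ζ * IA)) + ((((α + κ) * V + (β + λ′) * nB) + (γ * CB + ζ * IB)) + (κ * V + λ′ * N)))
    ≡ ((2ℚ * α + 2ℚ * 2ℚ * κ) * V + ((β + λ′) * (nA + nB) + 3ℚ * λ′ * N)) + (γ * (CA + CB) + (ζ * (IA + IB) + z * I))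
  regroup = trans
    (solve 11 (λ a k V b l N x y p q i → (k :* V :+ i :+ con 2ℚ :* l :* N) :+ ((((a :+ k) :* V :+ (b :+ l) :* x) :+ p) :+ ((((a :+ k) :* V :+ (b :+ l) :* y) :+ q) :+ (k :* V :+ l :* N)))
        := ((con 2ℚ :* a :+ con 2ℚ :* con 2ℚ :* k) :* V :+ ((b :+ l) :* (x :+ y) :+ con 3ℚ :* l :* N)) :+ (p :+ q :+ i)) refl
        α κ V β λ′ N nA nB (γ * CA + ζ * IA) (γ * CB + ζ * IB) (z * I))
    (cong (((2ℚ * α + 2ℚ * 2ℚ * κ) * V + ((β + λ′) * (nA + nB) + 3ℚ * λ′ * N)) +_)
      (solve 7 (λ g c d z i j m → (g :* c :+ z :* i) :+ (g :* d :+ z :* j) :+ m := g :* (c :+ d) :+ (z :* (i :+ j) :+ m)) refl γ CA CB ζ IA IB (z * I)))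

step-bound : ∀ k h l {α β γ ζ e} → 2 ℕ.≤ k → 0ℚ ≤ α → 0ℚ ≤ β → 0ℚ ≤ γ → 0ℚ ≤ ζ → leafExp h (threshold k h l) ℕ.≤ e →
  PairingBound α β γ ζ e →
  PairingBound (2ℚ * α + 2ℚ * 2ℚ * (½ ^ℚ k)) (β + 2ℚ * 2ℚ * (½ ^ℚ l)) (½ * ½ * γ) (ζ + 2ℚ * (½ ^ℚ h)) (e ℕ.+ 13)
step-bound k h l {α} {β} {γ} {ζ} {e} 2≤k 0≤α 0≤β 0≤γ 0≤ζ e₀≤e bound {n} φ c u 0≤c c≤1 u∅ small with ≤-total (norm² u) (2ℚ ^ℚ (l ℕ.+ l))
... | inj₂ big = ≤-trans (pair-giant l φ c u 0≤c c≤1 big)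
  (≤-gap ((x * V + (β + y) * N) + (g * C + z * I)) (0≤+ (0≤+ (0≤* 0≤x (energy-nonNeg f)) (0≤* (0≤+ 0≤β 0≤y) (norm²-nonNeg u))) (0≤+ (0≤* 0≤g (cubic-nonNeg u)) (0≤* 0≤z (influence-nonNeg f))))
    (solve 9 (λ x V h N t C z I b → (x :* V :+ (b :+ con 2ℚ :* con 2ℚ :* h) :* N) :+ (t :* C :+ z :* I)
        := con 2ℚ :* h :* N :+ ((x :* V :+ (b :+ con 2ℚ :* h) :* N) :+ (t :* C :+ z :* I))) refl x V (½ ^ℚ l) N g C z I β))
  where
  f = centred φ c
  V = energy f
  N = norm² u
  C = cubic u
  I = influence f
  x = 2ℚ * α + 2ℚ * 2ℚ * (½ ^ℚ k)
  y = 2ℚ * (½ ^ℚ l)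
  z = ζ + 2ℚ * (½ ^ℚ h)
  g = ½ * ½ * γ
  0≤x : 0ℚ ≤ x
  0≤x = 0≤+ (0≤* 0≤2 0≤α) (0≤* (0≤* 0≤2 0≤2) (0≤½^ k))
  0≤y : 0ℚ ≤ y
  0≤y = 0≤* 0≤2 (0≤½^ l)
  0≤z : 0ℚ ≤ z
  0≤z = 0≤+ 0≤ζ (0≤* 0≤2 (0≤½^ h))
  0≤g : 0ℚ ≤ g
  0≤g = 0≤* (0≤* 0≤½ 0≤½) 0≤γ
... | inj₁ N≤ = let A , balanced = balanced-mask u in
  step-moderate k h l {α} {β} {γ} {ζ} {e} 2≤k 0≤β 0≤γ e₀≤e bound φ c u 0≤c c≤1 u∅ small N≤ A balanced

-- The recursion over rounds

αs γs βs ζs : ℕ → ℕ → ℚ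
αs k zero = 2ℚ * (½ ^ℚ k)
αs k (suc j) = 2ℚ * αs k j + 2ℚ * 2ℚ * (½ ^ℚ k)
βs l zero = 2ℚ * 2ℚ * (½ ^ℚ l)
βs l (suc j) = βs l j + 2ℚ * 2ℚ * (½ ^ℚ l)
γs k zero = 2ℚ ^ℚ k
γs k (suc j) = ½ * ½ * γs k j
ζs h zero = 2ℚ * (½ ^ℚ h)
ζs h (suc j) = ζs h j + 2ℚ * (½ ^ℚ h)

-- 13 = 6 + 6 + 1: the factors of `weight` on the two sides, and 2^|T| to spare for `heavy-point`.
exponent : ℕ → ℕ → ℕ → ℕ → ℕ
exponent k h l zero = leafExp h (threshold k h l)
exponent k h l (suc j) = exponent k h l j ℕ.+ 13

-- The fixed point of the recursion is `-4 * ½ ^ℚ k`; relative to it each round is a pure doubling.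
αs-closed : ∀ k j → αs k j + 2ℚ * 2ℚ * (½ ^ℚ k) ≡ 2ℚ * 3ℚ * ((2ℚ ^ℚ j) * (½ ^ℚ k))
αs-closed k zero = solve 1 (λ h → con 2ℚ :* h :+ con 2ℚ :* con 2ℚ :* h := con 2ℚ :* con 3ℚ :* (con 1ℚ :* h)) refl (½ ^ℚ k)
αs-closed k (suc j) = trans (solve 2 (λ a h → (con 2ℚ :* a :+ con 2ℚ :* con 2ℚ :* h) :+ con 2ℚ :* con 2ℚ :* h := con 2ℚ :* (a :+ con 2ℚ :* con 2ℚ :* h)) refl (αs k j) (½ ^ℚ k))
  (trans (cong (2ℚ *_) (αs-closed k j)) (solve 2 (λ t h → con 2ℚ :* (con 2ℚ :* con 3ℚ :* (t :* h)) := con 2ℚ :* con 3ℚ :* (con 2ℚ :* t :* h)) refl (2ℚ ^ℚ j) (½ ^ℚ k)))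

βs-closed : ∀ l j → βs l j ≡ ι (suc j) * (2ℚ * 2ℚ * (½ ^ℚ l))
βs-closed l zero = solve 1 (λ h → h := (con 1ℚ :+ con 0ℚ) :* h) refl (2ℚ * 2ℚ * (½ ^ℚ l))
βs-closed l (suc j) = trans (cong (_+ 2ℚ * 2ℚ * (½ ^ℚ l)) (βs-closed l j)) (solve 2 (λ i h → i :* h :+ h := (con 1ℚ :+ i) :* h) refl (ι (suc j)) (2ℚ * 2ℚ * (½ ^ℚ l)))

γs-closed : ∀ k j → γs k j ≡ (2ℚ ^ℚ k) * (½ ^ℚ (j ℕ.+ j))
γs-closed k zero = sym (*-identityʳ (2ℚ ^ℚ k))
γs-closed k (suc j) = trans (cong (½ * ½ *_) (γs-closed k j)) (trans (solve 2 (λ t h → con ½ :* con ½ :* (t :* h) := t :* (con ½ :* (con ½ :* h))) refl (2ℚ ^ℚ k) (½ ^ℚ (j ℕ.+ j)))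
  (cong (λ i → (2ℚ ^ℚ k) * (½ ^ℚ i)) (cong suc (sym (ℕₚ.+-suc j j)))))

ζs-closed : ∀ h j → ζs h j ≡ ι (suc j) * (2ℚ * (½ ^ℚ h))
ζs-closed l zero = solve 1 (λ h → h := (con 1ℚ :+ con 0ℚ) :* h) refl (2ℚ * (½ ^ℚ l))
ζs-closed l (suc j) = trans (cong (_+ 2ℚ * (½ ^ℚ l)) (ζs-closed l j)) (solve 2 (λ i h → i :* h :+ h := (con 1ℚ :+ i) :* h) refl (ι (suc j)) (2ℚ * (½ ^ℚ l)))

αs-nonNeg : ∀ k j → 0ℚ ≤ αs k j
αs-nonNeg k zero = 0≤* 0≤2 (0≤½^ k)
αs-nonNeg k (suc j) = 0≤+ (0≤* 0≤2 (αs-nonNeg k j)) (0≤* (0≤* 0≤2 0≤2) (0≤½^ k))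

βs-nonNeg : ∀ l j → 0ℚ ≤ βs l j
βs-nonNeg l zero = 0≤* (0≤* 0≤2 0≤2) (0≤½^ l)
βs-nonNeg l (suc j) = 0≤+ (βs-nonNeg l j) (0≤* (0≤* 0≤2 0≤2) (0≤½^ l))

γs-nonNeg : ∀ k j → 0ℚ ≤ γs k j
γs-nonNeg k zero = 0≤2^ k
γs-nonNeg k (suc j) = 0≤* (0≤* 0≤½ 0≤½) (γs-nonNeg k j)

ζs-nonNeg : ∀ h j → 0ℚ ≤ ζs h j
ζs-nonNeg h zero = 0≤* 0≤2 (0≤½^ h)
ζs-nonNeg h (suc j) = 0≤+ (ζs-nonNeg h j) (0≤* 0≤2 (0≤½^ h))

leafExp≤exponent : ∀ k h l j → leafExp h (threshold k h l) ℕ.≤ exponent k h l j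
leafExp≤exponent k h l zero = ℕₚ.≤-refl
leafExp≤exponent k h l (suc j) = ℕₚ.≤-trans (leafExp≤exponent k h l j) (ℕₚ.m≤m+n (exponent k h l j) 13)

pairing-bound : ∀ k h l → 2 ℕ.≤ k → ∀ j → PairingBound (αs k j) (βs l j) (γs k j) (ζs h j) (exponent k h l j)
pairing-bound k h l 2≤k zero = leaf-bound k h l 2≤k
pairing-bound k h l 2≤k (suc j) = step-bound k h l {αs k j} {βs l j} {γs k j} {ζs h j} {exponent k h l j} 2≤k
  (αs-nonNeg k j) (βs-nonNeg l j) (γs-nonNeg k j) (ζs-nonNeg h j) (leafExp≤exponent k h l j) (pairing-bound k h l 2≤k j)

module Parameters (q : ℕ) where
  -- In the application `q` is the binary logarithm of `1 + Ĩ`. After `J` rounds `γ` is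
  -- `2^k * 4^-J = 2^(6-J)`, a set of the relevant size has at most `2^(3q+6)` triples, and
  -- `J = 3q + 16` leaves `2^-4`. The energy coefficient grows to at most `6 * 2^J * ½^k`, hence
  -- `k = J + 6`. In `l` and `h` the part `q + 5` pays for `J + 1` equal errors and `suc q` for the
  -- ratio of influence to energy; the final 6 and 5 are the gain.
  J k l h : ℕ
  J = q ℕ.* 3 ℕ.+ 16
  k = J ℕ.+ 6
  l = q ℕ.+ 5 ℕ.+ 6
  h = q ℕ.+ 5 ℕ.+ suc q ℕ.+ 5

  exponent-closed : ∀ j → exponent k h l j ≡ leafExp h (threshold k h l) ℕ.+ j ℕ.* 13
  exponent-closed zero = sym (ℕₚ.+-identityʳ _)
  exponent-closed (suc j) = trans (cong (ℕ._+ 13) (exponent-closed j)) (solveℕ 2 (λ a b → a :⊕ b :⊕ conℕ 13 :≡ a :⊕ (conℕ 13 :⊕ b)) refl (leafExp h (threshold k h l)) (j ℕ.* 13))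

  -- Here `h = 2q + 11` and the threshold is `8q + 66`; with 13 for each of the `3q + 16` rounds the
  -- exponent is `115q + 824`. As `1 ≤ q`, the constant is absorbed, and `115 + 824 = 939` becomes
  -- the constant of the theorem.
  exponent≤ : 1 ℕ.≤ q → exponent k h l J ℕ.≤ q ℕ.* 939
  exponent≤ 1≤q = ℕₚ.≤-trans (ℕₚ.≤-reflexive (trans (exponent-closed J) (closed q)))
    (ℕₚ.≤-trans (ℕₚ.+-monoʳ-≤ (q ℕ.* 115) (ℕₚ.*-monoˡ-≤ 824 1≤q)) (ℕₚ.≤-reflexive (sym (ℕₚ.*-distribˡ-+ q 115 824))))
    where
    closed : ∀ q → leafExp (q ℕ.+ 5 ℕ.+ suc q ℕ.+ 5) (threshold (q ℕ.* 3 ℕ.+ 16 ℕ.+ 6) (q ℕ.+ 5 ℕ.+ suc q ℕ.+ 5) (q ℕ.+ 5 ℕ.+ 6)) ℕ.+ (q ℕ.* 3 ℕ.+ 16) ℕ.* 13 ≡ q ℕ.* 115 ℕ.+ 824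
    closed = solveℕ 1 (λ q →
      let h = q :⊕ conℕ 5 :⊕ (conℕ 1 :⊕ q) :⊕ conℕ 5
          J = q :⊗ conℕ 3 :⊕ conℕ 16
          l = q :⊕ conℕ 5 :⊕ conℕ 6
          τ = J :⊕ conℕ 6 :⊕ h :⊕ (l :⊕ l :⊕ l)
      in (h :⊗ conℕ 2 :⊕ τ :⊗ conℕ 9) :⊕ J :⊗ conℕ 13 :≡ q :⊗ conℕ 115 :⊕ conℕ 824) refl

  ι[1+J]≤ : ι (suc J) ≤ 2ℚ ^ℚ (q ℕ.+ 5)
  ι[1+J]≤ = go q
    where
    go : ∀ q → ι (suc (q ℕ.* 3 ℕ.+ 16)) ≤ 2ℚ ^ℚ (q ℕ.+ 5)
    go zero = ≤-gap (2ℚ * 2ℚ * 2ℚ * 2ℚ - 1ℚ) (0≤+ {2ℚ * 2ℚ * 2ℚ * 2ℚ - 2ℚ} {1ℚ} (nonNegative⁻¹ (2ℚ * 2ℚ * 2ℚ * 2ℚ - 2ℚ)) 0≤1) refl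
    go (suc q) = ≤-trans (≤-reflexive (solve 1 (λ a → con 1ℚ :+ (con 1ℚ :+ (con 1ℚ :+ a)) := con 3ℚ :+ a) refl (ι (suc (q ℕ.* 3 ℕ.+ 16)))))
      (≤-trans (+-mono-≤ (≤-trans (≤-gap {3ℚ} {2ℚ ^ℚ 5} (2ℚ * 2ℚ * 2ℚ * 3ℚ + 2ℚ + 3ℚ) (0≤+ (0≤+ (0≤* (0≤* (0≤* 0≤2 0≤2) 0≤2) 0≤3) 0≤2) 0≤3) refl) (2^-mono (ℕₚ.m≤n+m 5 q))) (go q))
        (≤-reflexive (solve 1 (λ a → a :+ a := con 2ℚ :* a) refl (2ℚ ^ℚ (q ℕ.+ 5)))))

-- The low-degree part and the contradiction

ι-2^ : ∀ a → ι (2 ℕ.^ a) ≡ 2ℚ ^ℚ a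
ι-2^ zero = refl
ι-2^ (suc a) = trans (ι-+ (2 ℕ.^ a) (2 ℕ.^ a ℕ.+ 0)) (trans (cong (λ x → ι (2 ℕ.^ a) + ι x) (ℕₚ.+-identityʳ (2 ℕ.^ a)))
  (trans (cong (λ x → x + x) (ι-2^ a)) (solve 1 (λ a → a :+ a := con 2ℚ :* a) refl (2ℚ ^ℚ a))))

-- Markov's inequality for the distribution of squared coefficients: the cut-off `2^(q+2)` is twice
-- the assumed ratio `2^(q+1)` of influence to energy.
norm²-highDegree : ∀ q {n} (f : Cube n → ℚ) → influence f ≤ (2ℚ ^ℚ suc q) * energy f →
  norm² (on (not ∘ lowDegree (2 ℕ.^ (q ℕ.+ 2))) (hat f)) ≤ ½ * energy f
norm²-highDegree q f I≤ = begin
  norm² hi ≤⟨ ∫-mono (ΣF _) point ⟩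
  ∑ (λ T → (½ ^ℚ (q ℕ.+ 2)) * (ι (card T) * hat f T ²)) ≡⟨ ∫-*ˡ (ΣF _) (½ ^ℚ (q ℕ.+ 2)) _ ⟩
  (½ ^ℚ (q ℕ.+ 2)) * influence f ≤⟨ *-monoˡ (½ ^ℚ (q ℕ.+ 2)) (0≤½^ (q ℕ.+ 2)) I≤ ⟩
  (½ ^ℚ (q ℕ.+ 2)) * ((2ℚ ^ℚ suc q) * energy f) ≡⟨ solve 3 (λ a b c → a :* (b :* c) := b :* a :* c) refl (½ ^ℚ (q ℕ.+ 2)) (2ℚ ^ℚ suc q) (energy f) ⟩
  (2ℚ ^ℚ suc q) * (½ ^ℚ (q ℕ.+ 2)) * energy f
    ≤⟨ *-monoʳ (energy f) (energy-nonNeg f) (2^*½^≤ (suc q) (q ℕ.+ 2) 1 (ℕₚ.≤-reflexive (solveℕ 1 (λ q → conℕ 1 :⊕ q :⊕ conℕ 1 :≡ q :⊕ conℕ 2) refl q))) ⟩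
  ½ * energy f ∎
  where
  open ≤-Reasoning
  m = 2 ℕ.^ (q ℕ.+ 2)
  hi = on (not ∘ lowDegree m) (hat f)
  1≤ : ∀ t → m ℕ.< t → 1ℚ ≤ (½ ^ℚ (q ℕ.+ 2)) * ι t
  1≤ t p = ≤-trans (≤-reflexive (trans (sym (2^*½^ (q ℕ.+ 2))) (*-comm (2ℚ ^ℚ (q ℕ.+ 2)) (½ ^ℚ (q ℕ.+ 2)))))
    (*-monoˡ (½ ^ℚ (q ℕ.+ 2)) (0≤½^ (q ℕ.+ 2)) (≤-trans (≤-reflexive (sym (ι-2^ (q ℕ.+ 2)))) (ι-mono (ℕₚ.<⇒≤ p))))
  point : ∀ T → hi T ² ≤ (½ ^ℚ (q ℕ.+ 2)) * (ι (card T) * hat f T ²)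
  point T with high-large m (hat f) T
  ... | inj₁ p = ≤-trans (≤-reflexive (trans (cong _² p) (*-zeroˡ 0ℚ))) (0≤* (0≤½^ (q ℕ.+ 2)) (0≤* (ι-nonNeg (card T)) (0≤sq (hat f T))))
  ... | inj₂ p = ≤-trans (⊑-² (on-⊑ (not ∘ lowDegree m) (hat f)) T) (≤-trans (≤-reflexive (sym (*-identityˡ (hat f T ²))))
                   (≤-trans (*-monoʳ (hat f T ²) (0≤sq (hat f T)) (1≤ (card T) p)) (≤-reflexive (*-assoc (½ ^ℚ (q ℕ.+ 2)) (ι (card T)) (hat f T ²)))))

cubic-lowDegree : ∀ q {n} (f : Cube n → ℚ) →
  cubic (on (lowDegree (2 ℕ.^ (q ℕ.+ 2))) (hat f)) ≤ (2ℚ ^ℚ ((q ℕ.+ 2) ℕ.* 3)) * energy f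
cubic-lowDegree q f = ≤-trans (∫-mono (ΣF _) point) (≤-reflexive (trans (∫-*ˡ (ΣF _) (2ℚ ^ℚ ((q ℕ.+ 2) ℕ.* 3)) _) (cong ((2ℚ ^ℚ ((q ℕ.+ 2) ℕ.* 3)) *_) (parseval f))))
  where
  m = 2 ℕ.^ (q ℕ.+ 2)
  u = on (lowDegree m) (hat f)
  bin≤ : ∀ t → t ℕ.≤ m → bin 3 t ≤ 2ℚ ^ℚ ((q ℕ.+ 2) ℕ.* 3)
  bin≤ t p = ≤-trans (bin≤^ 3 t) (≤-trans (^-monoˡ (ι-nonNeg t) (≤-trans (ι-mono p) (≤-reflexive (ι-2^ (q ℕ.+ 2)))) 3) (≤-reflexive (sym (^-* 2ℚ (q ℕ.+ 2) 3))))
  point : ∀ T → bin 3 (card T) * u T ² ≤ (2ℚ ^ℚ ((q ℕ.+ 2) ℕ.* 3)) * hat f T ²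
  point T = go (lowDegree m T) refl
    where
    go : ∀ b → lowDegree m T ≡ b → bin 3 (card T) * u T ² ≤ (2ℚ ^ℚ ((q ℕ.+ 2) ℕ.* 3)) * hat f T ²
    go true e = *-mono-≤ (bin-nonNeg 3 (card T)) (0≤sq (u T)) (bin≤ (card T) (does-true (card T ℕ.≤? m) e)) (⊑-² (on-⊑ (lowDegree m) (hat f)) T)
    go false e = ≤-trans (≤-reflexive (trans (cong (λ a → bin 3 (card T) * a ²) (on-false (lowDegree m) (hat f) T e)) (*-zeroʳ (bin 3 (card T)))))
      (0≤* (0≤2^ ((q ℕ.+ 2) ℕ.* 3)) (0≤sq (hat f T)))

-- Pairing `f` with its own low-degree part returns the mass of that part, at least half of the
-- energy. `pairing-bound` allows at most `6/64 + 4/64 + 4/64 + 4/64` of the energy, which is less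
-- than one half.
spread⇒constant : ∀ {n} (φ : Cube n → Bool) c q → 1 ℕ.≤ q → 0ℚ ≤ c → c ≤ 1ℚ →
  (∀ T → card T ≡ 0 → hat (centred φ c) T ≡ 0ℚ) →
  influence (centred φ c) ≤ (2ℚ ^ℚ suc q) * energy (centred φ c) →
  (∀ T → 1 ℕ.≤ card T → card T ℕ.≤ 2 ℕ.^ (q ℕ.+ 2) → hat (centred φ c) T ² * (2ℚ ^ℚ (q ℕ.* 939 ℕ.* card T)) ≤ 1ℚ) →
  energy (centred φ c) ≤ 0ℚ
spread⇒constant {n} φ c q 1≤q 0≤c c≤1 f∅ I≤ small = collapse (≤-trans V≤ (≤-trans (pairing-bound k h l 2≤k J φ c u 0≤c c≤1 u∅ u-small) total))
  where
  open Parameters q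
  f = centred φ c
  V = energy f
  I = influence f
  m = 2 ℕ.^ (q ℕ.+ 2)
  u = on (lowDegree m) (hat f)
  N = norm² u
  C = cubic u
  0≤V : 0ℚ ≤ V
  0≤V = energy-nonNeg f
  2≤k : 2 ℕ.≤ k
  2≤k = ℕₚ.≤-trans (ℕ.s≤s (ℕ.s≤s ℕ.z≤n)) (ℕₚ.m≤n+m 6 J)
  u∅ : ∀ T → card T ≡ 0 → u T ≡ 0ℚ
  u∅ T p = trans (cong (val (lowDegree m T) *_) (f∅ T p)) (*-zeroʳ (val (lowDegree m T)))
  u-small : ∀ T → u T ² * (2ℚ ^ℚ (exponent k h l J ℕ.* card T)) ≤ 1ℚ
  u-small T = go (card T) refl (lowDegree m T) refl
    where
    vanishing : u T ≡ 0ℚ → u T ² * (2ℚ ^ℚ (exponent k h l J ℕ.* card T)) ≤ 1ℚ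
    vanishing e = ≤-trans (≤-reflexive (trans (cong (λ a → a ² * (2ℚ ^ℚ (exponent k h l J ℕ.* card T))) e) (*-zeroˡ (2ℚ ^ℚ (exponent k h l J ℕ.* card T))))) 0≤1
    go : ∀ t → card T ≡ t → ∀ b → lowDegree m T ≡ b → u T ² * (2ℚ ^ℚ (exponent k h l J ℕ.* card T)) ≤ 1ℚ
    go zero e _ _ = vanishing (u∅ T e)
    go (suc t) e false p = vanishing (on-false (lowDegree m) (hat f) T p)
    go (suc t) e true p = ≤-trans (*-mono-≤ (0≤sq (u T)) (0≤2^ (exponent k h l J ℕ.* card T)) (⊑-² (on-⊑ (lowDegree m) (hat f)) T)
      (2^-mono (ℕₚ.*-monoˡ-≤ (card T) (exponent≤ 1≤q)))) (small T (subst (1 ℕ.≤_) (sym e) (ℕ.s≤s ℕ.z≤n)) (does-true (card T ℕ.≤? m) p))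
  pair≡N : pair f u ≡ N
  pair≡N = ∫-cong (ΣF n) (λ T → idem (lowDegree m T) (hat f T))
    where
    idem : ∀ b a → a * (val b * a) ≡ (val b * a) ²
    idem true a = solve 1 (λ a → a :* (con 1ℚ :* a) := con 1ℚ :* a :* (con 1ℚ :* a)) refl a
    idem false a = solve 1 (λ a → a :* (con 0ℚ :* a) := con 0ℚ :* a :* (con 0ℚ :* a)) refl a
  V≡ : V ≡ N + norm² (on (not ∘ lowDegree m) (hat f))
  V≡ = trans (sym (parseval f)) (norm²-on (lowDegree m) (hat f))
  V≤ : ½ * V ≤ pair f u
  V≤ = ≤-trans (≤-gap (½ * V - norm² (on (not ∘ lowDegree m) (hat f))) (gap-≤ (norm²-highDegree q f I≤))
      (trans (solve 2 (λ N H → N := con ½ :* (N :+ H) :+ (con ½ :* (N :+ H) :- H)) refl N (norm² (on (not ∘ lowDegree m) (hat f))))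
        (cong (λ v → ½ * v + (½ * v - norm² (on (not ∘ lowDegree m) (hat f)))) (sym V≡)))) (≤-reflexive (sym pair≡N))
  N≤V : N ≤ V
  N≤V = ≤-gap (norm² (on (not ∘ lowDegree m) (hat f))) (norm²-nonNeg (on (not ∘ lowDegree m) (hat f))) V≡
  α≤ : αs k J ≤ 2ℚ * 3ℚ * (½ ^ℚ 6)
  α≤ = ≤-trans (≤+ʳ (2ℚ * 2ℚ * (½ ^ℚ k)) (0≤* (0≤* 0≤2 0≤2) (0≤½^ k))) (≤-trans (≤-reflexive (αs-closed k J))
    (*-monoˡ (2ℚ * 3ℚ) (0≤* 0≤2 0≤3) (2^*½^≤ J k 6 ℕₚ.≤-refl)))
  β≤ : βs l J ≤ 2ℚ * 2ℚ * (½ ^ℚ 6)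
  β≤ = begin
    βs l J ≡⟨ βs-closed l J ⟩
    ι (suc J) * (2ℚ * 2ℚ * (½ ^ℚ l)) ≤⟨ *-monoʳ (2ℚ * 2ℚ * (½ ^ℚ l)) (0≤* (0≤* 0≤2 0≤2) (0≤½^ l)) ι[1+J]≤ ⟩
    (2ℚ ^ℚ (q ℕ.+ 5)) * (2ℚ * 2ℚ * (½ ^ℚ l)) ≡⟨ solve 2 (λ a b → a :* (con 2ℚ :* con 2ℚ :* b) := con 2ℚ :* con 2ℚ :* (a :* b)) refl (2ℚ ^ℚ (q ℕ.+ 5)) (½ ^ℚ l) ⟩
    2ℚ * 2ℚ * ((2ℚ ^ℚ (q ℕ.+ 5)) * (½ ^ℚ l)) ≤⟨ *-monoˡ (2ℚ * 2ℚ) (0≤* 0≤2 0≤2) (2^*½^≤ (q ℕ.+ 5) l 6 ℕₚ.≤-refl) ⟩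
    2ℚ * 2ℚ * (½ ^ℚ 6) ∎
    where open ≤-Reasoning
  γC≤ : γs k J * C ≤ (½ ^ℚ 4) * V
  γC≤ = begin
    γs k J * C ≤⟨ *-monoˡ (γs k J) (γs-nonNeg k J) (cubic-lowDegree q f) ⟩
    γs k J * ((2ℚ ^ℚ r) * V) ≡⟨ cong (_* ((2ℚ ^ℚ r) * V)) (γs-closed k J) ⟩
    (2ℚ ^ℚ k) * (½ ^ℚ (J ℕ.+ J)) * ((2ℚ ^ℚ r) * V) ≡⟨ solve 4 (λ a b c d → a :* b :* (c :* d) := a :* c :* b :* d) refl (2ℚ ^ℚ k) (½ ^ℚ (J ℕ.+ J)) (2ℚ ^ℚ r) V ⟩
    (2ℚ ^ℚ k) * (2ℚ ^ℚ r) * (½ ^ℚ (J ℕ.+ J)) * V ≡⟨ cong (λ a → a * (½ ^ℚ (J ℕ.+ J)) * V) (sym (^-+ 2ℚ k r)) ⟩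
    (2ℚ ^ℚ (k ℕ.+ r)) * (½ ^ℚ (J ℕ.+ J)) * V ≤⟨ *-monoʳ V 0≤V (2^*½^≤ (k ℕ.+ r) (J ℕ.+ J) 4 (ℕₚ.≤-reflexive exps)) ⟩
    (½ ^ℚ 4) * V ∎
    where
    open ≤-Reasoning
    r = (q ℕ.+ 2) ℕ.* 3
    exps : k ℕ.+ r ℕ.+ 4 ≡ J ℕ.+ J
    exps = solveℕ 1 (λ q → q :⊗ conℕ 3 :⊕ conℕ 16 :⊕ conℕ 6 :⊕ (q :⊕ conℕ 2) :⊗ conℕ 3 :⊕ conℕ 4 :≡ q :⊗ conℕ 3 :⊕ conℕ 16 :⊕ (q :⊗ conℕ 3 :⊕ conℕ 16)) refl q
  ζI≤ : ζs h J * I ≤ 2ℚ * (½ ^ℚ 5) * V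
  ζI≤ = begin
    ζs h J * I ≤⟨ *-monoˡ (ζs h J) (ζs-nonNeg h J) I≤ ⟩
    ζs h J * ((2ℚ ^ℚ suc q) * V) ≡⟨ cong (_* ((2ℚ ^ℚ suc q) * V)) (ζs-closed h J) ⟩
    ι (suc J) * (2ℚ * (½ ^ℚ h)) * ((2ℚ ^ℚ suc q) * V)
      ≤⟨ *-monoʳ ((2ℚ ^ℚ suc q) * V) (0≤* (0≤2^ (suc q)) 0≤V) (*-monoʳ (2ℚ * (½ ^ℚ h)) (0≤* 0≤2 (0≤½^ h)) ι[1+J]≤) ⟩
    (2ℚ ^ℚ (q ℕ.+ 5)) * (2ℚ * (½ ^ℚ h)) * ((2ℚ ^ℚ suc q) * V)
      ≡⟨ solve 4 (λ a b c d → a :* (con 2ℚ :* b) :* (c :* d) := con 2ℚ :* (a :* c :* b) :* d) refl (2ℚ ^ℚ (q ℕ.+ 5)) (½ ^ℚ h) (2ℚ ^ℚ suc q) V ⟩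
    2ℚ * ((2ℚ ^ℚ (q ℕ.+ 5)) * (2ℚ ^ℚ suc q) * (½ ^ℚ h)) * V ≡⟨ cong (λ a → 2ℚ * (a * (½ ^ℚ h)) * V) (sym (^-+ 2ℚ (q ℕ.+ 5) (suc q))) ⟩
    2ℚ * ((2ℚ ^ℚ (q ℕ.+ 5 ℕ.+ suc q)) * (½ ^ℚ h)) * V ≤⟨ *-monoʳ V 0≤V (*-monoˡ 2ℚ 0≤2 (2^*½^≤ (q ℕ.+ 5 ℕ.+ suc q) h 5 ℕₚ.≤-refl)) ⟩
    2ℚ * (½ ^ℚ 5) * V ∎
    where open ≤-Reasoning
  total : (αs k J * V + βs l J * N) + (γs k J * C + ζs h J * I)
    ≤ (2ℚ * 3ℚ * (½ ^ℚ 6) * V + 2ℚ * 2ℚ * (½ ^ℚ 6) * V) + ((½ ^ℚ 4) * V + 2ℚ * (½ ^ℚ 5) * V)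
  total = +-mono-≤ (+-mono-≤ (*-monoʳ V 0≤V α≤) (*-mono-≤ (βs-nonNeg l J) (norm²-nonNeg u) β≤ N≤V)) (+-mono-≤ γC≤ ζI≤)
  collapse : ½ * V ≤ (2ℚ * 3ℚ * (½ ^ℚ 6) * V + 2ℚ * 2ℚ * (½ ^ℚ 6) * V) + ((½ ^ℚ 4) * V + 2ℚ * (½ ^ℚ 5) * V) → V ≤ 0ℚ
  -- `S` is `18/64` of `V`, so `8 * (S - ½ * V)` is `-7/4` of `V`; adding `¾ * V` gives exactly
  -- `-V`.
  collapse p = ≤-gap (2ℚ * 2ℚ * 2ℚ * (S - ½ * V) + ¾ * V) (0≤+ (0≤* (0≤* (0≤* 0≤2 0≤2) 0≤2) (gap-≤ p)) (0≤* (0≤+ 0≤½ (0≤* 0≤½ 0≤½)) 0≤V))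
    (solve 1 (λ V → con 0ℚ := V :+ (con (2ℚ * 2ℚ * 2ℚ) :* ((con (2ℚ * 3ℚ * (½ ^ℚ 6)) :* V :+ con (2ℚ * 2ℚ * (½ ^ℚ 6)) :* V) :+ (con (½ ^ℚ 4) :* V :+ con (2ℚ * (½ ^ℚ 5)) :* V) :- con ½ :* V) :+ con ¾ :* V)) refl V)
    where
    ¾ = ½ + ½ * ½
    S = (2ℚ * 3ℚ * (½ ^ℚ 6) * V + 2ℚ * 2ℚ * (½ ^ℚ 6) * V) + ((½ ^ℚ 4) * V + 2ℚ * (½ ^ℚ 5) * V)

-- Comparison with the definitions of the statement

-- The normal form of `fromℕ k` with an explicit coprimality proof, so that adding 1 can be computed
-- on numerators.
integral : ℕ → ℚ
integral k = mkℚ (ℤ.+ k) 0 (Coprime.sym (Coprime.1-coprimeTo k))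

fromℕ≡integral : ∀ k → fromℕ k ≡ integral k
fromℕ≡integral k = normalize-coprime (Coprime.sym (Coprime.1-coprimeTo k))

fromℕ≡ι : ∀ k → fromℕ k ≡ ι k
fromℕ≡ι zero = refl
fromℕ≡ι (suc k) = trans (sym (trans (cong (1ℚ +_) (fromℕ≡integral k)) (cong (_/ 1) (cong (ℤ._+_ (ℤ.+ 1)) (ℤₚ.*-identityʳ (ℤ.+ k)))))) (cong (1ℚ +_) (fromℕ≡ι k))

sumℚ-++ : ∀ xs ys → sumℚ (xs ++ ys) ≡ sumℚ xs + sumℚ ys
sumℚ-++ [] ys = sym (+-identityˡ (sumℚ ys))
sumℚ-++ (x ∷ xs) ys = trans (cong (x +_) (sumℚ-++ xs ys)) (sym (+-assoc x (sumℚ xs) (sumℚ ys)))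

sumℚ-cube : ∀ n (g : Cube n → ℚ) → sumℚ (map g (cube n)) ≡ ∑ g
sumℚ-cube zero g = trans (+-identityʳ (g [])) (sym (cubeF-[] g))
sumℚ-cube (suc n) g = begin
  sumℚ (map g (map (false ∷_) (cube n) ++ map (true ∷_) (cube n))) ≡⟨ cong sumℚ (map-++ g (map (false ∷_) (cube n)) (map (true ∷_) (cube n))) ⟩
  sumℚ (map g (map (false ∷_) (cube n)) ++ map g (map (true ∷_) (cube n))) ≡⟨ sumℚ-++ (map g (map (false ∷_) (cube n))) (map g (map (true ∷_) (cube n))) ⟩
  sumℚ (map g (map (false ∷_) (cube n))) + sumℚ (map g (map (true ∷_) (cube n)))
    ≡⟨ cong₂ _+_ (trans (cong sumℚ (sym (map-∘ (cube n)))) (sumℚ-cube n (g ∘ (false ∷_)))) (trans (cong sumℚ (sym (map-∘ (cube n)))) (sumℚ-cube n (g ∘ (true ∷_)))) ⟩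
  ∑ (g ∘ (false ∷_)) + ∑ (g ∘ (true ∷_)) ≡⟨ sym (∑-∷ g) ⟩
  ∑ g ∎
  where open ≡-Reasoning

∑≡2^*E : ∀ {n} (g : Cube n → ℚ) → ∑ g ≡ (2ℚ ^ℚ n) * E g
∑≡2^*E {zero} g = trans (cubeF-[] g) (sym (trans (*-identityˡ (E g)) (cubeF-[] g)))
∑≡2^*E {suc n} g = trans (∑-∷ g) (trans (cong₂ _+_ (∑≡2^*E (g ∘ (false ∷_))) (∑≡2^*E (g ∘ (true ∷_))))
  (trans (solve 3 (λ t a b → t :* a :+ t :* b := con 2ℚ :* t :* (con ½ :* (a :+ b))) refl (2ℚ ^ℚ n) (E (g ∘ (false ∷_))) (E (g ∘ (true ∷_)))) (cong ((2ℚ ^ℚ suc n) *_) (sym (cubeF-∷ g)))))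

÷₀-cancel : ∀ q x → q ≢ 0ℚ → (q * x) ÷₀ q ≡ x
÷₀-cancel q x q≢0 with q ≟ 0ℚ
... | yes e = ⊥-elim (q≢0 e)
... | no p = trans (solve 3 (λ q x r → q :* x :* r := q :* r :* x) refl q x (1/_ q {{≢-nonZero p}})) (trans (cong (_* x) (*-inverseʳ q {{≢-nonZero p}})) (*-identityˡ x))

2^≢0 : ∀ n → 2ℚ ^ℚ n ≢ 0ℚ
2^≢0 n e = <-irrefl refl (<-≤-trans (positive⁻¹ 1ℚ) (≤-trans (1≤^ 1≤2 n) (≤-reflexive e)))

𝔼≡E : ∀ n (g : Cube n → ℚ) → 𝔼 n g ≡ E g
𝔼≡E n g = trans (cong₂ _÷₀_ (trans (sumℚ-cube n g) (∑≡2^*E g)) (trans (fromℕ≡ι (2 ℕ.^ n)) (ι-2^ n))) (÷₀-cancel (2ℚ ^ℚ n) (E g) (2^≢0 n))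

χ≡χᵣ : ∀ {n} (S x : Cube n) → χ S x ≡ χᵣ S x
χ≡χᵣ [] [] = refl
χ≡χᵣ (s ∷ S) (x ∷ X) = trans (sgn-xor (s ∧ x) _) (cong (sgn (s ∧ x) *_) (χ≡χᵣ S X))
  where
  sgn-xor : ∀ a b → (if a xor b then - 1ℚ else 1ℚ) ≡ sgn a * (if b then - 1ℚ else 1ℚ)
  sgn-xor true true = refl
  sgn-xor true false = refl
  sgn-xor false true = refl
  sgn-xor false false = refl

fhat≡hat : ∀ {n} (φ : Cube n → Bool) S → fhat φ S ≡ hat (val ∘ φ) S
fhat≡hat {n} φ S = trans (𝔼≡E n _) (∫-cong (EF n) (λ x → cong (val (φ x) *_) (χ≡χᵣ S x)))

E-χᵣ : ∀ {n} (S : Cube n) → 1 ℕ.≤ card S → E (χᵣ S) ≡ 0ℚ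
E-χᵣ (false ∷ S) p = trans (cubeF-∷ _) (trans (cong (λ a → ½ * (a + a)) (trans (∫-*ˡ (EF _) 1ℚ (χᵣ S)) (cong (1ℚ *_) (E-χᵣ S p)))) refl)
E-χᵣ (true ∷ S) p = trans (cubeF-∷ _) (trans (cong₂ (λ a b → ½ * (a + b)) (∫-*ˡ (EF _) 1ℚ (χᵣ S)) (∫-*ˡ (EF _) (- 1ℚ) (χᵣ S)))
  (solve 1 (λ a → con ½ :* (con 1ℚ :* a :+ con (- 1ℚ) :* a) := con 0ℚ) refl (E (χᵣ S))))

χᵣ-∅ : ∀ {n} (S x : Cube n) → card S ≡ 0 → χᵣ S x ≡ 1ℚ
χᵣ-∅ [] [] e = refl
χᵣ-∅ (false ∷ S) (x ∷ X) e = trans (*-identityˡ (χᵣ S X)) (χᵣ-∅ S X e)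

mean : ∀ {n} → (Cube n → Bool) → ℚ
mean φ = E (val ∘ φ)

hat-centred : ∀ {n} (φ : Cube n → Bool) c S → hat (centred φ c) S ≡ hat (val ∘ φ) S - c * E (χᵣ S)
hat-centred φ c S = trans (∫-cong (EF _) (λ x → solve 3 (λ v c x → (v :- c) :* x := v :* x :- c :* x) refl (val (φ x)) c (χᵣ S x)))
  (trans (∫-- (EF _) _ _) (cong (λ a → hat (val ∘ φ) S - a) (∫-*ˡ (EF _) c (χᵣ S))))

hat-centred-nonempty : ∀ {n} (φ : Cube n → Bool) c S → 1 ℕ.≤ card S → hat (centred φ c) S ≡ fhat φ S
hat-centred-nonempty φ c S p = trans (hat-centred φ c S) (trans (cong (λ a → hat (val ∘ φ) S - c * a) (E-χᵣ S p))
  (trans (solve 2 (λ a c → a :- c :* con 0ℚ := a) refl (hat (val ∘ φ) S) c) (sym (fhat≡hat φ S))))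

hat-centred-∅ : ∀ {n} (φ : Cube n → Bool) S → card S ≡ 0 → hat (centred φ (mean φ)) S ≡ 0ℚ
hat-centred-∅ φ S p = trans (hat-centred φ (mean φ) S) (trans (cong₂ (λ a b → a - mean φ * b)
    (∫-cong (EF _) (λ x → trans (cong (val (φ x) *_) (χᵣ-∅ S x p)) (*-identityʳ (val (φ x)))))
    (trans (∫-cong (EF _) (λ x → χᵣ-∅ S x p)) (E-const 1ℚ)))
  (solve 1 (λ a → a :- a :* con 1ℚ := con 0ℚ) refl (mean φ)))

0≤mean : ∀ {n} (φ : Cube n → Bool) → 0ℚ ≤ mean φ
0≤mean φ = ∫-nonNeg (EF _) (λ x → 0≤val (φ x))

mean≤1 : ∀ {n} (φ : Cube n → Bool) → mean φ ≤ 1ℚ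
mean≤1 φ = ≤-trans (∫-mono (EF _) (λ x → val≤1 (φ x))) (≤-reflexive (E-const 1ℚ))
  where
  val≤1 : ∀ b → val b ≤ 1ℚ
  val≤1 true = ≤-refl
  val≤1 false = 0≤1

var≡energy : ∀ {n} (φ : Cube n → Bool) → var φ ≡ energy (centred φ (mean φ))
var≡energy {n} φ = trans (cong₂ (λ a b → a - (b ^ℚ 2)) (𝔼≡E n (λ x → val (φ x) * val (φ x))) (𝔼≡E n (val ∘ φ))) (sym (begin
  E (λ x → (val (φ x) - μ) ²)
    ≡⟨ ∫-cong (EF n) (λ x → solve 2 (λ v m → (v :- m) :* (v :- m) := con 1ℚ :* (v :* v) :+ (con (- 2ℚ) :* m :* v :+ m :* m)) refl (val (φ x)) μ) ⟩
  E (λ x → 1ℚ * val (φ x) ² + (- 2ℚ * μ * val (φ x) + μ * μ))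
    ≡⟨ trans (∫-+ (EF n) _ _) (cong₂ _+_ (∫-*ˡ (EF n) 1ℚ (λ x → val (φ x) ²)) (trans (∫-+ (EF n) _ _) (cong₂ _+_ (∫-*ˡ (EF n) (- 2ℚ * μ) (val ∘ φ)) (E-const (μ * μ))))) ⟩
  1ℚ * E (λ x → val (φ x) ²) + (- 2ℚ * μ * μ + μ * μ)
    ≡⟨ solve 2 (λ e m → con 1ℚ :* e :+ (con (- 2ℚ) :* m :* m :+ m :* m) := e :- m :* (m :* con 1ℚ)) refl (E (λ x → val (φ x) ²)) μ ⟩
  E (λ x → val (φ x) ²) - μ * (μ * 1ℚ) ∎))
  where
  open ≡-Reasoning
  μ = mean φ

-- Centring changes only the coefficient at the empty set, and there the weight is 0.
Inf≡influence : ∀ {n} (φ : Cube n → Bool) → Inf φ ≡ influence (centred φ (mean φ))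
Inf≡influence {n} φ = trans (sumℚ-cube n _) (∫-cong (ΣF n) (λ S → point S (card S) refl))
  where
  point : ∀ S t → card S ≡ t → fromℕ (card S) * (fhat φ S ^ℚ 2) ≡ ι (card S) * hat (centred φ (mean φ)) S ²
  point S zero e = trans (cong (λ t → fromℕ t * (fhat φ S ^ℚ 2)) e) (trans (*-zeroˡ (fhat φ S ^ℚ 2))
    (sym (trans (cong (λ t → ι t * hat (centred φ (mean φ)) S ²) e) (*-zeroˡ (hat (centred φ (mean φ)) S ²)))))
  point S (suc t) e = cong₂ _*_ (fromℕ≡ι (card S)) (trans (cong (fhat φ S *_) (*-identityʳ (fhat φ S)))
    (cong _² (sym (hat-centred-nonempty φ (mean φ) S (subst (1 ℕ.≤_) (sym e) (ℕ.s≤s ℕ.z≤n))))))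

E-≥-point : ∀ {n} (g : Cube n → ℚ) → (∀ x → 0ℚ ≤ g x) → ∀ x → (½ ^ℚ n) * g x ≤ E g
E-≥-point g p [] = ≤-reflexive (trans (*-identityˡ (g [])) (sym (cubeF-[] g)))
E-≥-point {suc n} g p (false ∷ x) = ≤-trans (≤-reflexive (*-assoc ½ (½ ^ℚ n) (g (false ∷ x)))) (≤-trans (*-monoˡ ½ 0≤½
  (≤-trans (E-≥-point (g ∘ (false ∷_)) (p ∘ (false ∷_)) x) (≤+ʳ (E (g ∘ (true ∷_))) (∫-nonNeg (EF n) (p ∘ (true ∷_)))))) (≤-reflexive (sym (cubeF-∷ g))))
E-≥-point {suc n} g p (true ∷ x) = ≤-trans (≤-reflexive (*-assoc ½ (½ ^ℚ n) (g (true ∷ x)))) (≤-trans (*-monoˡ ½ 0≤½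
  (≤-trans (E-≥-point (g ∘ (true ∷_)) (p ∘ (true ∷_)) x) (≤+ˡ (E (g ∘ (false ∷_))) (∫-nonNeg (EF n) (p ∘ (false ∷_)))))) (≤-reflexive (sym (cubeF-∷ g))))

-- Each point has weight `2^-n` in the average, so vanishing energy would force both values 0 and 1
-- to equal `c`; but `2(1-c)² + 2c² = 1 + (1-2c)²`.
energy>0 : ∀ {n} (φ : Cube n → Bool) c x y → φ x ≢ φ y → ¬ (energy (centred φ c) ≤ 0ℚ)
energy>0 {n} φ c x y φx≢φy V≤0 = go (φ x) (φ y) φx≢φy (small x) (small y)
  where
  small : ∀ x → centred φ c x ² ≤ 0ℚ
  small x = ≤-trans (≤-reflexive (begin
    s                              ≡⟨ sym (*-identityˡ s) ⟩
    1ℚ * s                         ≡⟨ cong (_* s) (sym (2^*½^ n)) ⟩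
    (2ℚ ^ℚ n) * (½ ^ℚ n) * s       ≡⟨ *-assoc (2ℚ ^ℚ n) (½ ^ℚ n) s ⟩
    (2ℚ ^ℚ n) * ((½ ^ℚ n) * s)     ∎)) (≤-trans (*-monoˡ (2ℚ ^ℚ n) (0≤2^ n) (≤-trans (E-≥-point (λ x → centred φ c x ²) (λ x → 0≤sq (centred φ c x)) x) V≤0)) (≤-reflexive (*-zeroʳ (2ℚ ^ℚ n))))
    where
    open ≡-Reasoning
    s = centred φ c x ²
  absurd : (1ℚ - c) ² ≤ 0ℚ → (0ℚ - c) ² ≤ 0ℚ → ⊥
  absurd p q = <-irrefl refl (<-≤-trans (positive⁻¹ 1ℚ) (≤-trans
    (≤-gap ((1ℚ - c + (0ℚ - c)) ²) (0≤sq (1ℚ - c + (0ℚ - c)))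
      (solve 1 (λ c → con 2ℚ :* ((con 1ℚ :- c) :* (con 1ℚ :- c) :+ (con 0ℚ :- c) :* (con 0ℚ :- c)) := con 1ℚ :+ (con 1ℚ :- c :+ (con 0ℚ :- c)) :* (con 1ℚ :- c :+ (con 0ℚ :- c))) refl c))
    (*-monoˡ 2ℚ 0≤2 (+-mono-≤ p q))))
  go : ∀ a b → a ≢ b → (val a - c) ² ≤ 0ℚ → (val b - c) ² ≤ 0ℚ → ⊥
  go true true a≢b _ _ = a≢b refl
  go false false a≢b _ _ = a≢b refl
  go true false _ p q = absurd p q
  go false true _ p q = absurd q p

-- Poincaré's inequality: every non-empty set has weight at least 1 in the influence.
energy≤influence : ∀ {n} (f : Cube n → ℚ) → (∀ T → card T ≡ 0 → hat f T ≡ 0ℚ) → energy f ≤ influence f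
energy≤influence f f∅ = ≤-trans (≤-reflexive (sym (parseval f))) (∫-mono (ΣF _) (λ T → point T (card T) refl))
  where
  point : ∀ T t → card T ≡ t → hat f T ² ≤ ι (card T) * hat f T ²
  point T zero e = ≤-trans (≤-reflexive (trans (cong _² (f∅ T e)) (*-zeroˡ 0ℚ))) (0≤* (ι-nonNeg (card T)) (0≤sq (hat f T)))
  point T (suc t) e = ≤-trans (≤-reflexive (sym (*-identityˡ (hat f T ²)))) (*-monoʳ (hat f T ²) (0≤sq (hat f T)) (≤-trans (≤+ʳ {1ℚ} (ι t) (ι-nonNeg t)) (≤-reflexive (cong ι (sym e)))))

influence≤ : ∀ {n} (f : Cube n → ℚ) → influence f ≤ ι n * energy f
influence≤ {n} f = ≤-trans (∫-mono (ΣF n) (λ T → *-monoʳ (hat f T ²) (0≤sq (hat f T)) (ι-mono (card-≤ T)))) (≤-reflexive (trans (∫-*ˡ (ΣF n) (ι n) _) (cong (ι n *_) (parseval f))))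

-- Extraction of the large coefficient

-- Descent from an a priori bound, whose `N` serves as fuel. The lower bound `2 ≤ x` yields `1 ≤ q`,
-- by which `exponent≤` absorbs its additive constant.
binary-log : ∀ N x → 2ℚ ≤ x → x ≤ 2ℚ ^ℚ suc N → Σ ℕ λ q → 1 ℕ.≤ q × 2ℚ ^ℚ q ≤ x × x ≤ 2ℚ ^ℚ suc q
binary-log zero x 2≤x x≤ = 1 , ℕ.s≤s ℕ.z≤n , 2≤x , ≤-trans x≤ (2^-mono {1} {2} (ℕ.s≤s ℕ.z≤n))
binary-log (suc N) x 2≤x x≤ with ≤-total x (2ℚ ^ℚ suc N)
... | inj₁ p = binary-log N x 2≤x p
... | inj₂ p = suc N , ℕ.s≤s ℕ.z≤n , p , x≤

search : ∀ {n} {P : Cube n → Set} → (∀ S → Dec (P S)) → Σ (Cube n) P ⊎ (∀ S → ¬ P S)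
search {zero} P? with P? []
... | yes p = inj₁ ([] , p)
... | no ¬p = inj₂ (λ { [] → ¬p })
search {suc n} P? with search (P? ∘ (false ∷_)) | search (P? ∘ (true ∷_))
... | inj₁ (S , p) | _ = inj₁ (false ∷ S , p)
... | inj₂ _ | inj₁ (S , p) = inj₁ (true ∷ S , p)
... | inj₂ p | inj₂ q = inj₂ (λ { (false ∷ S) → p S ; (true ∷ S) → q S })

÷₀-* : ∀ p q → q ≢ 0ℚ → (p ÷₀ q) * q ≡ p
÷₀-* p q q≢0 with q ≟ 0ℚ
... | yes e = ⊥-elim (q≢0 e)
... | no r = trans (*-assoc p (1/_ q {{≢-nonZero r}}) q) (trans (cong (p *_) (*-inverseˡ q {{≢-nonZero r}})) (*-identityʳ p))

*-↧ : ∀ p → 0ℚ ≤ p → p * fromℕ (↧ₙ p) ≡ fromℕ ∣ ↥ p ∣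
*-↧ (mkℚ ℤ.-[1+ _ ] _ _) (*≤* ())
*-↧ p@(mkℚ (ℤ.+ n) d _) _ = trans (cong (p *_) (fromℕ≡integral (suc d))) (trans (toℚᵘ-injective (ℚᵘₚ.≃-trans (toℚᵘ-homo-* p (integral (suc d))) (ℚᵘ.*≡*
  (trans (ℤₚ.*-identityʳ (ℤ.+ n ℤ.* ℤ.+ suc d)) (cong (λ a → ℤ.+ n ℤ.* ℤ.+ a) (sym (ℕₚ.*-identityʳ (suc d)))))))) (sym (fromℕ≡integral n)))

ι-* : ∀ a b → ι (a ℕ.* b) ≡ ι a * ι b
ι-* zero b = sym (*-zeroˡ (ι b))
ι-* (suc a) b = trans (ι-+ b (a ℕ.* b)) (trans (cong (ι b +_) (ι-* a b)) (solve 2 (λ a b → b :+ a :* b := (con 1ℚ :+ a) :* b) refl (ι a) (ι b)))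

ι-cancel-≤ : ∀ a b → ι a ≤ ι b → a ℕ.≤ b
ι-cancel-≤ a b p with a ℕ.≤? b
... | yes q = q
... | no ¬q = ⊥-elim (<-irrefl refl (<-≤-trans (positive⁻¹ 1ℚ) (≤-gap (ι b - ι a + (ι a - ι (suc b)))
    (0≤+ (gap-≤ p) (gap-≤ (ι-mono (ℕₚ.≰⇒> ¬q)))) (solve 2 (λ a b → con 0ℚ := con 1ℚ :+ (b :- a :+ (a :- (con 1ℚ :+ b)))) refl (ι a) (ι b)))))

module _ {n : ℕ} (φ : Cube n → Bool) (nc : NonConstant φ) where
  private
    f = centred φ (mean φ)
    V = energy f
    I = influence f
    Ĩ = tildeI φ

    V≰0 : ¬ (V ≤ 0ℚ)
    V≰0 = energy>0 φ (mean φ) (proj₁ nc) (proj₁ (proj₂ nc)) (proj₂ (proj₂ nc))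

    f∅ : ∀ T → card T ≡ 0 → hat f T ≡ 0ℚ
    f∅ = hat-centred-∅ φ

    Ĩ*V : Ĩ * V ≡ I
    Ĩ*V = trans (cong₂ (λ a b → (a ÷₀ b) * V) (Inf≡influence φ) (var≡energy φ)) (÷₀-* I V (λ e → V≰0 (≤-reflexive e)))

    cancel-V : ∀ a b → a * V ≤ b * V → a ≤ b
    cancel-V a b = *-cancelʳ-≤-pos V {{positive (≰⇒> V≰0)}}

  1≤tildeI : 1ℚ ≤ tildeI φ
  1≤tildeI = cancel-V 1ℚ Ĩ (≤-trans (≤-reflexive (*-identityˡ V)) (≤-trans (energy≤influence f f∅) (≤-reflexive (sym Ĩ*V))))

  private
    tildeI≤n : Ĩ ≤ ι n
    tildeI≤n = cancel-V Ĩ (ι n) (≤-trans (≤-reflexive Ĩ*V) (influence≤ f))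

    scale : Σ ℕ λ q → 1 ℕ.≤ q × 2ℚ ^ℚ q ≤ 1ℚ + Ĩ × 1ℚ + Ĩ ≤ 2ℚ ^ℚ suc q
    scale = binary-log n (1ℚ + Ĩ) (+-monoʳ-≤ 1ℚ 1≤tildeI) (≤-trans (+-monoʳ-≤ 1ℚ tildeI≤n) (ι≤2^ (suc n)))

  -- The left side is 1 instead of the variance: the min-entropy bound needs it in this form, and
  -- the other bound follows because the variance is at most 1.
  heavy-coefficient : Σ (Cube n) λ S → NonEmpty S × ι (card S) ≤ ι 8 * tildeI φ
    × 1ℚ ≤ (fhat φ S ^ℚ 2) * ((1ℚ + tildeI φ) ^ℚ (939 ℕ.* card S))
  -- All sets are tested, so the alternative to a witness is smallness of every relevant
  -- coefficient, which `spread⇒constant` refutes; no classical step is involved.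
  heavy-coefficient = let q , 1≤q , 2^q≤x , x≤2^1+q = scale in go q 1≤q 2^q≤x x≤2^1+q (search (Good? q))
    where
    Good : ℕ → Cube n → Set
    Good q S = NonEmpty S × card S ℕ.≤ 2 ℕ.^ (q ℕ.+ 2) × 1ℚ ≤ (fhat φ S ^ℚ 2) * ((1ℚ + Ĩ) ^ℚ (939 ℕ.* card S))
    Good? : ∀ q S → Dec (Good q S)
    Good? q S = (1 ℕ.≤? card S) ×-dec (card S ℕ.≤? 2 ℕ.^ (q ℕ.+ 2)) ×-dec (1ℚ ≤? (fhat φ S ^ℚ 2) * ((1ℚ + Ĩ) ^ℚ (939 ℕ.* card S)))
    go : ∀ q → 1 ℕ.≤ q → 2ℚ ^ℚ q ≤ 1ℚ + Ĩ → 1ℚ + Ĩ ≤ 2ℚ ^ℚ suc q → Σ (Cube n) (Good q) ⊎ (∀ S → ¬ Good q S) →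
      Σ (Cube n) λ S → NonEmpty S × ι (card S) ≤ ι 8 * Ĩ × 1ℚ ≤ (fhat φ S ^ℚ 2) * ((1ℚ + Ĩ) ^ℚ (939 ℕ.* card S))
    go q 1≤q 2^q≤x x≤ (inj₁ (S , 1≤s , s≤m , big)) = S , 1≤s , s≤8Ĩ , big
      where
      open ≤-Reasoning
      s≤8Ĩ : ι (card S) ≤ ι 8 * Ĩ
      s≤8Ĩ = begin
        ι (card S) ≤⟨ ι-mono s≤m ⟩
        ι (2 ℕ.^ (q ℕ.+ 2)) ≡⟨ trans (ι-2^ (q ℕ.+ 2)) (^-+ 2ℚ q 2) ⟩
        (2ℚ ^ℚ q) * (2ℚ ^ℚ 2) ≤⟨ *-monoʳ (2ℚ ^ℚ 2) (0≤2^ 2) 2^q≤x ⟩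
        -- `1 ≤ Ĩ` turns `4 * (1 + Ĩ)` into `8 * Ĩ`, the source of the constant 8.
        (1ℚ + Ĩ) * (2ℚ ^ℚ 2) ≤⟨ *-monoʳ (2ℚ ^ℚ 2) (0≤2^ 2) (+-monoˡ-≤ Ĩ 1≤tildeI) ⟩
        (Ĩ + Ĩ) * (2ℚ ^ℚ 2) ≡⟨ solve 1 (λ a → (a :+ a) :* con (2ℚ ^ℚ 2) := con (ι 8) :* a) refl Ĩ ⟩
        ι 8 * Ĩ ∎
    go q 1≤q 2^q≤x x≤ (inj₂ none) = ⊥-elim (V≰0 (spread⇒constant φ (mean φ) q 1≤q (0≤mean φ) (mean≤1 φ) f∅ I≤ spread))
      where
      I≤ : I ≤ (2ℚ ^ℚ suc q) * V
      I≤ = ≤-trans (≤-reflexive (sym Ĩ*V)) (*-monoʳ V (energy-nonNeg f) (≤-trans (≤+ˡ {Ĩ} 1ℚ 0≤1) x≤))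
      powers : ∀ t → 2ℚ ^ℚ (q ℕ.* 939 ℕ.* t) ≤ (1ℚ + Ĩ) ^ℚ (939 ℕ.* t)
      powers t = ≤-trans (≤-reflexive (trans (cong (2ℚ ^ℚ_) (ℕₚ.*-assoc q 939 t)) (^-* 2ℚ q (939 ℕ.* t)))) (^-monoˡ (0≤2^ q) 2^q≤x (939 ℕ.* t))
      spread : ∀ T → 1 ℕ.≤ card T → card T ℕ.≤ 2 ℕ.^ (q ℕ.+ 2) → hat f T ² * (2ℚ ^ℚ (q ℕ.* 939 ℕ.* card T)) ≤ 1ℚ
      spread T 1≤t t≤m = ≤-trans (*-monoˡ (hat f T ²) (0≤sq (hat f T)) (powers (card T)))
        (≤-trans (≤-reflexive (cong (_* ((1ℚ + Ĩ) ^ℚ (939 ℕ.* card T))) (trans (cong _² (hat-centred-nonempty φ (mean φ) T 1≤t)) (sym (cong (fhat φ T *_) (*-identityʳ (fhat φ T)))))))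
          (<⇒≤ (≰⇒> (λ p → none T (1≤t , t≤m , p)))))

  coefficient-bound : Σ (Cube n) λ S → NonEmpty S
    × (fromℕ (card S) ≤ fromℕ 8 * tildeI φ)
    × (var φ ≤ (fhat φ S ^ℚ 2) * ((1ℚ + tildeI φ) ^ℚ (939 ℕ.* card S)))
  coefficient-bound = let S , 1≤s , s≤ , big = heavy-coefficient in
    S , 1≤s , ≤-trans (≤-reflexive (fromℕ≡ι (card S))) s≤ ,
    ≤-trans (≤-reflexive (var≡energy φ)) (≤-trans (energy≤1 φ (mean φ) (0≤mean φ) (mean≤1 φ)) big)

  -- With `Ĩ = m / d`, the `d`-th power of the coefficient bound has exponent `939 * card S * d`,
  -- and `card S ≤ 8 * Ĩ` makes this at most `939 * 8 * m`. Clearing the denominator avoids rational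
  -- exponents; taking logarithms and dividing by `d` gives the bound on the min-entropy.
  minEntropy-bound : Σ (Cube n) λ S →
    1ℚ ≤ (fhat φ S ^ℚ (2 ℕ.* (↧ₙ tildeI φ))) * ((1ℚ + tildeI φ) ^ℚ (939 ℕ.* 8 ℕ.* ∣ ↥ tildeI φ ∣))
  minEntropy-bound = let S , _ , s≤ , big = heavy-coefficient in S , go S s≤ big
    where
    d = ↧ₙ Ĩ
    m = ∣ ↥ Ĩ ∣
    1≤x : 1ℚ ≤ 1ℚ + Ĩ
    1≤x = ≤+ʳ Ĩ (≤-trans 0≤1 1≤tildeI)
    go : ∀ S → ι (card S) ≤ ι 8 * Ĩ → 1ℚ ≤ (fhat φ S ^ℚ 2) * ((1ℚ + Ĩ) ^ℚ (939 ℕ.* card S)) →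
      1ℚ ≤ (fhat φ S ^ℚ (2 ℕ.* d)) * ((1ℚ + Ĩ) ^ℚ (939 ℕ.* 8 ℕ.* m))
    go S s≤ big = begin
      1ℚ ≤⟨ 1≤^ big d ⟩
      (F * ((1ℚ + Ĩ) ^ℚ (939 ℕ.* s))) ^ℚ d ≡⟨ ^-distrib-* F ((1ℚ + Ĩ) ^ℚ (939 ℕ.* s)) d ⟩
      (F ^ℚ d) * (((1ℚ + Ĩ) ^ℚ (939 ℕ.* s)) ^ℚ d) ≡⟨ cong₂ _*_ (sym (^-* (fhat φ S) 2 d)) (sym (^-* (1ℚ + Ĩ) (939 ℕ.* s) d)) ⟩
      (fhat φ S ^ℚ (2 ℕ.* d)) * ((1ℚ + Ĩ) ^ℚ (939 ℕ.* s ℕ.* d))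
        ≤⟨ *-monoˡ (fhat φ S ^ℚ (2 ℕ.* d)) (subst (0ℚ ≤_) (sym (^-* (fhat φ S) 2 d)) (^-nonNeg 0≤F d)) (^-monoʳ 1≤x exps) ⟩
      (fhat φ S ^ℚ (2 ℕ.* d)) * ((1ℚ + Ĩ) ^ℚ (939 ℕ.* 8 ℕ.* m)) ∎
      where
      open ≤-Reasoning
      s = card S
      F = fhat φ S ^ℚ 2
      0≤F : 0ℚ ≤ F
      0≤F = subst (0ℚ ≤_) (sym (cong (fhat φ S *_) (*-identityʳ (fhat φ S)))) (0≤sq (fhat φ S))
      sd≤8m : s ℕ.* d ℕ.≤ 8 ℕ.* m
      sd≤8m = ι-cancel-≤ (s ℕ.* d) (8 ℕ.* m) (begin
        ι (s ℕ.* d) ≡⟨ ι-* s d ⟩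
        ι s * ι d ≤⟨ *-monoʳ (ι d) (ι-nonNeg d) s≤ ⟩
        ι 8 * Ĩ * ι d ≡⟨ *-assoc (ι 8) Ĩ (ι d) ⟩
        ι 8 * (Ĩ * ι d) ≡⟨ cong (ι 8 *_) (trans (cong (Ĩ *_) (sym (fromℕ≡ι d))) (trans (*-↧ Ĩ (≤-trans 0≤1 1≤tildeI)) (fromℕ≡ι m))) ⟩
        ι 8 * ι m ≡⟨ sym (ι-* 8 m) ⟩
        ι (8 ℕ.* m) ∎)
      exps : 939 ℕ.* s ℕ.* d ℕ.≤ 939 ℕ.* 8 ℕ.* m
      exps = subst₂ ℕ._≤_ (sym (ℕₚ.*-assoc 939 s d)) (sym (ℕₚ.*-assoc 939 8 m)) (ℕₚ.*-monoʳ-≤ 939 sd≤8m)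

-- Both estimates are squared and free of logarithms: `(1 + Ĩ)^(-D * card S)` is the exponential of
-- `-D * card S * log (1 + Ĩ)`, so `C = D / (2 log 2)` serves in the lower bound for the
-- coefficient.
theorem1p1 : (Σ ℕ λ D → Σ ℕ λ C′ → (n : ℕ) → (f : Cube n → Bool) → NonConstant f →
    Σ (Cube n) λ S → NonEmpty S
    × (fromℕ (card S) ≤ fromℕ C′ * tildeI f)
    × (var f ≤ (fhat f S ^ℚ 2) * ((1ℚ + tildeI f) ^ℚ (D Data.Nat.* card S))))
    × (Σ ℕ λ K → (n : ℕ) → (f : Cube n → Bool) → NonConstant f →
    Σ (Cube n) λ S →
    1ℚ ≤ (fhat f S ^ℚ (2 Data.Nat.* (↧ₙ tildeI f)))
    * ((1ℚ + tildeI f) ^ℚ (K Data.Nat.* ∣ ↥ tildeI f ∣)))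
theorem1p1 = (939 , 8 , λ n f → coefficient-bound f) , (939 ℕ.* 8 , λ n f → minEntropy-bound f)
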